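{- For $n=4,5,\dots$, \[ N_{\rm bi}(n, 1) = n^{n-1} \sum_{2 \le k \le n/2}\dfrac{n !}{(n-2k)!\, n^{2k}}, \] and \[ N_{\rm bi}(n,1) \sim \sqrt{\dfrac{\pi}{8}}\, n^{n-1/2} \quad (n \to \infty). \]
   Context: For integers $r,s\ge 0$ and $k$, $N_{\rm bi}(r,s,k)$ is the number of connected bipartite simple graphs with labeled bipartition $V_1\sqcup V_2$, $|V_1|=r$, $|V_2|=s$, having exactly $r+s+k-1$ edges; equivalently, the number of connected spanning subgraphs of the complete bipartite graph $K_{r,s}$ with $r+s+k-1$ edges (so the Betti number is $k$). Conventions: if $rs=0$, then $N_{\rm bi}(r,s,k)=1$ if $k=0$ and $(r,s)\in\{(1,0),(0,1)\}$, and $0$ otherwise. Define \[ N_{\rm bi}(n,k) := \sum_{r+s=n}\binom{n}{r}N_{\rm bi}(r,s,k), \] which is the coefficient of $x^n/n!$ in $F_k(x,x)$, where $F_k(x,y)=\sum_{r,s\ge0}\frac{N_{\rm bi}(r,s,k)}{r!s!}x^ry^s$. Here $a_n\sim b_n$ means $a_n/b_n\to1$. -}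

module Defs where

open import Data.Fin.Base using (Fin)
import Data.Fin.Properties as Fin
open import Data.Fin.Subset using (Subset; inside; outside; _∈_; ∣_∣)
open import Data.Fin.Subset.Properties using (_∈?_)
open import Data.Integer.Base as ℤ using (ℤ; +_; 1ℤ; +≤+; +<+)
import Data.Integer.Properties as ℤ
open import Data.List.Base as List
  using (List; []; _∷_; [_]; length; map; filter; upTo; foldr; allFin;
         cartesianProduct; cartesianProductWith)
open import Data.List.Membership.Propositional using () renaming (_∈_ to _∈ₗ_)
open import Data.List.Membership.Propositional.Properties
  using (∈-filter⁺; ∈-filter⁻; ∈-cartesianProduct⁺; ∈-++⁺ˡ; ∈-++⁺ʳ; ∈-map⁺; ∈-allFin)
open import Data.List.Relation.Unary.Any using (here; there)
import Data.List.Relation.Unary.All as All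
open import Data.Nat.Base as ℕ using (ℕ; zero; suc; NonZero; s≤s; z≤n; _!)
open import Data.Nat.ListAction using (sum)
open import Data.Nat.Combinatorics using (_C_)
import Data.Nat.Properties as ℕ
open import Data.Nat.Tactic.RingSolver using () renaming (solve-∀ to ℕ-solve-∀)
open import Data.Product.Base using (Σ; ∃; _×_; _,_; proj₁; proj₂; uncurry)
open import Data.Rational.Base as ℚ using (ℚ; mkℚ; 0ℚ; 1ℚ; ½)
import Data.Rational.Properties as ℚ
open import Data.Rational.Solver using (module +-*-Solver)
open import Data.Rational.Unnormalised.Base as ℚᵘ using (mkℚᵘ; *≡*; *≤*)
import Data.Rational.Unnormalised.Properties as ℚᵘ
open import Data.Sum.Base using (_⊎_; inj₁; inj₂; [_,_]′)
import Data.Sum.Properties as Sum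
open import Data.Vec.Base as Vec using (Vec; lookup)
open import Function.Base using (_∘_)
open import Level using (0ℓ)
open import Relation.Binary.Construct.Closure.ReflexiveTransitive as Star
  using (Star; _◅_; _◅◅_) renaming (ε to done)
open import Relation.Binary.Core using (Rel)
open import Relation.Binary.Definitions using (Decidable; DecidableEquality)
open import Relation.Binary.PropositionalEquality
  using (_≡_; refl; sym; trans; cong; cong₂; subst; subst₂; module ≡-Reasoning)
open import Relation.Nullary using (yes; no; ¬_; contradiction)
open import Relation.Nullary.Decidable using (map′; _×-dec_; _⊎-dec_)
open import Relation.Unary using () renaming (Decidable to Decidable₁)

-- A simple bipartite graph with parts Fin r and Fin s, i.e. a spanning
-- subgraph of K_{r,s}: entry i is the set of neighbours of the left vertex i.
BiGraph : ℕ → ℕ → Set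
BiGraph r s = Vec (Subset s) r

Vertex : ℕ → ℕ → Set
Vertex r s = Fin r ⊎ Fin s

data Adj {r s} (G : BiGraph r s) : Vertex r s → Vertex r s → Set where
  left-right : ∀ {i j} → j ∈ lookup G i → Adj G (inj₁ i) (inj₂ j)
  right-left : ∀ {i j} → j ∈ lookup G i → Adj G (inj₂ j) (inj₁ i)

edgeCount : ∀ {r s} → BiGraph r s → ℕ
edgeCount = Vec.sum ∘ Vec.map ∣_∣

-- The empty graph is not connected, so that there is no connected graph
-- with r = s = 0.
Connected : ∀ {r s} → BiGraph r s → Set
Connected {r} {s} G = (0 ℕ.< r ℕ.+ s) × (∀ u v → Star (Adj G) u v)

module _ {A : Set} (_≟_ : DecidableEquality A) where

  private
    _⟶[_]_ : A → List (A × A) → A → Set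
    u ⟶[ es ] v = Star (λ a b → (a , b) ∈ₗ es) u v

    -- A walk either avoids the arc a → b, or can be cut at its first and
    -- last uses of that arc.
    split : ∀ {a b es u v} → u ⟶[ (a , b) ∷ es ] v →
            (u ⟶[ es ] v) ⊎ ((u ⟶[ es ] a) × (b ⟶[ es ] v))
    split done = inj₁ done
    split (here refl ◅ w) with split w
    ... | inj₁ w′       = inj₂ (done , w′)
    ... | inj₂ (_ , w′) = inj₂ (done , w′)
    split (there e ◅ w) with split w
    ... | inj₁ w′        = inj₁ (e ◅ w′)
    ... | inj₂ (w₁ , w₂) = inj₂ (e ◅ w₁ , w₂)

    join : ∀ {a b es u v} →
           (u ⟶[ es ] v) ⊎ ((u ⟶[ es ] a) × (b ⟶[ es ] v)) → u ⟶[ (a , b) ∷ es ] v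
    join (inj₁ w)         = Star.map there w
    join (inj₂ (w₁ , w₂)) = Star.map there w₁ ◅◅ (here refl ◅ Star.map there w₂)

    walk? : ∀ es → Decidable (λ u v → u ⟶[ es ] v)
    walk? [] u v = map′ (λ { refl → done }) (λ { done → refl }) (u ≟ v)
    walk? ((a , b) ∷ es) u v =
      map′ join split (walk? es u v ⊎-dec (walk? es u a ×-dec walk? es b v))

  star? : {R : Rel A 0ℓ} → Decidable R → (xs : List A) → (∀ x → x ∈ₗ xs) → Decidable (Star R)
  star? {R} R? xs full u v =
    map′ (Star.map λ e → proj₂ (∈-filter⁻ R×? {xs = pairs} e))
         (Star.map λ {a} {b} r → ∈-filter⁺ R×? (∈-cartesianProduct⁺ (full a) (full b)) r)
         (walk? (filter R×? pairs) u v)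
    where
    pairs = cartesianProduct xs xs
    R×? : Decidable₁ (uncurry R)
    R×? (a , b) = R? a b

module _ {r s : ℕ} where

  vertices : List (Vertex r s)
  vertices = map inj₁ (allFin r) List.++ map inj₂ (allFin s)

  ∈-vertices : ∀ v → v ∈ₗ vertices
  ∈-vertices (inj₁ i) = ∈-++⁺ˡ (∈-map⁺ inj₁ (∈-allFin i))
  ∈-vertices (inj₂ j) = ∈-++⁺ʳ (map inj₁ (allFin r)) (∈-map⁺ inj₂ (∈-allFin j))

  adj? : (G : BiGraph r s) → Decidable (Adj G)
  adj? G (inj₁ i) (inj₁ _) = no λ ()
  adj? G (inj₁ i) (inj₂ j) = map′ left-right (λ { (left-right p) → p }) (j ∈? lookup G i)
  adj? G (inj₂ j) (inj₁ i) = map′ right-left (λ { (right-left p) → p }) (j ∈? lookup G i)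
  adj? G (inj₂ _) (inj₂ _) = no λ ()

  connected? : Decidable₁ (Connected {r} {s})
  connected? G = (0 ℕ.<? r ℕ.+ s) ×-dec
    map′ (λ h u v → All.lookup (All.lookup h (∈-vertices u)) (∈-vertices v))
         (λ h → All.tabulate λ {u} _ → All.tabulate λ {v} _ → h u v)
         (All.all? (λ u → All.all? (λ v → star? (Sum.≡-dec Fin._≟_ Fin._≟_) (adj? G)
                                              vertices ∈-vertices u v) vertices) vertices)

-- All vectors with entries from a list; without repetitions if the list has none.
vectors : ∀ {A : Set} → List A → ∀ n → List (Vec A n)
vectors xs zero    = [ Vec.[] ]
vectors xs (suc n) = cartesianProductWith Vec._∷_ xs (vectors xs n)

allBiGraphs : ∀ r s → List (BiGraph r s)
allBiGraphs r s = vectors (vectors (outside ∷ inside ∷ []) s) r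

IsCounted : ∀ {r s} → ℤ → BiGraph r s → Set
IsCounted {r} {s} k G = Connected G × (+ edgeCount G ≡ + r ℤ.+ + s ℤ.+ k ℤ.- 1ℤ)

isCounted? : ∀ {r s} k → Decidable₁ (IsCounted {r} {s} k)
isCounted? {r} {s} k G = connected? G ×-dec (+ edgeCount G ℤ.≟ + r ℤ.+ + s ℤ.+ k ℤ.- 1ℤ)

N-bi₂ : ℕ → ℕ → ℤ → ℕ
N-bi₂ r s k = length (filter (isCounted? k) (allBiGraphs r s))

N-bi : ℕ → ℤ → ℕ
N-bi n k = sum (map (λ r → (n C r) ℕ.* N-bi₂ r (n ℕ.∸ r) k) (upTo (suc n)))

∑[_⋯_] : ℕ → ℕ → (ℕ → ℚ) → ℚ
∑[ a ⋯ b ] f = foldr (λ k q → f k ℚ.+ q) 0ℚ (map (a ℕ.+_) (upTo (suc b ℕ.∸ a)))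

fromℕℚ : ℕ → ℚ
fromℕℚ n = + n ℚ./ 1

term : (n : ℕ) .{{_ : NonZero n}} → ℕ → ℚ
term n k = (+ (n !)) ℚ./ ((n ℕ.∸ 2 ℕ.* k) ! ℕ.* n ℕ.^ (2 ℕ.* k))
  where instance
    _ = ℕ.m*n≢0 ((n ℕ.∸ 2 ℕ.* k) !) (n ℕ.^ (2 ℕ.* k))
          {{(n ℕ.∸ 2 ℕ.* k) ℕ.!≢0}} {{ℕ.m^n≢0 n (2 ℕ.* k)}}

open +-*-Solver using (solve; _:=_; _:+_; _:*_; _:-_; :-_; con)

module ℚ-Lemmas where

  ∣-∣-swap : ∀ p q → ℚ.∣ p ℚ.- q ∣ ≡ ℚ.∣ q ℚ.- p ∣
  ∣-∣-swap p q = trans (sym (ℚ.∣-p∣≡∣p∣ (p ℚ.- q)))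
    (cong ℚ.∣_∣ (solve 2 (λ p q → :- (p :- q) := q :- p) refl p q))

  p≤∣p∣ : ∀ p → p ℚ.≤ ℚ.∣ p ∣
  p≤∣p∣ p with ℚ.≤-total 0ℚ p
  ... | inj₁ 0≤p = ℚ.≤-reflexive (sym (ℚ.0≤p⇒∣p∣≡p 0≤p))
  ... | inj₂ p≤0 = ℚ.≤-trans p≤0 (ℚ.0≤∣p∣ p)

  ∣-∣<-intro : ∀ {p q ε} → p ℚ.< q ℚ.+ ε → q ℚ.< p ℚ.+ ε → ℚ.∣ p ℚ.- q ∣ ℚ.< ε
  ∣-∣<-intro {p} {q} {ε} p<q+ε q<p+ε with ℚ.∣p∣≡p∨∣p∣≡-p (p ℚ.- q)
  ... | inj₁ eq = subst (ℚ._< ε) (sym eq)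
    (subst (p ℚ.- q ℚ.<_) (solve 2 (λ q ε → q :+ ε :- q := ε) refl q ε) (ℚ.+-monoˡ-< (ℚ.- q) p<q+ε))
  ... | inj₂ eq = subst (ℚ._< ε) (sym eq)
    (subst₂ ℚ._<_ (solve 2 (λ p q → q :- p := :- (p :- q)) refl p q)
                  (solve 2 (λ p ε → p :+ ε :- p := ε) refl p ε) (ℚ.+-monoˡ-< (ℚ.- p) q<p+ε))

  ∣-∣<-elim : ∀ {p q ε} → ℚ.∣ p ℚ.- q ∣ ℚ.< ε → p ℚ.< q ℚ.+ ε
  ∣-∣<-elim {p} {q} {ε} h =
    subst (ℚ._< q ℚ.+ ε) (solve 2 (λ p q → q :+ (p :- q) := p) refl p q)
      (ℚ.+-monoʳ-< q (ℚ.≤-<-trans (p≤∣p∣ (p ℚ.- q)) h))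

  ∣-∣-triangle : ∀ p q → ℚ.∣ p ∣ ℚ.≤ ℚ.∣ q ∣ ℚ.+ ℚ.∣ p ℚ.- q ∣
  ∣-∣-triangle p q = subst (λ z → ℚ.∣ z ∣ ℚ.≤ ℚ.∣ q ∣ ℚ.+ ℚ.∣ p ℚ.- q ∣)
    (solve 2 (λ p q → q :+ (p :- q) := p) refl p q)
    (ℚ.∣p+q∣≤∣p∣+∣q∣ q (p ℚ.- q))

  ∣-∣-subadditive : ∀ a b c d →
    ℚ.∣ (a ℚ.+ c) ℚ.- (b ℚ.+ d) ∣ ℚ.≤ ℚ.∣ a ℚ.- b ∣ ℚ.+ ℚ.∣ c ℚ.- d ∣
  ∣-∣-subadditive a b c d = subst (λ z → ℚ.∣ z ∣ ℚ.≤ ℚ.∣ a ℚ.- b ∣ ℚ.+ ℚ.∣ c ℚ.- d ∣)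
    (solve 4 (λ a b c d → (a :- b) :+ (c :- d) := (a :+ c) :- (b :+ d)) refl a b c d)
    (ℚ.∣p+q∣≤∣p∣+∣q∣ (a ℚ.- b) (c ℚ.- d))

  *-mono : ∀ {p q r t} → 0ℚ ℚ.≤ p → p ℚ.≤ q → 0ℚ ℚ.≤ r → r ℚ.≤ t → p ℚ.* r ℚ.≤ q ℚ.* t
  *-mono {p} {q} {r} {t} 0≤p p≤q 0≤r r≤t = ℚ.≤-trans
    (ℚ.*-monoʳ-≤-nonNeg r {{ℚ.nonNegative 0≤r}} p≤q)
    (ℚ.*-monoˡ-≤-nonNeg q {{ℚ.nonNegative (ℚ.≤-trans 0≤p p≤q)}} r≤t)

  0≤* : ∀ p q → 0ℚ ℚ.≤ p → 0ℚ ℚ.≤ q → 0ℚ ℚ.≤ p ℚ.* q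
  0≤* p q 0≤p 0≤q = subst (ℚ._≤ p ℚ.* q) (ℚ.*-zeroʳ p)
    (ℚ.*-monoˡ-≤-nonNeg p {{ℚ.nonNegative 0≤p}} 0≤q)

  ≤+ : ∀ p q → 0ℚ ℚ.≤ q → p ℚ.≤ p ℚ.+ q
  ≤+ p q 0≤q = subst (ℚ._≤ p ℚ.+ q) (ℚ.+-identityʳ p) (ℚ.+-monoʳ-≤ p 0≤q)

  *-pos : ∀ {p q} → 0ℚ ℚ.< p → 0ℚ ℚ.< q → 0ℚ ℚ.< p ℚ.* q
  *-pos {p} {q} 0<p 0<q = ℚ.positive⁻¹ (p ℚ.* q)
    {{ℚ.pos*pos⇒pos p {{ℚ.positive 0<p}} q {{ℚ.positive 0<q}}}}

  quotient : ∀ {c ε} → 0ℚ ℚ.< c → 0ℚ ℚ.< ε → ∃ λ δ → (0ℚ ℚ.< δ) × (c ℚ.* δ ≡ ε)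
  quotient {c} {ε} 0<c 0<ε = ε ℚ.* c⁻¹ , *-pos 0<ε (ℚ.positive⁻¹ c⁻¹ {{ℚ.1/pos⇒pos c {{ℚ.positive 0<c}}}}) ,
    trans (solve 3 (λ c ε i → c :* (ε :* i) := ε :* (c :* i)) refl c ε c⁻¹)
          (trans (cong (ε ℚ.*_) (ℚ.*-inverseʳ c {{c≢0}})) (ℚ.*-identityʳ ε))
    where
    c≢0 = ℚ.pos⇒nonZero c {{ℚ.positive 0<c}}
    c⁻¹ = (ℚ.1/ c) {{c≢0}}

  half-pos : ∀ {ε} → 0ℚ ℚ.< ε → 0ℚ ℚ.< ½ ℚ.* ε
  half-pos = *-pos (ℚ.positive⁻¹ ½)

  halves : ∀ ε → ½ ℚ.* ε ℚ.+ ½ ℚ.* ε ≡ ε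
  halves = solve 1 (λ ε → con ½ :* ε :+ con ½ :* ε := ε) refl

  half< : ∀ {ε} → 0ℚ ℚ.< ε → ½ ℚ.* ε ℚ.< ε
  half< {ε} 0<ε = subst₂ ℚ._<_ (ℚ.+-identityʳ (½ ℚ.* ε)) (halves ε)
    (ℚ.+-monoʳ-< (½ ℚ.* ε) (half-pos 0<ε))

  /-≃ : ∀ a d → ℚ.toℚᵘ (a ℚ./ suc d) ℚᵘ.≃ mkℚᵘ a d
  /-≃ a d = ℚ.toℚᵘ-fromℚᵘ (mkℚᵘ a d)

  /-≤ : ∀ {a b c d} → a ℕ.* suc d ℕ.≤ c ℕ.* suc b → + a ℚ./ suc b ℚ.≤ + c ℚ./ suc d
  /-≤ {a} {b} {c} {d} h = ℚ.toℚᵘ-cancel-≤ (ℚᵘ.≤-trans (ℚᵘ.≤-reflexive (/-≃ (+ a) b))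
    (ℚᵘ.≤-trans (*≤* (subst₂ ℤ._≤_ (ℤ.pos-* a (suc d)) (ℤ.pos-* c (suc b)) (+≤+ h)))
                (ℚᵘ.≤-reflexive (ℚᵘ.≃-sym (/-≃ (+ c) d)))))

  /-* : ∀ a b c d → (+ a ℚ./ suc b) ℚ.* (+ c ℚ./ suc d) ≡ + (a ℕ.* c) ℚ./ (suc b ℕ.* suc d)
  /-* a b c d = ℚ.toℚᵘ-injective (ℚᵘ.≃-trans (ℚ.toℚᵘ-homo-* (+ a ℚ./ suc b) (+ c ℚ./ suc d))
    (ℚᵘ.≃-trans (ℚᵘ.*-cong (/-≃ (+ a) b) (/-≃ (+ c) d))
    (ℚᵘ.≃-trans (*≡* (cong (ℤ._* + (suc b ℕ.* suc d)) (sym (ℤ.pos-* a c))))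
                (ℚᵘ.≃-sym (/-≃ (+ (a ℕ.* c)) _)))))

  /-suc : ∀ k n → + suc k ℚ./ suc n ≡ (+ k ℚ./ suc n) ℚ.+ (+ 1 ℚ./ suc n)
  /-suc k n = ℚ.toℚᵘ-injective (ℚᵘ.≃-trans (/-≃ (+ suc k) n)
    (ℚᵘ.≃-sym (ℚᵘ.≃-trans (ℚ.toℚᵘ-homo-+ (+ k ℚ./ suc n) (+ 1 ℚ./ suc n))
    (ℚᵘ.≃-trans (ℚᵘ.+-cong (/-≃ (+ k) n) (/-≃ (+ 1) n)) (*≡* eq)))))
    where
    open ≡-Reasoning
    d = + suc n
    eq : (+ k ℤ.* d ℤ.+ + 1 ℤ.* d) ℤ.* d ≡ + suc k ℤ.* (d ℤ.* d)
    eq = begin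
      (+ k ℤ.* d ℤ.+ + 1 ℤ.* d) ℤ.* d ≡⟨ cong (ℤ._* d) (sym (ℤ.*-distribʳ-+ d (+ k) (+ 1))) ⟩
      (+ k ℤ.+ + 1) ℤ.* d ℤ.* d       ≡⟨ cong (λ x → + x ℤ.* d ℤ.* d) (ℕ.+-comm k 1) ⟩
      + suc k ℤ.* d ℤ.* d             ≡⟨ ℤ.*-assoc (+ suc k) d d ⟩
      + suc k ℤ.* (d ℤ.* d)           ∎

  0≤/ : ∀ k n → 0ℚ ℚ.≤ + k ℚ./ suc n
  0≤/ k n = /-≤ {0} {0} {k} {n} z≤n

  archimedean : ∀ {h} → 0ℚ ℚ.< h → ∃ λ N → ∀ n → N ℕ.≤ n → + 1 ℚ./ suc n ℚ.≤ h
  archimedean {h@(mkℚ (+ zero) d _)} (ℚ.*<* (+<+ ()))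
  archimedean {h@(mkℚ (+ suc p) d _)} _ = d , λ n d≤n →
    subst (+ 1 ℚ./ suc n ℚ.≤_) (ℚ.↥p/↧p≡p h)
      (/-≤ {1} {n} {suc p} {d} (ℕ.*-mono-≤ (s≤s (z≤n {p})) (s≤s d≤n)))
  archimedean {mkℚ ℤ.-[1+ _ ] d _} (ℚ.*<* ())

open ℚ-Lemmas

-- Real numbers are presented by Cauchy sequences of rationals; the
-- operations below act termwise on the approximations.
Cauchy : (ℕ → ℚ) → Set
Cauchy x = ∀ ε → 0ℚ ℚ.< ε → ∃ λ N → ∀ m n → N ℕ.≤ m → N ℕ.≤ n → ℚ.∣ x m ℚ.- x n ∣ ℚ.< ε

record ℝ : Set where
  constructor mkℝ
  field
    approx : ℕ → ℚ
    cauchy : Cauchy approx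

open ℝ public

infix  4 _<_ _#0
infixl 6 _+_ _-_
infixl 7 _*_
infix  8 -_ √_

_<_ : ℝ → ℝ → Set
x < y = ∃ λ δ → (0ℚ ℚ.< δ) × ∃ λ N → ∀ n → N ℕ.≤ n → approx x n ℚ.+ δ ℚ.≤ approx y n

_#0 : ℝ → Set
x #0 = ∃ λ δ → (0ℚ ℚ.< δ) × ∃ λ N → ∀ n → N ℕ.≤ n → δ ℚ.≤ ℚ.∣ approx x n ∣

fromℚ : ℚ → ℝ
fromℚ q = mkℝ (λ _ → q) λ ε 0<ε → 0 , λ _ _ _ _ →
  subst (λ z → ℚ.∣ z ∣ ℚ.< ε) (sym (ℚ.+-inverseʳ q)) 0<ε

fromℕ : ℕ → ℝ
fromℕ n = fromℚ (fromℕℚ n)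

_+_ : ℝ → ℝ → ℝ
x + y = mkℝ (λ n → approx x n ℚ.+ approx y n) λ ε 0<ε →
  let N₁ , h₁ = cauchy x (½ ℚ.* ε) (half-pos 0<ε)
      N₂ , h₂ = cauchy y (½ ℚ.* ε) (half-pos 0<ε)
  in N₁ ℕ.⊔ N₂ , λ m n m≥ n≥ → subst (_ ℚ.<_) (halves ε)
    (ℚ.≤-<-trans
      (∣-∣-subadditive (approx x m) (approx x n) (approx y m) (approx y n))
      (ℚ.+-mono-< (h₁ m n (ℕ.m⊔n≤o⇒m≤o N₁ N₂ m≥) (ℕ.m⊔n≤o⇒m≤o N₁ N₂ n≥))
                  (h₂ m n (ℕ.m⊔n≤o⇒n≤o N₁ N₂ m≥) (ℕ.m⊔n≤o⇒n≤o N₁ N₂ n≥))))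

-_ : ℝ → ℝ
- x = mkℝ (λ n → ℚ.- approx x n) λ ε 0<ε →
  let N , h = cauchy x ε 0<ε
  in N , λ m n m≥ n≥ → subst (λ z → ℚ.∣ z ∣ ℚ.< ε)
    (solve 2 (λ a b → b :- a := :- a :- :- b) refl (approx x m) (approx x n))
    (h n m n≥ m≥)

_-_ : ℝ → ℝ → ℝ
x - y = x + - y

abs : ℝ → ℝ
abs x = mkℝ (λ n → ℚ.∣ approx x n ∣) λ ε 0<ε →
  let N , h = cauchy x ε 0<ε
  in N , λ m n m≥ n≥ → ∣-∣<-intro
    (bound (approx x m) (approx x n) (h m n m≥ n≥)) (bound (approx x n) (approx x m) (h n m n≥ m≥))
  where
  bound : ∀ p q {ε} → ℚ.∣ p ℚ.- q ∣ ℚ.< ε → ℚ.∣ p ∣ ℚ.< ℚ.∣ q ∣ ℚ.+ ε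
  bound p q h = ℚ.≤-<-trans (∣-∣-triangle p q)
    (ℚ.+-monoʳ-< ℚ.∣ q ∣ h)

module Bounded where

  bounded : ∀ x → ∃ λ B → (0ℚ ℚ.≤ B) × ∃ λ N → ∀ n → N ℕ.≤ n → ℚ.∣ approx x n ∣ ℚ.≤ B
  bounded x =
    let N , h = cauchy (abs x) 1ℚ (ℚ.positive⁻¹ 1ℚ)
    in approx (abs x) N ℚ.+ 1ℚ
     , ℚ.+-mono-≤ (ℚ.0≤∣p∣ (approx x N)) (ℚ.nonNegative⁻¹ 1ℚ)
     , N , λ n n≥ → ℚ.<⇒≤ (∣-∣<-elim (h n N n≥ ℕ.≤-refl))

open Bounded

_*_ : ℝ → ℝ → ℝ
x * y = mkℝ (λ n → approx x n ℚ.* approx y n) λ ε 0<ε →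
  let B₁ , 0≤B₁ , M₁ , b₁ = bounded x
      B₂ , 0≤B₂ , M₂ , b₂ = bounded y
      0<C = ℚ.<-≤-trans (ℚ.positive⁻¹ 1ℚ)
              (subst (ℚ._≤ B₁ ℚ.+ B₂ ℚ.+ 1ℚ) (ℚ.+-identityˡ 1ℚ)
                (ℚ.+-monoˡ-≤ 1ℚ (ℚ.+-mono-≤ 0≤B₁ 0≤B₂)))
      δ , 0<δ , Cδ≡ε = quotient 0<C 0<ε
      N₁ , h₁ = cauchy x δ 0<δ
      N₂ , h₂ = cauchy y δ 0<δ
      M = M₁ ℕ.⊔ M₂
      N = N₁ ℕ.⊔ N₂
  in M ℕ.⊔ N , λ m n m≥ n≥ →
    let m≥M = ℕ.m⊔n≤o⇒m≤o M N m≥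
        n≥M = ℕ.m⊔n≤o⇒m≤o M N n≥
        m≥N = ℕ.m⊔n≤o⇒n≤o M N m≥
        n≥N = ℕ.m⊔n≤o⇒n≤o M N n≥
    in subst (_ ℚ.<_) Cδ≡ε (estimate {approx x m} {approx x n} {approx y m} {approx y n} 0<δ
         (b₁ m (ℕ.m⊔n≤o⇒m≤o M₁ M₂ m≥M)) (b₂ n (ℕ.m⊔n≤o⇒n≤o M₁ M₂ n≥M))
         (ℚ.<⇒≤ (h₁ m n (ℕ.m⊔n≤o⇒m≤o N₁ N₂ m≥N) (ℕ.m⊔n≤o⇒m≤o N₁ N₂ n≥N)))
         (ℚ.<⇒≤ (h₂ m n (ℕ.m⊔n≤o⇒n≤o N₁ N₂ m≥N) (ℕ.m⊔n≤o⇒n≤o N₁ N₂ n≥N))))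
  where
  estimate : ∀ {a b c d B₁ B₂ δ} → 0ℚ ℚ.< δ → ℚ.∣ a ∣ ℚ.≤ B₁ → ℚ.∣ d ∣ ℚ.≤ B₂ →
             ℚ.∣ a ℚ.- b ∣ ℚ.≤ δ → ℚ.∣ c ℚ.- d ∣ ℚ.≤ δ →
             ℚ.∣ a ℚ.* c ℚ.- b ℚ.* d ∣ ℚ.< (B₁ ℚ.+ B₂ ℚ.+ 1ℚ) ℚ.* δ
  estimate {a} {b} {c} {d} {B₁} {B₂} {δ} 0<δ a≤ d≤ ab cd = begin-strict
    ℚ.∣ a ℚ.* c ℚ.- b ℚ.* d ∣
      ≡⟨ cong ℚ.∣_∣ (solve 4 (λ a b c d → a :* c :- b :* d := a :* (c :- d) :+ d :* (a :- b)) refl a b c d) ⟩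
    ℚ.∣ a ℚ.* (c ℚ.- d) ℚ.+ d ℚ.* (a ℚ.- b) ∣
      ≤⟨ ℚ.∣p+q∣≤∣p∣+∣q∣ (a ℚ.* (c ℚ.- d)) (d ℚ.* (a ℚ.- b)) ⟩
    ℚ.∣ a ℚ.* (c ℚ.- d) ∣ ℚ.+ ℚ.∣ d ℚ.* (a ℚ.- b) ∣
      ≡⟨ cong₂ ℚ._+_ (ℚ.∣p*q∣≡∣p∣*∣q∣ a (c ℚ.- d)) (ℚ.∣p*q∣≡∣p∣*∣q∣ d (a ℚ.- b)) ⟩
    ℚ.∣ a ∣ ℚ.* ℚ.∣ c ℚ.- d ∣ ℚ.+ ℚ.∣ d ∣ ℚ.* ℚ.∣ a ℚ.- b ∣
      ≤⟨ ℚ.+-mono-≤ (*-mono (ℚ.0≤∣p∣ a) a≤ (ℚ.0≤∣p∣ (c ℚ.- d)) cd)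
                    (*-mono (ℚ.0≤∣p∣ d) d≤ (ℚ.0≤∣p∣ (a ℚ.- b)) ab) ⟩
    B₁ ℚ.* δ ℚ.+ B₂ ℚ.* δ
      ≡⟨ ℚ.+-identityʳ _ ⟨
    B₁ ℚ.* δ ℚ.+ B₂ ℚ.* δ ℚ.+ 0ℚ
      <⟨ ℚ.+-monoʳ-< (B₁ ℚ.* δ ℚ.+ B₂ ℚ.* δ) 0<δ ⟩
    B₁ ℚ.* δ ℚ.+ B₂ ℚ.* δ ℚ.+ δ
      ≡⟨ solve 3 (λ p q δ → p :* δ :+ q :* δ :+ δ := (p :+ q :+ con 1ℚ) :* δ) refl B₁ B₂ δ ⟩
    (B₁ ℚ.+ B₂ ℚ.+ 1ℚ) ℚ.* δ ∎
    where open ℚ.≤-Reasoning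

-- Reciprocal with the junk value 0 at 0.
recipℚ : ℚ → ℚ
recipℚ q with q ℚ.≟ 0ℚ
... | yes _  = 0ℚ
... | no q≢0 = (ℚ.1/ q) {{ℚ.≢-nonZero q≢0}}

module Recip-Lemmas where

  recip-inverse : ∀ {q δ} → 0ℚ ℚ.< δ → δ ℚ.≤ ℚ.∣ q ∣ → recipℚ q ℚ.* q ≡ 1ℚ
  recip-inverse {q} 0<δ δ≤ with q ℚ.≟ 0ℚ
  ... | yes refl = contradiction (ℚ.<-≤-trans 0<δ δ≤) (ℚ.<-irrefl refl)
  ... | no q≢0   = ℚ.*-inverseˡ q {{ℚ.≢-nonZero q≢0}}

  recip-bound : ∀ {q δ D} → 0ℚ ℚ.< δ → δ ℚ.≤ ℚ.∣ q ∣ → δ ℚ.* D ≡ 1ℚ → ℚ.∣ recipℚ q ∣ ℚ.≤ D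
  recip-bound {q} {δ} {D} 0<δ δ≤ δD≡1 = ℚ.*-cancelˡ-≤-pos δ {{ℚ.positive 0<δ}} (begin
    δ ℚ.* ℚ.∣ recipℚ q ∣       ≤⟨ *-mono (ℚ.<⇒≤ 0<δ) δ≤ (ℚ.0≤∣p∣ (recipℚ q)) ℚ.≤-refl ⟩
    ℚ.∣ q ∣ ℚ.* ℚ.∣ recipℚ q ∣ ≡⟨ ℚ.*-comm ℚ.∣ q ∣ ℚ.∣ recipℚ q ∣ ⟩
    ℚ.∣ recipℚ q ∣ ℚ.* ℚ.∣ q ∣ ≡⟨ ℚ.∣p*q∣≡∣p∣*∣q∣ (recipℚ q) q ⟨
    ℚ.∣ recipℚ q ℚ.* q ∣       ≡⟨ cong ℚ.∣_∣ (recip-inverse 0<δ δ≤) ⟩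
    1ℚ                         ≡⟨ δD≡1 ⟨
    δ ℚ.* D                    ∎)
    where open ℚ.≤-Reasoning

  recip-estimate : ∀ {a b δ D η} → 0ℚ ℚ.< δ → 0ℚ ℚ.< D → δ ℚ.* D ≡ 1ℚ →
                   δ ℚ.≤ ℚ.∣ a ∣ → δ ℚ.≤ ℚ.∣ b ∣ → ℚ.∣ b ℚ.- a ∣ ℚ.< η →
                   ℚ.∣ recipℚ a ℚ.- recipℚ b ∣ ℚ.< (D ℚ.* D) ℚ.* η
  recip-estimate {a} {b} {δ} {D} {η} 0<δ 0<D δD≡1 δ≤a δ≤b ba = begin-strict
    ℚ.∣ recipℚ a ℚ.- recipℚ b ∣
      ≡⟨ cong ℚ.∣_∣ difference ⟩
    ℚ.∣ (recipℚ a ℚ.* recipℚ b) ℚ.* (b ℚ.- a) ∣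
      ≡⟨ trans (ℚ.∣p*q∣≡∣p∣*∣q∣ (recipℚ a ℚ.* recipℚ b) (b ℚ.- a))
               (cong (ℚ._* ℚ.∣ b ℚ.- a ∣) (ℚ.∣p*q∣≡∣p∣*∣q∣ (recipℚ a) (recipℚ b))) ⟩
    (ℚ.∣ recipℚ a ∣ ℚ.* ℚ.∣ recipℚ b ∣) ℚ.* ℚ.∣ b ℚ.- a ∣
      ≤⟨ ℚ.*-monoʳ-≤-nonNeg ℚ.∣ b ℚ.- a ∣ {{ℚ.∣-∣-nonNeg (b ℚ.- a)}}
           (*-mono (ℚ.0≤∣p∣ (recipℚ a)) (recip-bound 0<δ δ≤a δD≡1)
                   (ℚ.0≤∣p∣ (recipℚ b)) (recip-bound 0<δ δ≤b δD≡1)) ⟩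
    (D ℚ.* D) ℚ.* ℚ.∣ b ℚ.- a ∣
      <⟨ ℚ.*-monoʳ-<-pos (D ℚ.* D) {{ℚ.positive (*-pos 0<D 0<D)}} ba ⟩
    (D ℚ.* D) ℚ.* η ∎
    where
    open ℚ.≤-Reasoning
    ra = recipℚ a
    rb = recipℚ b
    difference : ra ℚ.- rb ≡ (ra ℚ.* rb) ℚ.* (b ℚ.- a)
    difference = sym (trans
      (solve 4 (λ a b ra rb → (ra :* rb) :* (b :- a) := ra :* (rb :* b) :- rb :* (ra :* a)) refl a b ra rb)
      (trans (cong₂ (λ u v → ra ℚ.* u ℚ.- rb ℚ.* v) (recip-inverse 0<δ δ≤b) (recip-inverse 0<δ δ≤a))
             (cong₂ ℚ._-_ (ℚ.*-identityʳ ra) (ℚ.*-identityʳ rb))))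

open Recip-Lemmas

recip : (x : ℝ) → x #0 → ℝ
recip x (δ , 0<δ , M , away) = mkℝ (λ n → recipℚ (approx x n)) λ ε 0<ε →
  let D , 0<D , δD≡1 = quotient 0<δ (ℚ.positive⁻¹ 1ℚ)
      η , 0<η , DDη≡ε = quotient (*-pos 0<D 0<D) 0<ε
      N , h = cauchy x η 0<η
  in M ℕ.⊔ N , λ m n m≥ n≥ → subst (_ ℚ.<_) DDη≡ε
    (recip-estimate 0<δ 0<D δD≡1
      (away m (ℕ.m⊔n≤o⇒m≤o M N m≥)) (away n (ℕ.m⊔n≤o⇒m≤o M N n≥))
      (h n m (ℕ.m⊔n≤o⇒n≤o M N n≥) (ℕ.m⊔n≤o⇒n≤o M N m≥)))

divide : (x y : ℝ) → y #0 → ℝ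
divide x y y#0 = x * recip y y#0

-- The largest k with 1 ≤ k ≤ b satisfying P, and 0 if there is none.
largest : ∀ {P : ℕ → Set} → Decidable₁ P → ℕ → ℕ
largest P? zero    = 0
largest P? (suc b) with P? (suc b)
... | yes _ = suc b
... | no  _ = largest P? b

square : ℚ → ℚ
square q = q ℚ.* q

RootBelow : ℕ → ℚ → ℕ → Set
RootBelow n q k = square (+ k ℚ./ suc n) ℚ.≤ q

rootBelow? : ∀ n q → Decidable₁ (RootBelow n q)
rootBelow? n q k = square (+ k ℚ./ suc n) ℚ.≤? q

-- ⌊(n+1) √max(q, 0)⌋; the search bound is large enough since
-- √q < |numerator of q| + 1.
rootNumerator : ℕ → ℚ → ℕ
rootNumerator n q = largest (rootBelow? n q) (suc ℤ.∣ ℚ.↥ q ∣ ℕ.* suc n)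

-- √max(q, 0) rounded down to a multiple of 1/(n+1).
sqrtℚ : ℕ → ℚ → ℚ
sqrtℚ n q = + rootNumerator n q ℚ./ suc n

module Sqrt-Lemmas where

  largest-holds : ∀ {P} (P? : Decidable₁ P) b → (largest P? b ≡ 0) ⊎ P (largest P? b)
  largest-holds P? zero = inj₁ refl
  largest-holds P? (suc b) with P? (suc b)
  ... | yes h = inj₂ h
  ... | no  _ = largest-holds P? b

  largest-maximal : ∀ {P} (P? : Decidable₁ P) b → ¬ P (suc b) → ¬ P (suc (largest P? b))
  largest-maximal P? zero h = h
  largest-maximal P? (suc b) h with P? (suc b)
  ... | yes _ = h
  ... | no ¬p = largest-maximal P? b ¬p

  q≤numerator : ∀ q → q ℚ.≤ fromℕℚ ℤ.∣ ℚ.↥ q ∣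
  q≤numerator q@(mkℚ (+ p) d _) = subst (ℚ._≤ fromℕℚ p) (ℚ.↥p/↧p≡p q)
    (/-≤ {p} {d} {p} {0} (ℕ.*-monoʳ-≤ p (s≤s z≤n)))
  q≤numerator (mkℚ ℤ.-[1+ p ] d _) = ℚ.≤-trans
    (ℚ.<⇒≤ (ℚ.negative⁻¹ _)) (0≤/ (suc p) 0)

  q<q+1 : ∀ q → q ℚ.< q ℚ.+ 1ℚ
  q<q+1 q = subst (ℚ._< q ℚ.+ 1ℚ) (ℚ.+-identityʳ q) (ℚ.+-monoʳ-< q (ℚ.positive⁻¹ 1ℚ))

  search-bound : ∀ n q → let t = + suc (suc ℤ.∣ ℚ.↥ q ∣ ℕ.* suc n) ℚ./ suc n in q ℚ.< square t
  search-bound n q = begin-strict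
    q                       ≤⟨ q≤numerator q ⟩
    fromℕℚ a                <⟨ q<q+1 (fromℕℚ a) ⟩
    fromℕℚ a ℚ.+ 1ℚ         ≡⟨ /-suc a 0 ⟨
    fromℕℚ (suc a)          ≤⟨ c≤t ⟩
    t                       ≡⟨ ℚ.*-identityˡ t ⟨
    1ℚ ℚ.* t                ≤⟨ *-mono (ℚ.nonNegative⁻¹ 1ℚ) (ℚ.≤-trans 1≤c c≤t) (0≤/ (suc (suc a ℕ.* suc n)) n) ℚ.≤-refl ⟩
    t ℚ.* t                 ∎
    where
    open ℚ.≤-Reasoning
    a = ℤ.∣ ℚ.↥ q ∣
    t = + suc (suc a ℕ.* suc n) ℚ./ suc n
    c≤t : fromℕℚ (suc a) ℚ.≤ t
    c≤t = /-≤ {suc a} {0} {suc (suc a ℕ.* suc n)} {n}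
      (ℕ.≤-trans (ℕ.n≤1+n _) (ℕ.≤-reflexive (sym (ℕ.*-identityʳ _))))
    1≤c : 1ℚ ℚ.≤ fromℕℚ (suc a)
    1≤c = /-≤ {1} {0} {suc a} {0} (s≤s z≤n)

  sqrtℚ-lower : ∀ n q → (sqrtℚ n q ≡ 0ℚ) ⊎ (square (sqrtℚ n q) ℚ.≤ q)
  sqrtℚ-lower n q = go (rootNumerator n q) (
    largest-holds {RootBelow n q} (rootBelow? n q) (suc ℤ.∣ ℚ.↥ q ∣ ℕ.* suc n))
    where
    go : ∀ k → (k ≡ 0) ⊎ RootBelow n q k →
         (+ k ℚ./ suc n ≡ 0ℚ) ⊎ (square (+ k ℚ./ suc n) ℚ.≤ q)
    go k (inj₁ refl) = inj₁ (ℚ.0/n≡0 (suc n))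
    go k (inj₂ h)    = inj₂ h

  sqrtℚ-upper : ∀ n q → q ℚ.< square (sqrtℚ n q ℚ.+ (+ 1 ℚ./ suc n))
  sqrtℚ-upper n q = go (rootNumerator n q) (
    largest-maximal {RootBelow n q} (rootBelow? n q) (suc ℤ.∣ ℚ.↥ q ∣ ℕ.* suc n)
      λ t²≤q → ℚ.<-irrefl refl (ℚ.<-≤-trans (search-bound n q) t²≤q))
    where
    go : ∀ k → ¬ RootBelow n q (suc k) →
         q ℚ.< square ((+ k ℚ./ suc n) ℚ.+ (+ 1 ℚ./ suc n))
    go k h = subst (λ s → q ℚ.< square s) (/-suc k n) (ℚ.≰⇒> h)

  0≤sqrtℚ : ∀ n q → 0ℚ ℚ.≤ sqrtℚ n q
  0≤sqrtℚ n q = 0≤/ (rootNumerator n q) n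

  square-mono : ∀ p q → 0ℚ ℚ.≤ p → p ℚ.≤ q → square p ℚ.≤ square q
  square-mono p q 0≤p p≤q = *-mono {p} {q} {p} {q} 0≤p p≤q 0≤p p≤q

  square-expand : ∀ t h → (t ℚ.+ h) ℚ.* (t ℚ.+ h) ℚ.+ h ℚ.* h ℚ.+ (h ℚ.* (t ℚ.+ h) ℚ.+ h ℚ.* (t ℚ.+ h))
                        ≡ (t ℚ.+ (h ℚ.+ h)) ℚ.* (t ℚ.+ (h ℚ.+ h))
  square-expand t h = solve 2 (λ t h →
    (t :+ h) :* (t :+ h) :+ h :* h :+ (h :* (t :+ h) :+ h :* (t :+ h))
      := (t :+ (h :+ h)) :* (t :+ (h :+ h))) refl t h

  square-gap : ∀ t h → 0ℚ ℚ.≤ t → 0ℚ ℚ.≤ h →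
               square (t ℚ.+ h) ℚ.+ square h ℚ.≤ square (t ℚ.+ (h ℚ.+ h))
  square-gap t h 0≤t 0≤h = subst (square (t ℚ.+ h) ℚ.+ square h ℚ.≤_) (square-expand t h)
    (≤+ (square (t ℚ.+ h) ℚ.+ square h) (h ℚ.* (t ℚ.+ h) ℚ.+ h ℚ.* (t ℚ.+ h)) (ℚ.+-mono-≤ 0≤hth 0≤hth))
    where
    0≤hth : 0ℚ ℚ.≤ h ℚ.* (t ℚ.+ h)
    0≤hth = 0≤* h (t ℚ.+ h) 0≤h (ℚ.+-mono-≤ 0≤t 0≤h)

  root-estimate : ∀ {h e p q s t} → 0ℚ ℚ.< h → 0ℚ ℚ.≤ e → e ℚ.≤ h → 0ℚ ℚ.≤ t →
                  (s ≡ 0ℚ) ⊎ (square s ℚ.≤ p) → q ℚ.< square (t ℚ.+ e) → p ℚ.< q ℚ.+ square h →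
                  s ℚ.≤ t ℚ.+ (h ℚ.+ h)
  root-estimate {t = t} 0<h _ _ 0≤t (inj₁ refl) _ _ =
    ℚ.+-mono-≤ 0≤t (ℚ.+-mono-≤ (ℚ.<⇒≤ 0<h) (ℚ.<⇒≤ 0<h))
  root-estimate {h} {e} {p} {q} {s} {t} 0<h 0≤e e≤h 0≤t (inj₂ ss≤p) q<tt p<q+hh =
    ℚ.≮⇒≥ λ t+2h<s → ℚ.<-irrefl refl (begin-strict
      p                               <⟨ p<q+hh ⟩
      q ℚ.+ square h                  <⟨ ℚ.+-monoˡ-< (square h) q<tt ⟩
      square (t ℚ.+ e) ℚ.+ square h
        ≤⟨ ℚ.+-monoˡ-≤ (square h) (square-mono (t ℚ.+ e) (t ℚ.+ h) (ℚ.+-mono-≤ 0≤t 0≤e) (ℚ.+-monoʳ-≤ t e≤h)) ⟩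
      square (t ℚ.+ h) ℚ.+ square h   ≤⟨ square-gap t h 0≤t 0≤h ⟩
      square (t ℚ.+ (h ℚ.+ h))
        ≤⟨ square-mono (t ℚ.+ (h ℚ.+ h)) s (ℚ.+-mono-≤ 0≤t (ℚ.+-mono-≤ 0≤h 0≤h)) (ℚ.<⇒≤ t+2h<s) ⟩
      square s                        ≤⟨ ss≤p ⟩
      p                               ∎)
    where
    open ℚ.≤-Reasoning
    0≤h = ℚ.<⇒≤ 0<h

  sqrtℚ-estimate : ∀ {h} m n p q → 0ℚ ℚ.< h → + 1 ℚ./ suc n ℚ.≤ h → p ℚ.< q ℚ.+ square h →
                   sqrtℚ m p ℚ.≤ sqrtℚ n q ℚ.+ (h ℚ.+ h)
  sqrtℚ-estimate m n p q 0<h e≤h =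
    root-estimate 0<h (0≤/ 1 n) e≤h (0≤sqrtℚ n q) (sqrtℚ-lower m p) (sqrtℚ-upper n q)

  sqrtℚ-close : ∀ {h ε} m n p q → 0ℚ ℚ.< h → h ℚ.+ h ℚ.< ε → + 1 ℚ./ suc n ℚ.≤ h →
                ℚ.∣ p ℚ.- q ∣ ℚ.< square h → sqrtℚ m p ℚ.< sqrtℚ n q ℚ.+ ε
  sqrtℚ-close {h} {ε} m n p q 0<h 2h<ε e≤h close = ℚ.≤-<-trans {sqrtℚ m p} {sqrtℚ n q ℚ.+ (h ℚ.+ h)}
    (sqrtℚ-estimate m n p q 0<h e≤h (∣-∣<-elim {p} {q} close))
    (ℚ.+-monoʳ-< (sqrtℚ n q) 2h<ε)

  sqrtℚ-cauchy : ∀ x → Cauchy x → Cauchy (λ n → sqrtℚ n (x n))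
  sqrtℚ-cauchy x cx ε 0<ε = M ℕ.⊔ N , λ m n m≥ n≥ →
    ∣-∣<-intro {sqrtℚ m (x m)} {sqrtℚ n (x n)}
      (sqrtℚ-close m n (x m) (x n) 0<h 2h<ε (fine n (≥M n≥)) (close m n (≥N m≥) (≥N n≥)))
      (sqrtℚ-close n m (x n) (x m) 0<h 2h<ε (fine m (≥M m≥)) (close n m (≥N n≥) (≥N m≥)))
    where
    h = ½ ℚ.* (½ ℚ.* ε)
    0<h = half-pos (half-pos 0<ε)
    2h<ε = subst (ℚ._< ε) (sym (halves (½ ℚ.* ε))) (half< 0<ε)
    M = proj₁ (archimedean 0<h)
    fine = proj₂ (archimedean 0<h)
    N = proj₁ (cx (square h) (*-pos 0<h 0<h))
    close = proj₂ (cx (square h) (*-pos 0<h 0<h))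
    ≥M : ∀ {n} → M ℕ.⊔ N ℕ.≤ n → M ℕ.≤ n
    ≥M = ℕ.m⊔n≤o⇒m≤o M N
    ≥N : ∀ {n} → M ℕ.⊔ N ℕ.≤ n → N ℕ.≤ n
    ≥N = ℕ.m⊔n≤o⇒n≤o M N

open Sqrt-Lemmas

-- √ x is the square root of max(x, 0).
√_ : ℝ → ℝ
√ x = mkℝ (λ n → sqrtℚ n (approx x n)) (sqrtℚ-cauchy (approx x) (cauchy x))

∏ : (ℕ → ℚ) → ℕ → ℚ
∏ f zero    = 1ℚ
∏ f (suc n) = ∏ f n ℚ.* f n

-- The factor 4j² / ((2j-1)(2j+1)), with j = n + 1, of Wallis's product for π/2.
wallisFactor : ℕ → ℚ
wallisFactor n = + (4 ℕ.* (suc n ℕ.* suc n)) ℚ./ ((1 ℕ.+ 2 ℕ.* n) ℕ.* (3 ℕ.+ 2 ℕ.* n))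

module Wallis-Lemmas where

  -- If f ≥ 1 and f n · g (n+1) ≤ g n, the products increase while their
  -- multiples by g decrease.
  module Squeeze (f g : ℕ → ℚ)
                 (1≤f : ∀ n → 1ℚ ℚ.≤ f n) (1≤g : ∀ n → 1ℚ ℚ.≤ g n)
                 (fg≤g : ∀ n → f n ℚ.* g (suc n) ℚ.≤ g n)
                 (g₀≤2 : g 0 ℚ.≤ fromℕℚ 2)
                 (g≤ : ∀ n → g n ℚ.≤ 1ℚ ℚ.+ (+ 1 ℚ./ suc n)) where

    0≤1 : 0ℚ ℚ.≤ 1ℚ
    0≤1 = ℚ.nonNegative⁻¹ 1ℚ

    0≤∏ : ∀ n → 0ℚ ℚ.≤ ∏ f n
    0≤∏ zero    = 0≤1
    0≤∏ (suc n) = 0≤* (∏ f n) (f n) (0≤∏ n) (ℚ.≤-trans 0≤1 (1≤f n))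

    ∏≤∏* : ∀ n {q} → 1ℚ ℚ.≤ q → ∏ f n ℚ.≤ ∏ f n ℚ.* q
    ∏≤∏* n {q} 1≤q = subst (ℚ._≤ ∏ f n ℚ.* q) (ℚ.*-identityʳ (∏ f n))
      (*-mono (0≤∏ n) ℚ.≤-refl 0≤1 1≤q)

    upper : ℕ → ℚ
    upper n = ∏ f n ℚ.* g n

    mono : ∀ {N n} → N ℕ.≤′ n → ∏ f N ℚ.≤ ∏ f n
    mono ℕ.≤′-refl             = ℚ.≤-refl
    mono (ℕ.≤′-step {n} N≤n) = ℚ.≤-trans (mono N≤n) (∏≤∏* n (1≤f n))

    anti : ∀ {N n} → N ℕ.≤′ n → upper n ℚ.≤ upper N
    anti ℕ.≤′-refl             = ℚ.≤-refl
    anti (ℕ.≤′-step {n} N≤n) = ℚ.≤-trans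
      (subst (ℚ._≤ upper n) (sym (ℚ.*-assoc (∏ f n) (f n) (g (suc n))))
        (ℚ.*-monoˡ-≤-nonNeg (∏ f n) {{ℚ.nonNegative (0≤∏ n)}} (fg≤g n)))
      (anti N≤n)

    ∏≤2 : ∀ n → ∏ f n ℚ.≤ fromℕℚ 2
    ∏≤2 n = begin
      ∏ f n     ≤⟨ ∏≤∏* n (1≤g n) ⟩
      upper n   ≤⟨ anti {0} {n} (ℕ.≤⇒≤′ z≤n) ⟩
      1ℚ ℚ.* g 0 ≡⟨ ℚ.*-identityˡ (g 0) ⟩
      g 0       ≤⟨ g₀≤2 ⟩
      fromℕℚ 2  ∎
      where open ℚ.≤-Reasoning

    upper≤ : ∀ n → upper n ℚ.≤ ∏ f n ℚ.+ fromℕℚ 2 ℚ.* (+ 1 ℚ./ suc n)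
    upper≤ n = go (∏ f n) (+ 1 ℚ./ suc n) (0≤∏ n) (∏≤2 n) (0≤/ 1 n) (g≤ n)
      where
      open ℚ.≤-Reasoning
      go : ∀ w c {q} → 0ℚ ℚ.≤ w → w ℚ.≤ fromℕℚ 2 → 0ℚ ℚ.≤ c → q ℚ.≤ 1ℚ ℚ.+ c →
           w ℚ.* q ℚ.≤ w ℚ.+ fromℕℚ 2 ℚ.* c
      go w c {q} 0≤w w≤2 0≤c q≤ = begin
        w ℚ.* q               ≤⟨ ℚ.*-monoˡ-≤-nonNeg w {{ℚ.nonNegative 0≤w}} q≤ ⟩
        w ℚ.* (1ℚ ℚ.+ c)      ≡⟨ solve 2 (λ w c → w :* (con 1ℚ :+ c) := w :+ w :* c) refl w c ⟩
        w ℚ.+ w ℚ.* c         ≤⟨ ℚ.+-monoʳ-≤ w (*-mono 0≤w w≤2 0≤c ℚ.≤-refl) ⟩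
        w ℚ.+ fromℕℚ 2 ℚ.* c  ∎

    2·quarter : ∀ ε → fromℕℚ 2 ℚ.* (½ ℚ.* (½ ℚ.* ε)) ≡ ½ ℚ.* ε
    2·quarter = solve 1 (λ ε → con (fromℕℚ 2) :* (con ½ :* (con ½ :* ε)) := con ½ :* ε) refl

    ∏-close : ∀ {N h ε} m n → N ℕ.≤ m → N ℕ.≤ n → + 1 ℚ./ suc N ℚ.≤ h →
              fromℕℚ 2 ℚ.* h ℚ.< ε → ∏ f m ℚ.< ∏ f n ℚ.+ ε
    ∏-close {N} {h} {ε} m n m≥ n≥ fine 2h<ε = begin-strict
      ∏ f m                                     ≤⟨ ∏≤∏* m (1≤g m) ⟩
      upper m                                   ≤⟨ anti {N} {m} (ℕ.≤⇒≤′ m≥) ⟩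
      upper N                                   ≤⟨ upper≤ N ⟩
      ∏ f N ℚ.+ fromℕℚ 2 ℚ.* (+ 1 ℚ./ suc N)
        ≤⟨ ℚ.+-mono-≤ (mono (ℕ.≤⇒≤′ n≥)) (ℚ.*-monoˡ-≤-nonNeg (fromℕℚ 2) fine) ⟩
      ∏ f n ℚ.+ fromℕℚ 2 ℚ.* h                  <⟨ ℚ.+-monoʳ-< (∏ f n) 2h<ε ⟩
      ∏ f n ℚ.+ ε                               ∎
      where open ℚ.≤-Reasoning

    ∏-cauchy : Cauchy (∏ f)
    ∏-cauchy ε 0<ε = N , λ m n m≥ n≥ → ∣-∣<-intro {∏ f m} {∏ f n}
      (∏-close m n m≥ n≥ fine 2h<ε) (∏-close n m n≥ m≥ fine 2h<ε)
      where
      0<h = half-pos (half-pos 0<ε)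
      N = proj₁ (archimedean 0<h)
      fine = proj₂ (archimedean 0<h) N ℕ.≤-refl
      2h<ε : fromℕℚ 2 ℚ.* (½ ℚ.* (½ ℚ.* ε)) ℚ.< ε
      2h<ε = subst (ℚ._< ε) (sym (2·quarter ε)) (half< 0<ε)

  wallisGap : ℕ → ℚ
  wallisGap n = + (2 ℕ.+ 2 ℕ.* n) ℚ./ (1 ℕ.+ 2 ℕ.* n)

  1≤wallisFactor : ∀ n → 1ℚ ℚ.≤ wallisFactor n
  1≤wallisFactor n = /-≤ {1} {0} {4 ℕ.* (suc n ℕ.* suc n)}
    (subst₂ ℕ._≤_ (sym (ℕ.*-identityˡ _)) (sym (ℕ.*-identityʳ _))
      (ℕ.≤-trans (ℕ.n≤1+n _) (ℕ.≤-reflexive (identity n))))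
    where
    identity : ∀ n → suc ((1 ℕ.+ 2 ℕ.* n) ℕ.* (3 ℕ.+ 2 ℕ.* n)) ≡ 4 ℕ.* (suc n ℕ.* suc n)
    identity = ℕ-solve-∀

  1≤wallisGap : ∀ n → 1ℚ ℚ.≤ wallisGap n
  1≤wallisGap n = /-≤ {1} {0} {2 ℕ.+ 2 ℕ.* n} {2 ℕ.* n}
    (subst₂ ℕ._≤_ (sym (ℕ.*-identityˡ _)) (sym (ℕ.*-identityʳ _)) (ℕ.n≤1+n _))

  factor*gap≤gap : ∀ n → wallisFactor n ℚ.* wallisGap (suc n) ℚ.≤ wallisGap n
  factor*gap≤gap n = subst (ℚ._≤ wallisGap n)
    (sym (/-* (4 ℕ.* (suc n ℕ.* suc n)) (ℕ.pred d) (2 ℕ.+ 2 ℕ.* suc n) (2 ℕ.* suc n)))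
    (/-≤ {4 ℕ.* (suc n ℕ.* suc n) ℕ.* (2 ℕ.+ 2 ℕ.* suc n)} {ℕ.pred (d ℕ.* (1 ℕ.+ 2 ℕ.* suc n))} {2 ℕ.+ 2 ℕ.* n} {2 ℕ.* n}
      (ℕ.≤-trans (ℕ.m≤m+n (4 ℕ.* (suc n ℕ.* suc n) ℕ.* (2 ℕ.+ 2 ℕ.* suc n) ℕ.* (1 ℕ.+ 2 ℕ.* n))
                       ((2 ℕ.+ 2 ℕ.* n) ℕ.* (1 ℕ.+ 2 ℕ.* n))) (ℕ.≤-reflexive (identity n))))
    where
    d = (1 ℕ.+ 2 ℕ.* n) ℕ.* (3 ℕ.+ 2 ℕ.* n)
    identity : ∀ n → 4 ℕ.* (suc n ℕ.* suc n) ℕ.* (2 ℕ.+ 2 ℕ.* suc n) ℕ.* (1 ℕ.+ 2 ℕ.* n)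
                       ℕ.+ (2 ℕ.+ 2 ℕ.* n) ℕ.* (1 ℕ.+ 2 ℕ.* n)
                   ≡ (2 ℕ.+ 2 ℕ.* n) ℕ.* ((1 ℕ.+ 2 ℕ.* n) ℕ.* (3 ℕ.+ 2 ℕ.* n) ℕ.* (1 ℕ.+ 2 ℕ.* suc n))
    identity = ℕ-solve-∀

  wallisGap≤ : ∀ n → wallisGap n ℚ.≤ 1ℚ ℚ.+ (+ 1 ℚ./ suc n)
  wallisGap≤ n = subst (ℚ._≤ 1ℚ ℚ.+ (+ 1 ℚ./ suc n)) (sym (/-suc (1 ℕ.+ 2 ℕ.* n) (2 ℕ.* n)))
    (ℚ.+-mono-≤
      (/-≤ {1 ℕ.+ 2 ℕ.* n} {2 ℕ.* n} {1} {0} (ℕ.≤-reflexive (ℕ.*-comm (1 ℕ.+ 2 ℕ.* n) 1)))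
      (/-≤ {1} {2 ℕ.* n} {1} {n} (ℕ.*-monoʳ-≤ 1 (s≤s (ℕ.m≤m+n n (n ℕ.+ 0))))))

open Wallis-Lemmas

π : ℝ
π = fromℕ 2 * mkℝ (∏ wallisFactor)
  (Squeeze.∏-cauchy wallisFactor wallisGap 1≤wallisFactor 1≤wallisGap factor*gap≤gap ℚ.≤-refl wallisGap≤)

-- n^(n - 1/2) = n^(n-1) · √n, for n ≥ 1.
n^[n-½] : ℕ → ℝ
n^[n-½] n = fromℕ (n ℕ.^ (n ℕ.∸ 1)) * √ fromℕ n

-- Asymptotic equivalence: a n / b n → 1, the quotient being defined for
-- all sufficiently large n.
infix 4 _∼_

_∼_ : (ℕ → ℝ) → (ℕ → ℝ) → Set
a ∼ b = ∀ ε → 0ℚ ℚ.< ε → ∃ λ N → ∀ n → N ℕ.≤ n →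
  Σ (b n #0) λ bn#0 → abs (divide (a n) (b n) bn#0 - fromℕ 1) < fromℚ ε

-- Call some vertices of a bipartite graph active, and consider the graphs in which every
-- vertex is reachable from an active one. Deleting an active vertex and activating its
-- neighbours gives a recursion in which only the numbers of active and of other vertices of
-- either colour matter. Restricted to forests and to graphs with one more edge, and summed over
-- all colourings of the other vertices, it has an explicit solution: the forests are counted
-- by b (b + n)^(n - 1), and an additional edge creates either a path between two roots or a
-- cycle. For a single root only the cycles remain, whence
-- N-bi n 1 = Σ_{k ≥ 2} (n - 1) (n - 2) ⋯ (n - 2k + 1) n^(n - 2k).
--
-- For the asymptotics, let t_m = Π_{i < m} (1 - i/n) and v_m(N) = Π_{i < m} (N - i) / (N + i).
-- The sum of v_m(N) over m ≥ 1 is explicit, and its square is (2N + 1) / 4 times the N-th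
-- partial product of Wallis. Now t_m ≤ v_m(2n) for all m, while t_m ≥ v_m(2n - c) for m ≤ c + 1,
-- and the sum of v_m(N) over m > c telescopes to at most N / c. With c a small multiple of n,
-- both bounds for Σ t_m are asymptotic to √(πn/2); by monotonicity, the terms t_4, t_6, … make
-- up half of this sum up to a bounded error.
module Submission where

-- In a graph all of whose vertices are reachable from coloured roots, the colours of the other
-- vertices are forced. Summing over all colourings therefore leaves a forest count that depends
-- only on the number b = p + q of roots; the colours of the roots matter only for the two ends of a
-- path that joins roots. The counts with an additional edge are doubled, because unordered pairs of
-- roots and undirected cycles would otherwise call for division by two.
--
-- As π is given by Wallis products, t_m is compared with products whose sums have exact Wallis
-- products as squares; no integral or Stirling formula enters. The choice N = 2n comes from (N - i)
-- / (N + i) ≈ 1 - 2i / N, which agrees with 1 - i / n to first order. All inequalities are between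
-- rational approximations of index m, where m is large in terms of n, as the order of quantifiers
-- in `_∼_` permits.

-- Binomial sums and the numbers of rooted forests

module BinomialSums where

  open import Data.Nat.Base using (ℕ; zero; suc; _+_; _*_; _^_; pred)
  open import Data.Nat.Properties
  open import Data.Nat.Tactic.RingSolver using (solve-∀)
  open import Relation.Binary.PropositionalEquality

  interchange : ∀ a b c d → (a + b) + (c + d) ≡ (a + c) + (b + d)
  interchange = solve-∀

  opaque
    -- B n f is the sum of (n choose i) f i j over i + j = n.
    B : ℕ → (ℕ → ℕ → ℕ) → ℕ
    B zero    f = f 0 0
    B (suc n) f = B n (λ i j → f (suc i) j) + B n (λ i j → f i (suc j))

    B-cong : ∀ n {f g : ℕ → ℕ → ℕ} → (∀ i j → i + j ≡ n → f i j ≡ g i j) → B n f ≡ B n g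
    B-cong zero    h = h 0 0 refl
    B-cong (suc n) h = cong₂ _+_
      (B-cong n λ i j eq → h (suc i) j (cong suc eq))
      (B-cong n λ i j eq → h i (suc j) (trans (+-suc i j) (cong suc eq)))

    B-cong′ : ∀ n {f g : ℕ → ℕ → ℕ} → (∀ i j → f i j ≡ g i j) → B n f ≡ B n g
    B-cong′ n h = B-cong n λ i j _ → h i j

    B-+ : ∀ n (f g : ℕ → ℕ → ℕ) → B n (λ i j → f i j + g i j) ≡ B n f + B n g
    B-+ zero    f g = refl
    B-+ (suc n) f g = trans (cong₂ _+_ (B-+ n _ _) (B-+ n _ _)) (interchange (B n _) (B n _) (B n _) (B n _))

    B-* : ∀ n c (f : ℕ → ℕ → ℕ) → B n (λ i j → c * f i j) ≡ c * B n f
    B-* zero    c f = refl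
    B-* (suc n) c f = trans (cong₂ _+_ (B-* n c _) (B-* n c _)) (sym (*-distribˡ-+ c (B n _) (B n _)))

    B-zero : ∀ n → B n (λ _ _ → 0) ≡ 0
    B-zero zero    = refl
    B-zero (suc n) = cong₂ _+_ (B-zero n) (B-zero n)

    B-sym : ∀ n (f : ℕ → ℕ → ℕ) → B n f ≡ B n (λ i j → f j i)
    B-sym zero    f = refl
    B-sym (suc n) f = trans (cong₂ _+_ (B-sym n _) (B-sym n _)) (+-comm (B n _) (B n _))

    B-swap : ∀ m n (f : ℕ → ℕ → ℕ → ℕ → ℕ) →
             B m (λ i j → B n (f i j)) ≡ B n (λ k l → B m (λ i j → f i j k l))
    B-swap zero    n f = refl
    B-swap (suc m) n f = trans (cong₂ _+_ (B-swap m n _) (B-swap m n _)) (sym (B-+ n _ _))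

    -- Both sides sum g over all 3-colourings of n points.
    B-assoc : ∀ n (g : ℕ → ℕ → ℕ → ℕ) →
              B n (λ i j → B j (g i)) ≡ B n (λ k m → B m (λ i l → g i k l))
    B-assoc zero    g = refl
    B-assoc (suc n) g = begin
      B n (λ i j → B j (g (suc i))) + B n (λ i j → B (suc j) (g i))
        ≡⟨ cong (B n (λ i j → B j (g (suc i))) +_) (B-+ n (λ i j → B j (λ k l → g i (suc k) l)) (λ i j → B j (λ k l → g i k (suc l)))) ⟩
      B n (λ i j → B j (g (suc i))) + (B n (λ i j → B j (λ k l → g i (suc k) l)) + B n (λ i j → B j (λ k l → g i k (suc l))))
        ≡⟨ cong₂ _+_ (B-assoc n _) (cong₂ _+_ (B-assoc n _) (B-assoc n _)) ⟩
      x + (y + z)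
        ≡⟨ reorder x y z ⟩
      y + (x + z)
        ≡⟨ cong (y +_) (B-+ n (λ k m → B m (λ i l → g (suc i) k l)) (λ k m → B m (λ i l → g i k (suc l)))) ⟨
      B n (λ k m → B m (λ i l → g i (suc k) l)) + B n (λ k m → B (suc m) (λ i l → g i k l)) ∎
      where
      open ≡-Reasoning
      x y z : ℕ
      x = B n (λ k m → B m (λ i l → g (suc i) k l))
      y = B n (λ k m → B m (λ i l → g i (suc k) l))
      z = B n (λ k m → B m (λ i l → g i k (suc l)))
      reorder : ∀ x y z → x + (y + z) ≡ y + (x + z)
      reorder = solve-∀

    B-base : ∀ f → B 0 f ≡ f 0 0
    B-base f = refl

    B-suc : ∀ n f → B (suc n) f ≡ B n (λ i j → f (suc i) j) + B n (λ i j → f i (suc j))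
    B-suc n f = refl

    B-binomial : ∀ n x y → B n (λ i j → x ^ i * y ^ j) ≡ (x + y) ^ n
    B-binomial zero    x y = refl
    B-binomial (suc n) x y = begin
      B n (λ i j → x * x ^ i * y ^ j) + B n (λ i j → x ^ i * (y * y ^ j))
        ≡⟨ cong₂ _+_ (B-cong′ n λ i j → *-assoc x (x ^ i) (y ^ j))
                     (B-cong′ n λ i j → comm (x ^ i) y (y ^ j)) ⟩
      B n (λ i j → x * (x ^ i * y ^ j)) + B n (λ i j → y * (x ^ i * y ^ j))
        ≡⟨ cong₂ _+_ (B-* n x _) (B-* n y _) ⟩
      x * B n (λ i j → x ^ i * y ^ j) + y * B n (λ i j → x ^ i * y ^ j)
        ≡⟨ *-distribʳ-+ (B n _) x y ⟨
      (x + y) * B n (λ i j → x ^ i * y ^ j)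
        ≡⟨ cong ((x + y) *_) (B-binomial n x y) ⟩
      (x + y) * (x + y) ^ n ∎
      where
      open ≡-Reasoning
      comm : ∀ a b c → a * (b * c) ≡ b * (a * c)
      comm = solve-∀

  -- A factor i marks one of the i chosen points; the marked point can be selected beforehand, in
  -- `suc n` ways.
  B-absorbˡ : ∀ n (f : ℕ → ℕ → ℕ) → B (suc n) (λ i j → i * f i j) ≡ suc n * B n (λ i j → f (suc i) j)
  B-absorbˡ zero    f = trans (B-suc 0 _) (cong₂ _+_
    (trans (B-base _) (trans (+-identityʳ (f 1 0)) (sym (B-base _)))) (B-base _))
  B-absorbˡ (suc n) f = begin
    B (suc (suc n)) (λ i j → i * f i j)
      ≡⟨ B-suc (suc n) _ ⟩
    B (suc n) (λ i j → f (suc i) j + i * f (suc i) j) + B (suc n) (λ i j → i * f i (suc j))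
      ≡⟨ cong (_+ B (suc n) (λ i j → i * f i (suc j))) (B-+ (suc n) _ _) ⟩
    B (suc n) (λ i j → f (suc i) j) + B (suc n) (λ i j → i * f (suc i) j) + B (suc n) (λ i j → i * f i (suc j))
      ≡⟨ cong₂ (λ a b → B (suc n) (λ i j → f (suc i) j) + a + b) (B-absorbˡ n _) (B-absorbˡ n _) ⟩
    B (suc n) (λ i j → f (suc i) j) + suc n * B n (λ i j → f (suc (suc i)) j) + suc n * B n (λ i j → f (suc i) (suc j))
      ≡⟨ cong (λ a → a + suc n * x + suc n * y) (B-suc n _) ⟩
    x + y + suc n * x + suc n * y
      ≡⟨ collect (suc n) x y ⟩
    suc (suc n) * (x + y)
      ≡⟨ cong (suc (suc n) *_) (B-suc n _) ⟨
    suc (suc n) * B (suc n) (λ i j → f (suc i) j) ∎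
    where
    open ≡-Reasoning
    x = B n (λ i j → f (suc (suc i)) j)
    y = B n (λ i j → f (suc i) (suc j))
    collect : ∀ m a b → a + b + m * a + m * b ≡ suc m * (a + b)
    collect = solve-∀

  B-absorbʳ : ∀ n (f : ℕ → ℕ → ℕ) → B (suc n) (λ i j → j * f i j) ≡ suc n * B n (λ i j → f i (suc j))
  B-absorbʳ n f = trans (B-sym (suc n) _) (trans (B-absorbˡ n (λ i j → f j i)) (cong (suc n *_) (B-sym n _)))

  -- The number of forests on n labelled vertices and b further vertices, the roots.
  forests : ℕ → ℕ → ℕ
  forests zero    b = 1
  forests (suc n) b = b * (b + suc n) ^ n

  -- F counts structures on n labelled vertices with b roots; shift F those in which one
  -- of the n vertices is promoted to an additional root.
  shift : (ℕ → ℕ → ℕ) → ℕ → ℕ → ℕ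
  shift F zero    b = 0
  shift F (suc n) b = suc n * F n (suc b)

  forests*total : ∀ n b → forests n b * (b + n) ≡ b * (b + n) ^ n
  forests*total zero    b = trans (*-identityˡ (b + 0)) (trans (+-identityʳ b) (sym (*-identityʳ b)))
  forests*total (suc n) b = trans (*-assoc b ((b + suc n) ^ n) (b + suc n)) (cong (b *_) (*-comm ((b + suc n) ^ n) (b + suc n)))

  -- The effect of deleting one of c + 1 roots: i of the n other vertices, its neighbours, become
  -- roots, so that c + i roots and j other vertices remain.
  Stable : (ℕ → ℕ → ℕ) → Set
  Stable F = ∀ n c → B n (λ i j → F j (c + i)) ≡ F n (suc c)

  B-binomial₁ : ∀ n x → B n (λ i j → x ^ j) ≡ suc x ^ n
  B-binomial₁ n x = trans (B-cong′ n λ i j → sym (trans (cong (_* x ^ j) (^-zeroˡ i)) (*-identityˡ (x ^ j)))) (B-binomial n 1 x)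

  -- Multiplication by the number of vertices turns the exponent j - 1 into j. This number c + i + j
  -- is the same in all summands, so the binomial theorem applies to what remains.
  forests-stable : Stable forests
  forests-stable zero    c = B-base _
  forests-stable (suc n) c = *-cancelʳ-≡ _ _ (suc (c + n)) (begin
    B (suc n) (λ i j → forests j (c + i)) * m
      ≡⟨ *-comm _ m ⟩
    m * B (suc n) (λ i j → forests j (c + i))
      ≡⟨ B-* (suc n) m _ ⟨
    B (suc n) (λ i j → m * forests j (c + i))
      ≡⟨ B-cong (suc n) (λ i j eq → subst (λ m → m * forests j (c + i) ≡ c * m ^ j + i * m ^ j)
           (trans (+-assoc c i j) (trans (cong (c +_) eq) (+-suc c n)))
           (trans (*-comm (c + i + j) (forests j (c + i)))
           (trans (forests*total j (c + i)) (*-distribʳ-+ ((c + i + j) ^ j) c i)))) ⟩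
    B (suc n) (λ i j → c * m ^ j + i * m ^ j)
      ≡⟨ B-+ (suc n) _ _ ⟩
    B (suc n) (λ i j → c * m ^ j) + B (suc n) (λ i j → i * m ^ j)
      ≡⟨ cong₂ _+_ (B-* (suc n) c _) (B-absorbˡ n _) ⟩
    c * B (suc n) (λ i j → m ^ j) + suc n * B n (λ i j → m ^ j)
      ≡⟨ cong₂ (λ u v → c * u + suc n * v) (B-binomial₁ (suc n) m) (B-binomial₁ n m) ⟩
    c * (suc m * suc m ^ n) + suc n * suc m ^ n
      ≡⟨ collect c n (suc m ^ n) ⟩
    suc c * suc m ^ n * m
      ≡⟨ cong (λ k → suc c * suc k ^ n * m) (+-suc c n) ⟨
    suc c * (suc c + suc n) ^ n * m ∎)
    where
    open ≡-Reasoning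
    m = suc (c + n)
    collect : ∀ c n x → c * (suc (suc (c + n)) * x) + suc n * x ≡ suc c * x * suc (c + n)
    collect = solve-∀

  -- Stability is localised at one n because `evens` and `odds` are treated by a mutual induction on
  -- n, where each is known to be stable only at the predecessor.
  stable-at : (ℕ → ℕ → ℕ) → ℕ → Set
  stable-at F n = ∀ c → B n (λ i j → F j (c + i)) ≡ F n (suc c)

  B-promote : ∀ F n → stable-at F n → ∀ c →
              B (suc n) (λ i j → i * F j (c + i)) ≡ shift F (suc n) (suc c)
  B-promote F n st c = trans (B-absorbˡ n _) (cong (suc n *_)
    (trans (B-cong′ n λ i j → cong (F j) (+-suc c i)) (st (suc c))))

  B-promoted : ∀ F → Stable F → ∀ n c → B n (λ i j → i * F j (c + i)) ≡ shift F n (suc c)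
  B-promoted F st zero    c = B-base _
  B-promoted F st (suc n) c = B-promote F n (st n) c

  shift-stable-at : ∀ F n → stable-at F n → stable-at (shift F) (suc n)
  shift-stable-at F n st c = trans (B-cong′ (suc n) expand) (trans (B-absorbʳ n _) (cong (suc n *_) (st (suc c))))
    where
    expand : ∀ i j → shift F j (c + i) ≡ j * F (pred j) (suc c + i)
    expand i zero    = refl
    expand i (suc j) = refl

  -- Forests with a path of an even (odd) number of inner vertices, which become roots.
  evens odds : ℕ → ℕ → ℕ
  evens zero    b = 1
  evens (suc n) b = forests (suc n) b + suc n * odds n (suc b)
  odds zero    b = 0
  odds (suc n) b = suc n * evens n (suc b)

  odds≡ : ∀ n b → odds n b ≡ shift evens n b
  odds≡ zero    b = refl
  odds≡ (suc n) b = refl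

  evens≡ : ∀ n b → evens n b ≡ forests n b + shift odds n b
  evens≡ zero    b = refl
  evens≡ (suc n) b = refl

  stable-cong : ∀ {F G} n → (∀ m b → F m b ≡ G m b) → stable-at G n → stable-at F n
  stable-cong n eq st c = trans (B-cong′ n λ i j → eq j (c + i)) (trans (st c) (sym (eq n (suc c))))

  mutual
    evens-stable : Stable evens
    evens-stable zero    c = B-base _
    evens-stable (suc n) = stable-cong (suc n) evens≡ λ c →
      trans (B-+ (suc n) _ _) (cong₂ _+_ (forests-stable (suc n) c) (shift-stable-at odds n (odds-stable n) c))

    odds-stable : Stable odds
    odds-stable zero    c = B-base _
    odds-stable (suc n) = stable-cong (suc n) odds≡ (shift-stable-at evens n (evens-stable n))

-- The closed form for graphs with one additional edge

module RootedForests where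

  open BinomialSums
  open import Data.Nat.Base using (ℕ; zero; suc; _+_; _*_; _^_; pred)
  open import Data.Nat.Properties
  open import Data.Nat.Tactic.RingSolver using (solve-∀)
  open import Relation.Binary.PropositionalEquality

  -- The analogue of shift for structures depending on the total number of vertices.
  lower : (ℕ → ℕ → ℕ) → ℕ → ℕ → ℕ
  lower F zero    m = 0
  lower F (suc n) m = suc n * F n m

  -- Counterpart of `Stable` in terms of the total m of roots and other vertices: deleting a root
  -- lowers the total by one, while promoting neighbours to roots does not change it.
  TotalStable : (ℕ → ℕ → ℕ) → Set
  TotalStable F = ∀ n m → B n (λ i j → F j m) ≡ F n (suc m)

  lower-promoted : ∀ F → TotalStable F → ∀ n m → B n (λ i j → i * F j m) ≡ lower F n (suc m)
  lower-promoted F st zero    m = B-base _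
  lower-promoted F st (suc n) m = trans (B-absorbˡ n _) (cong (suc n *_) (st n m))

  lower-stable-at : ∀ F n → (∀ m → B n (λ i j → F j m) ≡ F n (suc m)) →
                    ∀ m → B (suc n) (λ i j → lower F j m) ≡ lower F (suc n) (suc m)
  lower-stable-at F n st m = trans (B-cong′ (suc n) (λ i j → expand j)) (trans (B-absorbʳ n _) (cong (suc n *_) (st m)))
    where
    expand : ∀ j → lower F j m ≡ j * F (pred j) m
    expand zero    = refl
    expand (suc j) = refl

  lower-stable : ∀ F → TotalStable F → TotalStable (lower F)
  lower-stable F st zero    m = B-base _
  lower-stable F st (suc n) m = lower-stable-at F n (st n) m

  power : ℕ → ℕ → ℕ
  power n m = m ^ n

  power-stable : TotalStable power
  power-stable n m = B-binomial₁ n m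

  -- Σ over even (odd) l of n (n - 1) ⋯ (n - l + 1) m ^ (n - l)
  evenFalls oddFalls : ℕ → ℕ → ℕ
  evenFalls zero    m = 1
  evenFalls (suc n) m = m ^ suc n + suc n * oddFalls n m
  oddFalls zero    m = 0
  oddFalls (suc n) m = suc n * evenFalls n m

  oddFalls≡ : ∀ n m → oddFalls n m ≡ lower evenFalls n m
  oddFalls≡ zero    m = refl
  oddFalls≡ (suc n) m = refl

  evenFalls≡ : ∀ n m → evenFalls n m ≡ m ^ n + lower oddFalls n m
  evenFalls≡ zero    m = refl
  evenFalls≡ (suc n) m = refl

  mutual
    evenFalls-stable : TotalStable evenFalls
    evenFalls-stable zero    m = B-base _
    evenFalls-stable (suc n) m = trans (B-cong′ (suc n) λ i j → evenFalls≡ j m)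
      (trans (B-+ (suc n) _ _) (cong₂ _+_ (power-stable (suc n) m) (lower-stable-at oddFalls n (oddFalls-stable n) m)))

    oddFalls-stable : TotalStable oddFalls
    oddFalls-stable zero    m = B-base _
    oddFalls-stable (suc n) m = trans (B-cong′ (suc n) λ i j → oddFalls≡ j m)
      (lower-stable-at evenFalls n (evenFalls-stable n) m)

  -- For m = b + n the model is m ^ n = n m ^ (n - 1) + b m ^ (n - 1): one value of a map from the n
  -- vertices to all m is either not a root or a root. Thus F is the difference of G and `lower G`,
  -- which links families depending on b to families depending only on m.
  Splits-at : (F G : ℕ → ℕ → ℕ) → ℕ → Set
  Splits-at F G n = ∀ b → G n (b + n) ≡ lower G n (b + n) + F n b

  Splits : (F G : ℕ → ℕ → ℕ) → Set
  Splits F G = ∀ n → Splits-at F G n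

  shift-splits-at : ∀ {F G} n → Splits-at F G n → Splits-at (shift F) (lower G) (suc n)
  shift-splits-at {F} {G} n split b = begin
    suc n * G n (b + suc n)
      ≡⟨ cong (λ m → suc n * G n m) (+-suc b n) ⟩
    suc n * G n (suc b + n)
      ≡⟨ cong (suc n *_) (split (suc b)) ⟩
    suc n * (lower G n (suc b + n) + F n (suc b))
      ≡⟨ *-distribˡ-+ (suc n) (lower G n (suc b + n)) (F n (suc b)) ⟩
    suc n * lower G n (suc b + n) + suc n * F n (suc b)
      ≡⟨ cong (λ m → suc n * lower G n m + suc n * F n (suc b)) (+-suc b n) ⟨
    suc n * lower G n (b + suc n) + suc n * F n (suc b) ∎
    where open ≡-Reasoning

  shift-splits : ∀ {F G} → Splits F G → Splits (shift F) (lower G)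
  shift-splits         split zero    b = refl
  shift-splits {F} {G} split (suc n) b = shift-splits-at {F} {G} n (split n) b

  forests-splits : Splits forests power
  forests-splits zero    b = refl
  forests-splits (suc n) b = begin
    (b + suc n) * (b + suc n) ^ n                     ≡⟨ *-distribʳ-+ ((b + suc n) ^ n) b (suc n) ⟩
    b * (b + suc n) ^ n + suc n * (b + suc n) ^ n     ≡⟨ +-comm (b * (b + suc n) ^ n) _ ⟩
    suc n * (b + suc n) ^ n + b * (b + suc n) ^ n     ∎
    where open ≡-Reasoning

  lower-+ : ∀ F G H n m → (∀ k → F k m ≡ G k m + H k m) → lower F n m ≡ lower G n m + lower H n m
  lower-+ F G H zero    m eq = refl
  lower-+ F G H (suc n) m eq = trans (cong (suc n *_) (eq n)) (*-distribˡ-+ (suc n) (G n m) (H n m))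

  lower-cong : ∀ F G n m → (∀ k → F k m ≡ G k m) → lower F n m ≡ lower G n m
  lower-cong F G zero    m eq = refl
  lower-cong F G (suc n) m eq = cong (suc n *_) (eq n)

  mutual
    evens-split : Splits evens evenFalls
    evens-split zero    b = refl
    evens-split (suc n) b = begin
      evenFalls (suc n) m
        ≡⟨ cong₂ _+_ (forests-splits (suc n) b) (shift-splits-at {odds} {oddFalls} n (odds-split n) b) ⟩
      (lower power (suc n) m + forests (suc n) b) + (lower (lower oddFalls) (suc n) m + shift odds (suc n) b)
        ≡⟨ interchange (lower power (suc n) m) _ _ _ ⟩
      (lower power (suc n) m + lower (lower oddFalls) (suc n) m) + evens (suc n) b
        ≡⟨ cong (_+ evens (suc n) b) (lower-+ evenFalls power (lower oddFalls) (suc n) m (λ k → evenFalls≡ k m)) ⟨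
      lower evenFalls (suc n) m + evens (suc n) b ∎
      where
      open ≡-Reasoning
      m = b + suc n

    odds-split : Splits odds oddFalls
    odds-split zero    b = refl
    odds-split (suc n) b = trans (shift-splits-at {evens} {evenFalls} n (evens-split n) b)
      (cong (_+ odds (suc n) b) (lower-cong (lower evenFalls) oddFalls (suc n) (b + suc n) (λ k → sym (oddFalls≡ k (b + suc n)))))

  cycles : ℕ → ℕ → ℕ
  cycles = lower (lower oddFalls)

  -- Twice the number of forests with one more edge: such an edge creates a path between
  -- two roots, with an odd number of inner vertices if the roots have the same colour
  -- and an even number otherwise, or it creates a cycle.
  unicyclic : ℕ → ℕ → ℕ → ℕ
  unicyclic n p q =
    (p * pred p + q * pred q) * odds n (p + q) + 2 * (p * q) * evens n (p + q) + (p + q) * cycles n (p + q + n)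

  unicyclic-sym : ∀ n p q → unicyclic n p q ≡ unicyclic n q p
  unicyclic-sym n p q = cong₂ _+_
    (cong₂ _+_
      (cong₂ _*_ (+-comm (p * pred p) (q * pred q)) (cong (odds n) (+-comm p q)))
      (cong₂ _*_ (cong (2 *_) (*-comm p q)) (cong (evens n) (+-comm p q))))
    (cong₂ _*_ (+-comm p q) (cong (λ b → cycles n (b + n)) (+-comm p q)))

  forests-rec : ∀ n p q → B n (λ i j → forests j (p + (q + i))) ≡ forests n (suc (p + q))
  forests-rec n p q = trans (B-cong′ n λ i j → cong (forests j) (sym (+-assoc p q i))) (forests-stable n (p + q))

  -- Upon deletion of a left root, the additional edge either survives or was an edge to one of the
  -- q right roots. The latter case leaves a forest, and is weighted by 2 because `unicyclic` counts
  -- twice.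
  unicyclic-rec : ∀ n p q → B n (λ i j → unicyclic j p (q + i)) + 2 * q * forests n (suc (p + q))
                          ≡ unicyclic n (suc p) q
  unicyclic-rec n p q = begin
    B n (λ i j → unicyclic j p (q + i)) + 2 * q * forests n b
      -- The coefficients are expanded in 1, i and i (i - 1), since `B` absorbs each of these as an
      -- iterated shift.
      ≡⟨ cong (_+ 2 * q * forests n b) (B-cong n expand) ⟩
    B n (λ i j → (d * odds j (c + i) + 2 * q * (i * odds j (c + i)) + i * (pred i * odds j (c + i)))
               + (2 * (p * q) * evens j (c + i) + 2 * p * (i * evens j (c + i)))
               + (c * cycles j (c + n) + i * cycles j (c + n)))
      + 2 * q * forests n b
      ≡⟨ cong (_+ 2 * q * forests n b) (trans (B-+ n _ _) (cong₂ _+_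
           (trans (B-+ n _ _) (cong₂ _+_
             (trans (B-+ n _ _) (cong₂ _+_
               (trans (B-+ n _ _) (cong₂ _+_
                 (scaled n d _ (odds-stable n c))
                 (scaled n (2 * q) _ (B-promoted odds odds-stable n c))))
               (twice n)))
             (trans (B-+ n _ _) (cong₂ _+_
               (scaled n (2 * (p * q)) _ (evens-stable n c))
               (scaled n (2 * p) _ (trans (B-promoted evens evens-stable n c) (sym (odds≡ n b))))))))
           (trans (B-+ n _ _) (cong₂ _+_
             (scaled n c _ (cycles-stable n (c + n)))
             (lower-promoted cycles cycles-stable n (c + n)))))) ⟩
    (d * o + 2 * q * o⁺ + o⁺⁺) + (2 * (p * q) * e + 2 * p * o) + (c * z + z⁺) + 2 * q * forests n b
      ≡⟨ collect d o q o⁺ o⁺⁺ (p * q) e p (c * z) z⁺ (forests n b) ⟩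
    (d + 2 * p) * o + (2 * (p * q) * e + 2 * q * (forests n b + o⁺)) + (z⁺ + o⁺⁺ + c * z)
      -- The separate forest term is the path without inner vertices, which completes `o⁺` to
      -- `evens`. The term `o⁺⁺`, from a path between two neighbours of the deleted root, accounts
      -- for cycles through that root and completes `z⁺` to `z`.
      ≡⟨ cong₂ (λ u v → (d + 2 * p) * o + (2 * (p * q) * e + 2 * q * u) + (v + c * z))
               (evens≡ n b) (cycles-split n b) ⟨
    (d + 2 * p) * o + (2 * (p * q) * e + 2 * q * e) + (z + c * z)
      ≡⟨ cong₂ (λ u v → u * o + v + b * z) (pairs p (q * pred q)) (finish p q e) ⟩
    unicyclic n (suc p) q ∎
    where
    open ≡-Reasoning
    b = suc (p + q)
    c = p + q
    d = p * pred p + q * pred q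
    o = odds n b
    o⁺ = shift odds n b
    o⁺⁺ = shift (shift odds) n b
    e = evens n b
    z = cycles n (b + n)
    z⁺ = lower cycles n (b + n)
    cycles-stable : TotalStable cycles
    cycles-stable = lower-stable (lower oddFalls) (lower-stable oddFalls oddFalls-stable)
    cycles-split : Splits (shift (shift odds)) cycles
    cycles-split = shift-splits {shift odds} {lower oddFalls} (shift-splits {odds} {oddFalls} odds-split)
    scaled : ∀ n k f {x} → B n f ≡ x → B n (λ i j → k * f i j) ≡ k * x
    scaled n k f eq = trans (B-* n k f) (cong (k *_) eq)
    twice : ∀ n → B n (λ i j → i * (pred i * odds j (c + i))) ≡ shift (shift odds) n b
    twice zero    = B-base _
    twice (suc n) = trans (B-absorbˡ n _) (cong (suc n *_)
      (trans (B-cong′ n λ i j → cong (λ m → i * odds j m) (+-suc c i)) (B-promoted odds odds-stable n (suc c))))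
    square : ∀ q i → (q + i) * pred (q + i) ≡ q * pred q + 2 * q * i + i * pred i
    square zero    i       = refl
    square (suc q) zero    = lemma q (q + 0) (+-identityʳ q)
      where
      lemma : ∀ q q′ → q′ ≡ q → suc q′ * q′ ≡ suc q * q + 2 * suc q * 0 + 0
      lemma q q′ refl = lemma′ q
        where
        lemma′ : ∀ q → suc q * q ≡ suc q * q + 2 * suc q * 0 + 0
        lemma′ = solve-∀
    square (suc q) (suc i) = lemma q i
      where
      lemma : ∀ q i → (suc q + suc i) * (q + suc i) ≡ suc q * q + 2 * suc q * suc i + suc i * i
      lemma = solve-∀
    expand : ∀ i j → i + j ≡ n → unicyclic j p (q + i)
           ≡ (d * odds j (c + i) + 2 * q * (i * odds j (c + i)) + i * (pred i * odds j (c + i)))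
               + (2 * (p * q) * evens j (c + i) + 2 * p * (i * evens j (c + i)))
               + (c * cycles j (c + n) + i * cycles j (c + n))
    expand i j i+j≡n = begin
      (p * pred p + (q + i) * pred (q + i)) * odds j (p + (q + i)) + 2 * (p * (q + i)) * evens j (p + (q + i))
        + (p + (q + i)) * cycles j (p + (q + i) + j)
        ≡⟨ cong (λ m → (p * pred p + (q + i) * pred (q + i)) * odds j m + 2 * (p * (q + i)) * evens j m + m * cycles j (m + j)) (sym (+-assoc p q i)) ⟩
      (p * pred p + (q + i) * pred (q + i)) * odds j (c + i) + 2 * (p * (q + i)) * evens j (c + i)
        + (c + i) * cycles j (c + i + j)
        ≡⟨ cong₂ (λ u v → (p * pred p + u) * odds j (c + i) + 2 * (p * (q + i)) * evens j (c + i) + (c + i) * cycles j v)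
             (square q i) (trans (+-assoc c i j) (cong (c +_) i+j≡n)) ⟩
      (p * pred p + (q * pred q + 2 * q * i + i * pred i)) * odds j (c + i) + 2 * (p * (q + i)) * evens j (c + i)
        + (c + i) * cycles j (c + n)
        ≡⟨ ring (p * pred p) (q * pred q) q i (pred i) (odds j (c + i)) p (evens j (c + i)) c (cycles j (c + n)) ⟩
      _ ∎
      where
      ring : ∀ P Q q i i′ o p e c z →
        (P + (Q + 2 * q * i + i * i′)) * o + 2 * (p * (q + i)) * e + (c + i) * z
          ≡ ((P + Q) * o + 2 * q * (i * o) + i * (i′ * o)) + (2 * (p * q) * e + 2 * p * (i * e)) + (c * z + i * z)
      ring = solve-∀
    collect : ∀ d o q o⁺ o⁺⁺ pq e p cz z⁺ f →
      (d * o + 2 * q * o⁺ + o⁺⁺) + (2 * pq * e + 2 * p * o) + (cz + z⁺) + 2 * q * f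
        ≡ (d + 2 * p) * o + (2 * pq * e + 2 * q * (f + o⁺)) + (z⁺ + o⁺⁺ + cz)
    collect = solve-∀
    pairs : ∀ p Q → p * pred p + Q + 2 * p ≡ suc p * p + Q
    pairs zero    Q = +-identityʳ Q
    pairs (suc p) Q = lemma p Q
      where
      lemma : ∀ p Q → suc p * p + Q + 2 * suc p ≡ suc (suc p) * suc p + Q
      lemma = solve-∀
    finish : ∀ p q e → 2 * (p * q) * e + 2 * q * e ≡ 2 * (suc p * q) * e
    finish = solve-∀

  unicyclic-one-root : ∀ n → unicyclic n 1 0 ≡ cycles n (suc n)
  unicyclic-one-root n = +-identityʳ (cycles n (suc n))

-- Solution of the deletion recursion

module Exploration where

  open BinomialSums
  open RootedForests
  open import Data.Nat.Base using (ℕ; zero; suc; _+_; _*_; _≤_; s≤s)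
  open import Data.Nat.Properties
  open import Data.Nat.Tactic.RingSolver using (solve-∀)
  open import Relation.Binary.PropositionalEquality

  -- The sum of w over the edge numbers of the bipartite graphs in which every vertex is
  -- reachable from p given left and q given right vertices, there being i further left and
  -- j further right vertices. It is computed by deleting a given vertex, whose new
  -- neighbours join the given vertices; v bounds the number of vertices.
  explore : ℕ → (ℕ → ℕ) → ℕ → ℕ → ℕ → ℕ → ℕ
  explore v       w zero    zero    zero    zero    = w 0
  explore v       w zero    (suc j) zero    zero    = 0
  explore v       w (suc i) j       zero    zero    = 0
  explore zero    w i       j       zero    (suc q) = 0
  explore zero    w i       j       (suc p) q       = 0
  explore (suc v) w i       j       zero    (suc q) =
    B i λ x i′ → explore v (λ m → w (x + m)) i′ j x q
  explore (suc v) w i       j       (suc p) q       =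
    B q λ x _ → B j λ y j′ → explore v (λ m → w (x + y + m)) i j′ p (q + y)

  exploreAll : ℕ → (ℕ → ℕ) → ℕ → ℕ → ℕ → ℕ
  exploreAll v w n p q = B n λ i j → explore v w i j p q

  -- Colouring the n vertices and then choosing y neighbours among the right ones amounts to
  -- choosing the y neighbours first and colouring only the rest.
  exploreAll-left : ∀ v w n p q →
    exploreAll (suc v) w n (suc p) q ≡ B q λ x _ → B n λ y m → exploreAll v (λ k → w (x + y + k)) m p (q + y)
  exploreAll-left v w n p q = trans
    (B-cong′ n {g = λ i j → B q λ x _ → B j λ y j′ → explore v (λ m → w (x + y + m)) i j′ p (q + y)}
      -- The clauses of `explore` distinguish the values of i and j, so it unfolds only in these
      -- cases.
      (λ { zero zero → refl ; zero (suc j) → refl ; (suc i) j → refl}))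
    (trans (B-swap n q (λ i j x _ → B j λ y j′ → explore v (λ m → w (x + y + m)) i j′ p (q + y)))
    (B-cong′ q λ x _ → B-assoc n λ i y j′ → explore v (λ m → w (x + y + m)) i j′ p (q + y)))

  exploreAll-right : ∀ v w n q →
    exploreAll (suc v) w n 0 (suc q) ≡ B n λ x m → exploreAll v (λ k → w (x + k)) m x q
  exploreAll-right v w n q = trans (B-sym n _) (trans
    (B-cong′ n {g = λ j i → B i λ x i′ → explore v (λ m → w (x + m)) i′ j x q}
      λ { zero zero → refl ; (suc j) zero → refl ; zero (suc i) → refl ; (suc j) (suc i) → refl })
    (trans (B-assoc n λ j x i′ → explore v (λ m → w (x + m)) i′ j x q)
    (B-cong′ n λ x m → B-sym m _)))

  B-first : ∀ q (f : ℕ → ℕ) → (∀ x → f (suc x) ≡ 0) → B q (λ x _ → f x) ≡ f 0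
  B-first zero    f h = B-base _
  B-first (suc q) f h = trans (B-suc q _) (cong₂ _+_ (trans (B-cong′ q λ x _ → h x) (B-zero q)) (B-first q f h))

  -- For f depending on the number x of edges from the deleted vertex to roots of the other colour:
  -- each of these is additional, so the terms with x ≥ 2 vanish.
  B-first₂ : ∀ q (f : ℕ → ℕ) → (∀ x → f (suc (suc x)) ≡ 0) → B q (λ x _ → f x) ≡ f 0 + q * f 1
  B-first₂ zero    f h = trans (B-base _) (sym (+-identityʳ (f 0)))
  B-first₂ (suc q) f h = trans (B-suc q _) (trans
    (cong₂ _+_ (B-first q (λ x → f (suc x)) h) (B-first₂ q f h)) (lemma (f 0) (f 1) q))
    where
    lemma : ∀ a b q → b + (a + q * b) ≡ a + (b + q * b)
    lemma = solve-∀

  -- w is arbitrary at n, the number of edges of a forest, and at n + 1.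
  Vanishes : ℕ → (ℕ → ℕ) → Set
  Vanishes n w = ∀ m → suc (suc n) ≤ m → w m ≡ 0

  vanishes-shift : ∀ {n} {w : ℕ → ℕ} x y m → y + m ≡ n → Vanishes n w → Vanishes m (λ k → w (x + y + k))
  vanishes-shift {n} x y m refl h k 2+m≤k = h (x + y + k) (≤-trans
    (≤-trans (≤-reflexive (sym (trans (+-suc y (suc m)) (cong suc (+-suc y m))))) (+-monoʳ-≤ y 2+m≤k))
    (≤-trans (m≤n+m (y + k) x) (≤-reflexive (sym (+-assoc x y k)))))

  closedForm : (ℕ → ℕ) → ℕ → ℕ → ℕ → ℕ
  closedForm w n p q = 2 * w n * forests n (p + q) + w (suc n) * unicyclic n p q

  -- Each of the y newly reached vertices uses up one edge and lowers the number of edges still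
  -- needed by one. The arguments of w are therefore the same in all summands, and w can be taken
  -- out of the sum.
  layers : ∀ (w : ℕ → ℕ) n x p q →
    B n (λ y m → 2 * w (x + y + m) * forests m (p + (q + y)) + w (x + y + suc m) * unicyclic m p (q + y))
      ≡ 2 * w (x + n) * forests n (suc (p + q)) + w (x + suc n) * B n (λ y m → unicyclic m p (q + y))
  layers w n x p q = begin
    B n (λ y m → 2 * w (x + y + m) * forests m (p + (q + y)) + w (x + y + suc m) * unicyclic m p (q + y))
      ≡⟨ B-cong n (λ y m eq → cong₂ (λ u v → 2 * w u * forests m (p + (q + y)) + w v * unicyclic m p (q + y))
           (trans (+-assoc x y m) (cong (x +_) eq))
           (trans (+-assoc x y (suc m)) (cong (x +_) (trans (+-suc y m) (cong suc eq))))) ⟩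
    B n (λ y m → 2 * w (x + n) * forests m (p + (q + y)) + w (x + suc n) * unicyclic m p (q + y))
      ≡⟨ B-+ n _ _ ⟩
    B n (λ y m → 2 * w (x + n) * forests m (p + (q + y))) + B n (λ y m → w (x + suc n) * unicyclic m p (q + y))
      ≡⟨ cong₂ _+_ (trans (B-* n (2 * w (x + n)) _) (cong (2 * w (x + n) *_) (forests-rec n p q))) (B-* n (w (x + suc n)) _) ⟩
    2 * w (x + n) * forests n (suc (p + q)) + w (x + suc n) * B n (λ y m → unicyclic m p (q + y)) ∎
    where open ≡-Reasoning

  -- The induction is on the number v of vertices, which each deletion lowers by one. The weight w
  -- has to be general, because the edges removed with a vertex shift its argument.
  exploreAll-closed : ∀ v w n p q → n + (p + q) ≡ v → Vanishes n w →
                      2 * exploreAll v w n p q ≡ closedForm w n p q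
  exploreAll-closed v w zero zero zero eq h = trans (cong (2 *_) (B-base _)) (lemma (w 0) (w 1))
    where
    lemma : ∀ a b → 2 * a ≡ 2 * a * 1 + b * 0
    lemma = solve-∀
  exploreAll-closed v w (suc n) zero zero eq h = trans
    (cong (2 *_) (trans (B-suc n _) (cong₂ _+_ (B-zero n)
      (trans (B-cong′ n λ { zero j → refl ; (suc i) j → refl }) (B-zero n)))))
    (lemma (w (suc n)) (w (suc (suc n))))
    where
    lemma : ∀ a b → 0 ≡ 2 * a * 0 + b * 0
    lemma = solve-∀
  exploreAll-closed zero w n zero (suc q) eq h with () ← m+n≡0⇒n≡0 n eq
  exploreAll-closed zero w n (suc p) q eq h with () ← m+n≡0⇒n≡0 n eq
  exploreAll-closed (suc v) w n zero (suc q) eq h = begin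
    2 * exploreAll (suc v) w n 0 (suc q)
      ≡⟨ cong (2 *_) (exploreAll-right v w n q) ⟩
    2 * B n (λ x m → exploreAll v (λ k → w (x + k)) m x q)
      ≡⟨ B-* n 2 _ ⟨
    B n (λ x m → 2 * exploreAll v (λ k → w (x + k)) m x q)
      ≡⟨ B-cong n (λ x m x+m≡n → trans
           (exploreAll-closed v (λ k → w (x + k)) m x q (total x m x+m≡n) (vanishes-shift 0 x m x+m≡n h))
           -- Only right roots were present and x left ones arise; exchanging the colours brings
           -- this to the form of `unicyclic-rec`.
           (cong₂ (λ a b → 2 * w (x + m) * forests m a + w (x + suc m) * b) (+-comm x q) (unicyclic-sym m x q))) ⟩
    B n (λ x m → 2 * w (x + m) * forests m (q + x) + w (x + suc m) * unicyclic m q x)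
      ≡⟨ layers w n 0 q 0 ⟩
    2 * w n * forests n (suc (q + 0)) + w (suc n) * B n (λ x m → unicyclic m q x)
      ≡⟨ cong₂ (λ a b → 2 * w n * forests n (suc a) + w (suc n) * b) (+-identityʳ q)
           (trans (sym (+-identityʳ _)) (trans (unicyclic-rec n q 0) (unicyclic-sym n (suc q) 0))) ⟩
    closedForm w n zero (suc q) ∎
    where
    open ≡-Reasoning
    total : ∀ x m → x + m ≡ n → m + (x + q) ≡ v
    total x m refl = suc-injective (trans (lemma x m q) eq)
      where
      lemma : ∀ x m q → suc (m + (x + q)) ≡ x + m + suc q
      lemma = solve-∀
  exploreAll-closed (suc v) w n (suc p) q eq h = begin
    2 * exploreAll (suc v) w n (suc p) q
      ≡⟨ cong (2 *_) (exploreAll-left v w n p q) ⟩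
    2 * B q (λ x _ → B n λ y m → exploreAll v (λ k → w (x + y + k)) m p (q + y))
      ≡⟨ B-* q 2 _ ⟨
    B q (λ x _ → 2 * B n λ y m → exploreAll v (λ k → w (x + y + k)) m p (q + y))
      ≡⟨ B-cong′ q (λ x _ → trans (sym (B-* n 2 _)) (trans (B-cong n λ y m y+m≡n →
           exploreAll-closed v (λ k → w (x + y + k)) m p (q + y) (total y m y+m≡n) (vanishes-shift x y m y+m≡n h))
           (layers w n x p q))) ⟩
    B q (λ x _ → 2 * w (x + n) * f + w (x + suc n) * u)
      -- With x = 1 the additional edge is spent and only forests remain; these q terms are the
      -- inhomogeneous part `2 * q * forests` of `unicyclic-rec`.
      ≡⟨ B-first₂ q _ (λ x → cong₂ (λ a b → 2 * a * f + b * u)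
           (h (suc (suc x) + n) (s≤s (s≤s (m≤n+m n x))))
           (h (suc (suc x) + suc n) (s≤s (s≤s (≤-trans (n≤1+n n) (m≤n+m (suc n) x)))))) ⟩
    2 * w n * f + w (suc n) * u + q * (2 * w (suc n) * f + w (suc (suc n)) * u)
      ≡⟨ cong (λ a → 2 * w n * f + w (suc n) * u + q * (2 * w (suc n) * f + a * u)) (h (suc (suc n)) ≤-refl) ⟩
    2 * w n * f + w (suc n) * u + q * (2 * w (suc n) * f + 0)
      ≡⟨ collect (w n) (w (suc n)) f u q ⟩
    2 * w n * f + w (suc n) * (u + 2 * q * f)
      ≡⟨ cong (λ a → 2 * w n * f + w (suc n) * a) (unicyclic-rec n p q) ⟩
    closedForm w n (suc p) q ∎
    where
    open ≡-Reasoning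
    f = forests n (suc (p + q))
    u = B n λ y m → unicyclic m p (q + y)
    collect : ∀ w₀ w₁ f u q → 2 * w₀ * f + w₁ * u + q * (2 * w₁ * f + 0) ≡ 2 * w₀ * f + w₁ * (u + 2 * q * f)
    collect = solve-∀
    total : ∀ x m → x + m ≡ n → m + (p + (q + x)) ≡ v
    total x m refl = suc-injective (trans (lemma x m p q) eq)
      where
      lemma : ∀ x m p q → suc (m + (p + (q + x))) ≡ x + m + (suc p + q)
      lemma = solve-∀

-- Deleting vertices from bipartite graphs

module Reachability where

  open BinomialSums
  open RootedForests
  open Exploration
  open import Defs using (BiGraph; Vertex; Adj; left-right; right-left; edgeCount; vectors; allBiGraphs; adj?; star?; vertices; ∈-vertices)

  open import Data.Bool.Base using (Bool; if_then_else_)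
  open import Data.Fin.Base as Fin using (Fin; zero; suc; punchIn; punchOut)
  import Data.Fin.Properties as Fin
  open import Data.Fin.Subset using (Subset; inside; outside; _∈_; _∉_; ∁; _∪_)
  open import Data.Fin.Subset using () renaming (∣_∣ to size)
  open import Data.Fin.Subset.Properties using (_∈?_; x∈p∪q⁻; x∈p∪q⁺; ∣p∣≤n)
  open import Data.List.Base as List using (List; []; _∷_; map; cartesianProductWith)
  open import Data.List.Properties using (map-++; map-∘)
  import Data.List.Relation.Unary.All as All
  open import Data.Nat.Base using (ℕ; zero; suc; _+_; _≤_)
  open import Data.Nat.ListAction using (sum)
  open import Data.Nat.ListAction.Properties using (sum-++)
  open import Data.Nat.Properties
  open import Data.Product.Base using (∃; _×_; _,_)
  open import Data.Sum.Base as Sum using (_⊎_; inj₁; inj₂)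
  import Data.Sum.Properties as Sum
  open import Data.Vec.Base as Vec using (Vec; []; _∷_; lookup; insertAt; zipWith)
  open import Data.Vec.Properties using (insertAt-lookup; insertAt-punchIn; lookup-zipWith; []=⇒lookup; lookup⇒[]=)
  open import Function.Bundles using (_⇔_; mk⇔)
  open import Relation.Binary.Construct.Closure.ReflexiveTransitive using (Star; ε; _◅_; gmap)
  open import Relation.Binary.PropositionalEquality
  open import Relation.Nullary using (Dec; yes; no; does; ¬_; contradiction)
  open import Relation.Nullary.Decidable using (map′; does-⇔; dec-false; dec-true; _×-dec_)
  open import Relation.Unary using (Decidable)

  sumOver : ∀ {A : Set} → List A → (A → ℕ) → ℕ
  sumOver xs f = sum (map f xs)

  sumOver-cong : ∀ {A : Set} (xs : List A) {f g : A → ℕ} → (∀ x → f x ≡ g x) → sumOver xs f ≡ sumOver xs g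
  sumOver-cong []       h = refl
  sumOver-cong (x ∷ xs) h = cong₂ _+_ (h x) (sumOver-cong xs h)

  sumOver-zero : ∀ {A : Set} (xs : List A) → sumOver xs (λ _ → 0) ≡ 0
  sumOver-zero []       = refl
  sumOver-zero (x ∷ xs) = sumOver-zero xs

  sumOver-+ : ∀ {A : Set} (xs : List A) (f g : A → ℕ) → sumOver xs (λ x → f x + g x) ≡ sumOver xs f + sumOver xs g
  sumOver-+ []       f g = refl
  sumOver-+ (x ∷ xs) f g = trans (cong (f x + g x +_) (sumOver-+ xs f g)) (interchange (f x) (g x) _ _)

  sumOver-swap : ∀ {A C : Set} (xs : List A) (ys : List C) (f : A → C → ℕ) →
    sumOver xs (λ x → sumOver ys (f x)) ≡ sumOver ys (λ y → sumOver xs (λ x → f x y))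
  sumOver-swap []       ys f = sym (sumOver-zero ys)
  sumOver-swap (x ∷ xs) ys f = trans (cong (sumOver ys (f x) +_) (sumOver-swap xs ys f))
    (sym (sumOver-+ ys (f x) _))

  sumOver-product : ∀ {A C D : Set} (g : A → C → D) xs ys (f : D → ℕ) →
    sumOver (cartesianProductWith g xs ys) f ≡ sumOver xs (λ x → sumOver ys (λ y → f (g x y)))
  sumOver-product g []       ys f = refl
  sumOver-product g (x ∷ xs) ys f = trans (cong sum (map-++ f (map (g x) ys) _))
    (trans (sum-++ (map f (map (g x) ys)) _)
    (cong₂ _+_ (cong sum (sym (map-∘ ys))) (sumOver-product g xs ys f)))

  sumOver-insertAt : ∀ {A : Set} (xs : List A) {n} (k : Fin (suc n)) (f : Vec A (suc n) → ℕ) →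
    sumOver (vectors xs (suc n)) f ≡ sumOver xs (λ x → sumOver (vectors xs n) (λ v → f (insertAt v k x)))
  sumOver-insertAt xs         zero    f = sumOver-product _∷_ xs (vectors xs _) f
  sumOver-insertAt xs {suc n} (suc k) f = begin
    sumOver (vectors xs (suc (suc n))) f
      ≡⟨ sumOver-product _∷_ xs (vectors xs (suc n)) f ⟩
    sumOver xs (λ y → sumOver (vectors xs (suc n)) (λ v → f (y ∷ v)))
      ≡⟨ sumOver-cong xs (λ y → sumOver-insertAt xs k (λ v → f (y ∷ v))) ⟩
    sumOver xs (λ y → sumOver xs (λ x → sumOver (vectors xs n) (λ v → f (y ∷ insertAt v k x))))
      ≡⟨ sumOver-swap xs xs _ ⟩
    sumOver xs (λ x → sumOver xs (λ y → sumOver (vectors xs n) (λ v → f (y ∷ insertAt v k x))))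
      ≡⟨ sumOver-cong xs (λ x → sumOver-product _∷_ xs (vectors xs n) (λ v → f (insertAt v (suc k) x))) ⟨
    sumOver xs (λ x → sumOver (vectors xs (suc n)) (λ v → f (insertAt v (suc k) x))) ∎
    where open ≡-Reasoning

  subsets : ∀ n → List (Subset n)
  subsets = vectors (outside ∷ inside ∷ [])

  insertColumn : ∀ {r s} → BiGraph r s → Fin (suc s) → Subset r → BiGraph r (suc s)
  insertColumn G k c = zipWith (λ row b → insertAt row k b) G c

  sumOver-insertColumn : ∀ r {s} (k : Fin (suc s)) (f : BiGraph r (suc s) → ℕ) →
    sumOver (allBiGraphs r (suc s)) f
      ≡ sumOver (subsets r) (λ c → sumOver (allBiGraphs r s) (λ G → f (insertColumn G k c)))
  sumOver-insertColumn zero    {s} k f = sym (+-identityʳ (f [] + 0))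
  sumOver-insertColumn (suc r) {s} k f = begin
    sumOver (allBiGraphs (suc r) (suc s)) f
      ≡⟨ sumOver-product _∷_ (subsets (suc s)) (allBiGraphs r (suc s)) f ⟩
    sumOver (subsets (suc s)) (λ row → sumOver (allBiGraphs r (suc s)) (λ G → f (row ∷ G)))
      ≡⟨ sumOver-insertAt sides k (λ row → sumOver (allBiGraphs r (suc s)) (λ G → f (row ∷ G))) ⟩
    sumOver sides (λ b → sumOver (subsets s) (λ row → sumOver (allBiGraphs r (suc s)) (λ G → f (insertAt row k b ∷ G))))
      ≡⟨ sumOver-cong sides (λ b → sumOver-cong (subsets s) (λ row → sumOver-insertColumn r k (λ G → f (insertAt row k b ∷ G)))) ⟩
    sumOver sides (λ b → sumOver (subsets s) (λ row → sumOver (subsets r) (λ c → sumOver (allBiGraphs r s) (λ G →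
      f (insertAt row k b ∷ insertColumn G k c)))))
      ≡⟨ sumOver-cong sides (λ b → sumOver-swap (subsets s) (subsets r)
           (λ row c → sumOver (allBiGraphs r s) (λ G → f (insertAt row k b ∷ insertColumn G k c)))) ⟩
    sumOver sides (λ b → sumOver (subsets r) (λ c → sumOver (subsets s) (λ row → sumOver (allBiGraphs r s) (λ G →
      f (insertAt row k b ∷ insertColumn G k c)))))
      ≡⟨ sumOver-cong sides (λ b → sumOver-cong (subsets r) (λ c →
           sumOver-product _∷_ (subsets s) (allBiGraphs r s) (λ G → f (insertColumn G k (b ∷ c))))) ⟨
    sumOver sides (λ b → sumOver (subsets r) (λ c → sumOver (allBiGraphs (suc r) s) (λ G → f (insertColumn G k (b ∷ c)))))
      ≡⟨ sumOver-product _∷_ sides (subsets r) (λ c → sumOver (allBiGraphs (suc r) s) (λ G → f (insertColumn G k c))) ⟨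
    sumOver (subsets (suc r)) (λ c → sumOver (allBiGraphs (suc r) s) (λ G → f (insertColumn G k c))) ∎
    where
    open ≡-Reasoning
    sides = outside ∷ inside ∷ []

  size-insertAt : ∀ {n} (p : Subset n) k b → size (insertAt p k b) ≡ size (b ∷ p)
  size-insertAt p             zero    b       = refl
  size-insertAt (inside  ∷ p) (suc k) inside  = cong suc (size-insertAt p k inside)
  size-insertAt (inside  ∷ p) (suc k) outside = cong suc (size-insertAt p k outside)
  size-insertAt (outside ∷ p) (suc k) inside  = size-insertAt p k inside
  size-insertAt (outside ∷ p) (suc k) outside = size-insertAt p k outside

  size-∁-insertAt : ∀ {n} (p : Subset n) k → size (∁ (insertAt p k inside)) ≡ size (∁ p)
  size-∁-insertAt p             zero    = refl
  size-∁-insertAt (inside  ∷ p) (suc k) = size-∁-insertAt p k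
  size-∁-insertAt (outside ∷ p) (suc k) = cong suc (size-∁-insertAt p k)

  edgeCount-insertAt : ∀ {r s} (G : BiGraph r s) k row → edgeCount (insertAt G k row) ≡ size row + edgeCount G
  edgeCount-insertAt G          zero    row = refl
  edgeCount-insertAt (row′ ∷ G) (suc k) row = trans (cong (size row′ +_) (edgeCount-insertAt G k row))
    (x∙yz≈y∙xz (size row′) (size row) (edgeCount G))
    where open import Algebra.Properties.CommutativeSemigroup +-commutativeSemigroup using (x∙yz≈y∙xz)

  edgeCount-insertColumn : ∀ {r s} (G : BiGraph r s) k c → edgeCount (insertColumn G k c) ≡ size c + edgeCount G
  edgeCount-insertColumn []        k []      = refl
  edgeCount-insertColumn (row ∷ G) k (b ∷ c) = begin
    size (insertAt row k b) + edgeCount (insertColumn G k c) ≡⟨ cong₂ _+_ (size-insertAt row k b) (edgeCount-insertColumn G k c) ⟩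
    size (b ∷ row) + (size c + edgeCount G)                  ≡⟨ lemma b ⟩
    size (b ∷ c) + (size row + edgeCount G)                  ∎
    where
    open ≡-Reasoning
    open import Algebra.Properties.CommutativeSemigroup +-commutativeSemigroup using (x∙yz≈y∙xz)
    lemma : ∀ b → size (b ∷ row) + (size c + edgeCount G) ≡ size (b ∷ c) + (size row + edgeCount G)
    lemma inside  = cong suc (x∙yz≈y∙xz (size row) (size c) (edgeCount G))
    lemma outside = x∙yz≈y∙xz (size row) (size c) (edgeCount G)

  -- Matching on this view selects an active vertex k to be deleted and presents the set of active
  -- vertices as the result of inserting k.
  data Inhabited : ∀ {n} → Subset n → ℕ → Set where
    extend : ∀ {n p} (k : Fin (suc n)) (P : Subset n) → size P ≡ p → Inhabited (insertAt P k inside) p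

  inhabited : ∀ {n} (P : Subset n) {p} → size P ≡ suc p → Inhabited P p
  inhabited (inside ∷ P)  eq = extend zero P (suc-injective eq)
  inhabited (outside ∷ P) eq with extend k P′ eq′ ← inhabited P eq = extend (suc k) (outside ∷ P′) eq′

  -- A neighbourhood R consists of x vertices that are active already and y that become active. In
  -- the induction, each point of Q contributes a choice to x and each point outside Q a choice to
  -- y.
  sumOver-subsets : ∀ {s} (Q : Subset s) (h : ℕ → ℕ → ℕ → ℕ) →
    sumOver (subsets s) (λ R → h (size R) (size (∁ (Q ∪ R))) (size (Q ∪ R)))
      ≡ B (size Q) (λ x _ → B (size (∁ Q)) (λ y j → h (x + y) j (size Q + y)))
  sumOver-subsets [] h = trans (+-identityʳ (h 0 0 0)) (sym (trans (B-base _) (B-base _)))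
  sumOver-subsets {suc s} (inside ∷ Q) h = begin
    sumOver (subsets (suc s)) _
      ≡⟨ sumOver-product _∷_ (outside ∷ inside ∷ []) (subsets s) _ ⟩
    sumOver (subsets s) _ + (sumOver (subsets s) _ + 0)
      ≡⟨ cong₂ _+_ (sumOver-subsets Q (λ x j u → h x j (suc u)))
           (trans (+-identityʳ _) (sumOver-subsets Q (λ x j u → h (suc x) j (suc u)))) ⟩
    B (size Q) (λ x _ → B (size (∁ Q)) (λ y j → h (x + y) j (suc (size Q + y))))
      + B (size Q) (λ x _ → B (size (∁ Q)) (λ y j → h (suc (x + y)) j (suc (size Q + y))))
      ≡⟨ +-comm (B (size Q) _) (B (size Q) _) ⟩
    _
      ≡⟨ B-suc (size Q) (λ x _ → B (size (∁ Q)) (λ y j → h (x + y) j (suc (size Q + y)))) ⟨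
    B (suc (size Q)) (λ x _ → B (size (∁ Q)) (λ y j → h (x + y) j (suc (size Q + y)))) ∎
    where open ≡-Reasoning
  sumOver-subsets {suc s} (outside ∷ Q) h = begin
    sumOver (subsets (suc s)) _
      ≡⟨ sumOver-product _∷_ (outside ∷ inside ∷ []) (subsets s) _ ⟩
    sumOver (subsets s) _ + (sumOver (subsets s) _ + 0)
      ≡⟨ cong₂ _+_ (sumOver-subsets Q (λ x j u → h x (suc j) u))
           (trans (+-identityʳ _) (sumOver-subsets Q (λ x j u → h (suc x) j (suc u)))) ⟩
    B (size Q) (λ x _ → B (size (∁ Q)) (λ y j → h (x + y) (suc j) (size Q + y)))
      + B (size Q) (λ x _ → B (size (∁ Q)) (λ y j → h (suc (x + y)) j (suc (size Q + y))))
      ≡⟨ +-comm (B (size Q) _) (B (size Q) _) ⟩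
    _
      ≡⟨ B-+ (size Q) _ _ ⟨
    B (size Q) (λ x _ → B (size (∁ Q)) (λ y j → h (suc (x + y)) j (suc (size Q + y)))
                   + B (size (∁ Q)) (λ y j → h (x + y) (suc j) (size Q + y)))
      ≡⟨ B-cong′ (size Q) (λ x _ → trans (B-suc (size (∁ Q)) _) (cong (_+ B (size (∁ Q)) (λ y j → h (x + y) (suc j) (size Q + y))) (B-cong′ (size (∁ Q)) λ y j →
           cong₂ (λ a b → h a j b) (+-suc x y) (+-suc (size Q) y)))) ⟨
    B (size Q) (λ x _ → B (suc (size (∁ Q))) (λ y j → h (x + y) j (size Q + y))) ∎
    where open ≡-Reasoning

  Covers : ∀ {V : Set} → (V → V → Set) → (V → Set) → Set
  Covers E A = ∀ v → ∃ λ u → A u × Star E u v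

  -- A graph is stored by rows, so that deleting a left and deleting a right vertex look different.
  -- The common argument is given for abstract relations: `E′` is the graph induced on the vertices
  -- other than k, and `A′` activates the neighbours of k in addition.
  module Deletion {V V′ : Set} {E : V → V → Set} {E′ : V′ → V′ → Set} {A : V → Set} {A′ : V′ → Set}
    (k : V) (ι : V′ → V) (view : ∀ v → (v ≡ k) ⊎ ∃ λ v′ → v ≡ ι v′)
    (E⁺ : ∀ {u v} → E′ u v → E (ι u) (ι v)) (E⁻ : ∀ {u v} → E (ι u) (ι v) → E′ u v) (Ak : A k)
    (A⁺ : ∀ {v} → A′ v → A (ι v) ⊎ E k (ι v)) (A⁻ : ∀ {v} → A (ι v) ⊎ E k (ι v) → A′ v) where

    -- The part of a walk after its last visit to k starts at a neighbour of k.
    cut : ∀ {u v} → Star E u (ι v) → (∃ λ u′ → A′ u′ × Star E′ u′ v) ⊎ (∃ λ u′ → (u ≡ ι u′) × Star E′ u′ v)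
    cut ε = inj₂ (_ , refl , ε)
    cut (_◅_ {u} e w) with cut w
    ... | inj₁ found = inj₁ found
    ... | inj₂ (u₂ , refl , w′) with view u
    ...   | inj₁ refl        = inj₁ (u₂ , A⁻ (inj₂ e) , w′)
    ...   | inj₂ (u′ , refl) = inj₂ (u′ , refl , E⁻ e ◅ w′)

    covers : Covers E A ⇔ Covers E′ A′
    covers = mk⇔ to from
      where
      to : Covers E A → Covers E′ A′
      to c v with c (ι v)
      ... | u , Au , w with cut w
      ...   | inj₁ found           = found
      ...   | inj₂ (u′ , refl , w′) = u′ , A⁻ (inj₁ Au) , w′
      from : Covers E′ A′ → Covers E A
      from c v with view v
      ... | inj₁ refl = k , Ak , ε
      ... | inj₂ (v′ , refl) with c v′
      ...   | u , A′u , w with A⁺ A′u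
      ...     | inj₁ Au = ι u , Au , gmap ι E⁺ w
      ...     | inj₂ e  = k , Ak , e ◅ gmap ι E⁺ w

  Active : ∀ {r s} → Subset r → Subset s → Vertex r s → Set
  Active P Q (inj₁ i) = i ∈ P
  Active P Q (inj₂ j) = j ∈ Q

  Reachable : ∀ {r s} → BiGraph r s → Subset r → Subset s → Set
  Reachable G P Q = Covers (Adj G) (Active P Q)

  active? : ∀ {r s} (P : Subset r) (Q : Subset s) → Decidable (Active P Q)
  active? P Q (inj₁ i) = i ∈? P
  active? P Q (inj₂ j) = j ∈? Q

  reachable? : ∀ {r s} (G : BiGraph r s) P Q → Dec (Reachable G P Q)
  reachable? {r} {s} G P Q = map′
    (λ h v → let u , _ , a , w = find {P = From v} (All.lookup h (∈-vertices v)) in u , a , w)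
    (λ h → All.tabulate λ {v} _ → let u , a , w = h v in lose {P = From v} (∈-vertices u) (a , w))
    (All.all? (λ v → any? (λ u → active? P Q u ×-dec
      star? (Sum.≡-dec Fin._≟_ Fin._≟_) (adj? G) vertices ∈-vertices u v) vertices) vertices)
    where
    open import Data.List.Membership.Propositional using (find; lose)
    open import Data.List.Relation.Unary.Any using (any?)
    From : Vertex r s → Vertex r s → Set
    From v u = Active P Q u × Star (Adj G) u v

  punchIn-view : ∀ {n} (k i : Fin (suc n)) → (i ≡ k) ⊎ ∃ λ i′ → i ≡ punchIn k i′
  punchIn-view k i with k Fin.≟ i
  ... | yes refl = inj₁ refl
  ... | no k≢i   = inj₂ (punchOut k≢i , sym (Fin.punchIn-punchOut k≢i))

  module _ {n} (p : Subset n) (k : Fin (suc n)) {b : Bool} where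

    insertAt-∈ : ∀ {i} → i ∈ p → punchIn k i ∈ insertAt p k b
    insertAt-∈ {i} i∈p = lookup⇒[]= (punchIn k i) _ (trans (insertAt-punchIn p k b i) ([]=⇒lookup i∈p))

    insertAt-∈⁻ : ∀ {i} → punchIn k i ∈ insertAt p k b → i ∈ p
    insertAt-∈⁻ {i} h = lookup⇒[]= i p (trans (sym (insertAt-punchIn p k b i)) ([]=⇒lookup h))

  ∈-insertAt : ∀ {n} (p : Subset n) k → k ∈ insertAt p k inside
  ∈-insertAt p k = lookup⇒[]= k _ (insertAt-lookup p k inside)

  ∈-insertAt⁻ : ∀ {n} (p : Subset n) k {b} → k ∈ insertAt p k b → b ≡ inside
  ∈-insertAt⁻ p k h = trans (sym (insertAt-lookup p k _)) ([]=⇒lookup h)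

  delete-row : ∀ {r s} (G : BiGraph r s) k row P (Q : Subset s) →
    Reachable (insertAt G k row) (insertAt P k inside) Q ⇔ Reachable G P (Q ∪ row)
  delete-row {r} {s} G k row P Q = Deletion.covers (inj₁ k) ι view E⁺ E⁻ (∈-insertAt P k)
    (λ {v} → A⁺ {v}) (λ {v} → A⁻ {v})
    where
    H = insertAt G k row
    ι : Vertex r s → Vertex (suc r) s
    ι = Sum.map₁ (punchIn k)
    view : ∀ v → (v ≡ inj₁ k) ⊎ ∃ λ v′ → v ≡ ι v′
    view (inj₁ i) = Sum.map (cong inj₁) (λ (i′ , eq) → inj₁ i′ , cong inj₁ eq) (punchIn-view k i)
    view (inj₂ j) = inj₂ (inj₂ j , refl)
    E⁺ : ∀ {u v} → Adj G u v → Adj H (ι u) (ι v)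
    E⁺ (left-right {i} e) = left-right (subst (_ ∈_) (sym (insertAt-punchIn G k row i)) e)
    E⁺ (right-left {i} e) = right-left (subst (_ ∈_) (sym (insertAt-punchIn G k row i)) e)
    E⁻ : ∀ {u v} → Adj H (ι u) (ι v) → Adj G u v
    E⁻ {inj₁ i} {inj₂ j} (left-right e) = left-right (subst (j ∈_) (insertAt-punchIn G k row i) e)
    E⁻ {inj₂ j} {inj₁ i} (right-left e) = right-left (subst (j ∈_) (insertAt-punchIn G k row i) e)
    A⁺ : ∀ {v} → Active P (Q ∪ row) v → Active (insertAt P k inside) Q (ι v) ⊎ Adj H (inj₁ k) (ι v)
    A⁺ {inj₁ i} a = inj₁ (insertAt-∈ P k a)
    A⁺ {inj₂ j} a = Sum.map₂ (λ e → left-right (subst (j ∈_) (sym (insertAt-lookup G k row)) e)) (x∈p∪q⁻ Q row a)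
    A⁻ : ∀ {v} → Active (insertAt P k inside) Q (ι v) ⊎ Adj H (inj₁ k) (ι v) → Active P (Q ∪ row) v
    A⁻ {inj₁ i} (inj₁ a)              = insertAt-∈⁻ P k a
    A⁻ {inj₂ j} (inj₁ a)              = x∈p∪q⁺ (inj₁ a)
    A⁻ {inj₂ j} (inj₂ (left-right e)) = x∈p∪q⁺ (inj₂ (subst (j ∈_) (insertAt-lookup G k row) e))

  delete-column : ∀ {r s} (G : BiGraph r s) k col (P : Subset r) Q →
    Reachable (insertColumn G k col) P (insertAt Q k inside) ⇔ Reachable G (P ∪ col) Q
  delete-column {r} {s} G k col P Q = Deletion.covers (inj₂ k) ι view E⁺ E⁻ (∈-insertAt Q k)
    (λ {v} → A⁺ {v}) (λ {v} → A⁻ {v})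
    where
    H = insertColumn G k col
    row : ∀ i → lookup H i ≡ insertAt (lookup G i) k (lookup col i)
    row i = lookup-zipWith _ i G col
    ι : Vertex r s → Vertex r (suc s)
    ι = Sum.map₂ (punchIn k)
    view : ∀ v → (v ≡ inj₂ k) ⊎ ∃ λ v′ → v ≡ ι v′
    view (inj₁ i) = inj₂ (inj₁ i , refl)
    view (inj₂ j) = Sum.map (cong inj₂) (λ (j′ , eq) → inj₂ j′ , cong inj₂ eq) (punchIn-view k j)
    E⁺ : ∀ {u v} → Adj G u v → Adj H (ι u) (ι v)
    E⁺ (left-right {i} e) = left-right (subst (_ ∈_) (sym (row i)) (insertAt-∈ (lookup G i) k e))
    E⁺ (right-left {i} e) = right-left (subst (_ ∈_) (sym (row i)) (insertAt-∈ (lookup G i) k e))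
    E⁻ : ∀ {u v} → Adj H (ι u) (ι v) → Adj G u v
    E⁻ {inj₁ i} {inj₂ j} (left-right e) = left-right (insertAt-∈⁻ (lookup G i) k (subst (_ ∈_) (row i) e))
    E⁻ {inj₂ j} {inj₁ i} (right-left e) = right-left (insertAt-∈⁻ (lookup G i) k (subst (_ ∈_) (row i) e))
    A⁺ : ∀ {v} → Active (P ∪ col) Q v → Active P (insertAt Q k inside) (ι v) ⊎ Adj H (inj₂ k) (ι v)
    A⁺ {inj₁ i} a = Sum.map₂ (λ e → right-left (subst (k ∈_) (sym (row i))
      (subst (λ b → k ∈ insertAt (lookup G i) k b) (sym ([]=⇒lookup e)) (∈-insertAt (lookup G i) k)))) (x∈p∪q⁻ P col a)
    A⁺ {inj₂ j} a = inj₁ (insertAt-∈ Q k a)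
    A⁻ : ∀ {v} → Active P (insertAt Q k inside) (ι v) ⊎ Adj H (inj₂ k) (ι v) → Active (P ∪ col) Q v
    A⁻ {inj₁ i} (inj₁ a)              = x∈p∪q⁺ (inj₁ a)
    A⁻ {inj₁ i} (inj₂ (right-left e)) = x∈p∪q⁺ (inj₂ (lookup⇒[]= i col
      (∈-insertAt⁻ (lookup G i) k (subst (k ∈_) (row i) e))))
    A⁻ {inj₂ j} (inj₁ a)              = insertAt-∈⁻ Q k a

  weigh : ∀ {A : Set} → Dec A → ℕ → ℕ
  weigh a? n = if does a? then n else 0

  weigh-⇔ : ∀ {A B : Set} → A ⇔ B → (a? : Dec A) (b? : Dec B) → ∀ n → weigh a? n ≡ weigh b? n
  weigh-⇔ A⇔B a? b? n = cong (if_then n else 0) (does-⇔ A⇔B a? b?)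

  weigh-no : ∀ {A : Set} → ¬ A → (a? : Dec A) → ∀ n → weigh a? n ≡ 0
  weigh-no ¬a a? n = cong (if_then n else 0) (dec-false a? ¬a)

  reachCount : (ℕ → ℕ) → ∀ {r s} → Subset r → Subset s → ℕ
  reachCount w {r} {s} P Q = sumOver (allBiGraphs r s) (λ G → weigh (reachable? G P Q) (w (edgeCount G)))

  ∉-empty : ∀ {n} (P : Subset n) → size P ≡ 0 → ∀ i → i ∉ P
  ∉-empty (outside ∷ P) eq (suc i) (Vec.there i∈P) = ∉-empty P eq i i∈P

  unreachable : ∀ w {r s} (P : Subset r) (Q : Subset s) → size P ≡ 0 → size Q ≡ 0 → Vertex r s → reachCount w P Q ≡ 0
  unreachable w {r} {s} P Q P-empty Q-empty v = trans
    (sumOver-cong (allBiGraphs r s) λ G → weigh-no (λ c → none G (c v)) (reachable? G P Q) _)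
    (sumOver-zero (allBiGraphs r s))
    where
    none : ∀ G → ¬ ∃ λ u → Active P Q u × Star (Adj G) u v
    none G (inj₁ i , a , _) = ∉-empty P P-empty i a
    none G (inj₂ j , a , _) = ∉-empty Q Q-empty j a

  -- After one deletion, the sum over the neighbourhoods of the deleted vertex depends on P and Q
  -- only through cardinalities, by `sumOver-subsets`. This is what reduces the counting of graphs
  -- to a recursion in four numbers.
  reachCount-explore : ∀ v w {r s} (P : Subset r) (Q : Subset s) {p q} → r + s ≤ v → size P ≡ p → size Q ≡ q →
    reachCount w P Q ≡ explore v w (size (∁ P)) (size (∁ Q)) p q
  reachCount-explore v w [] [] {zero} {zero} _ _ _ =
    trans (+-identityʳ _) (cong (if_then w 0 else 0) (dec-true (reachable? [] [] []) λ { (inj₁ ()) ; (inj₂ ()) }))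
  reachCount-explore v w [] (outside ∷ Q) {zero} {zero} _ p≡ q≡ = unreachable w [] (outside ∷ Q) p≡ q≡ (inj₂ zero)
  reachCount-explore v w (outside ∷ P) Q {zero} {zero} _ p≡ q≡ = unreachable w (outside ∷ P) Q p≡ q≡ (inj₁ zero)
  reachCount-explore zero w {r} {s} P Q {zero} {suc q} r+s≤0 p≡ q≡ = contradiction
    (subst (_≤ 0) q≡ (≤-trans (∣p∣≤n Q) (≤-trans (m≤n+m s r) r+s≤0))) λ ()
  reachCount-explore zero w {r} {s} P Q {suc p} {q} r+s≤0 p≡ q≡ = contradiction
    (subst (_≤ 0) p≡ (≤-trans (∣p∣≤n P) (≤-trans (m≤m+n r s) r+s≤0))) λ ()
  reachCount-explore (suc v) w {r} P Q {zero} {suc q} r+s≤ p≡ q≡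
    with extend {s} k Q′ q≡′ ← inhabited Q q≡ = begin
    reachCount w P (insertAt Q′ k inside)
      ≡⟨ sumOver-insertColumn r k _ ⟩
    sumOver (subsets r) (λ c → sumOver (allBiGraphs r s) (λ G →
      weigh (reachable? (insertColumn G k c) P (insertAt Q′ k inside)) (w (edgeCount (insertColumn G k c)))))
      ≡⟨ sumOver-cong (subsets r) (λ c → sumOver-cong (allBiGraphs r s) (λ G → trans
           (weigh-⇔ (delete-column G k c P Q′) (reachable? (insertColumn G k c) P (insertAt Q′ k inside)) (reachable? G (P ∪ c) Q′) _)
           (cong (λ m → weigh (reachable? G (P ∪ c) Q′) (w m)) (edgeCount-insertColumn G k c)))) ⟩
    sumOver (subsets r) (λ c → reachCount (λ m → w (size c + m)) (P ∪ c) Q′)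
      ≡⟨ sumOver-cong (subsets r) (λ c → reachCount-explore v _ (P ∪ c) Q′ r+s≤v refl q≡′) ⟩
    sumOver (subsets r) (λ c → explore v (λ m → w (size c + m)) (size (∁ (P ∪ c))) (size (∁ Q′)) (size (P ∪ c)) q)
      ≡⟨ sumOver-subsets P (λ x i p → explore v (λ m → w (x + m)) i (size (∁ Q′)) p q) ⟩
    B (size P) (λ x _ → B (size (∁ P)) (λ y i → explore v (λ m → w (x + y + m)) i (size (∁ Q′)) (size P + y) q))
      -- Right vertices are deleted only when no left vertex is active, so no edge to an active
      -- vertex can occur here.
      ≡⟨ cong (λ p → B p (λ x _ → B (size (∁ P)) (λ y i → explore v (λ m → w (x + y + m)) i (size (∁ Q′)) (p + y) q))) p≡ ⟩
    B 0 (λ x _ → B (size (∁ P)) (λ y i → explore v (λ m → w (x + y + m)) i (size (∁ Q′)) y q))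
      ≡⟨ B-base _ ⟩
    B (size (∁ P)) (λ y i → explore v (λ m → w (y + m)) i (size (∁ Q′)) y q)
      ≡⟨ cong (λ j → B (size (∁ P)) (λ y i → explore v (λ m → w (y + m)) i j y q)) (size-∁-insertAt Q′ k) ⟨
    B (size (∁ P)) (λ y i → explore v (λ m → w (y + m)) i (size (∁ (insertAt Q′ k inside))) y q)
      ≡⟨ unfold (size (∁ P)) _ ⟨
    explore (suc v) w (size (∁ P)) (size (∁ (insertAt Q′ k inside))) zero (suc q) ∎
    where
    open ≡-Reasoning
    r+s≤v : r + s ≤ v
    r+s≤v = ≤-pred (subst (_≤ suc v) (+-suc r s) r+s≤)
    unfold : ∀ i j → explore (suc v) w i j zero (suc q) ≡ B i (λ x i′ → explore v (λ m → w (x + m)) i′ j x q)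
    unfold zero    zero    = refl
    unfold zero    (suc j) = refl
    unfold (suc i) j       = refl
  reachCount-explore (suc v) w {r} {s} P Q {suc p} {q} r+s≤ p≡ q≡
    with extend {r} k P′ p≡′ ← inhabited P p≡ = begin
    reachCount w (insertAt P′ k inside) Q
      ≡⟨ sumOver-insertAt (subsets s) k _ ⟩
    sumOver (subsets s) (λ row → sumOver (allBiGraphs r s) (λ G →
      weigh (reachable? (insertAt G k row) (insertAt P′ k inside) Q) (w (edgeCount (insertAt G k row)))))
      ≡⟨ sumOver-cong (subsets s) (λ row → sumOver-cong (allBiGraphs r s) (λ G → trans
           (weigh-⇔ (delete-row G k row P′ Q) (reachable? (insertAt G k row) (insertAt P′ k inside) Q) (reachable? G P′ (Q ∪ row)) _)
           (cong (λ m → weigh (reachable? G P′ (Q ∪ row)) (w m)) (edgeCount-insertAt G k row)))) ⟩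
    sumOver (subsets s) (λ row → reachCount (λ m → w (size row + m)) P′ (Q ∪ row))
      ≡⟨ sumOver-cong (subsets s) (λ row → reachCount-explore v _ P′ (Q ∪ row) (≤-pred r+s≤) p≡′ refl) ⟩
    sumOver (subsets s) (λ row → explore v (λ m → w (size row + m)) (size (∁ P′)) (size (∁ (Q ∪ row))) p (size (Q ∪ row)))
      ≡⟨ sumOver-subsets Q (λ x j q → explore v (λ m → w (x + m)) (size (∁ P′)) j p q) ⟩
    B (size Q) (λ x _ → B (size (∁ Q)) (λ y j → explore v (λ m → w (x + y + m)) (size (∁ P′)) j p (size Q + y)))
      ≡⟨ cong₂ (λ q i → B q (λ x _ → B (size (∁ Q)) (λ y j → explore v (λ m → w (x + y + m)) i j p (q + y)))) q≡ (sym (size-∁-insertAt P′ k)) ⟩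
    B q (λ x _ → B (size (∁ Q)) (λ y j → explore v (λ m → w (x + y + m)) (size (∁ (insertAt P′ k inside))) j p (q + y)))
      ≡⟨ unfold (size (∁ (insertAt P′ k inside))) (size (∁ Q)) ⟨
    explore (suc v) w (size (∁ (insertAt P′ k inside))) (size (∁ Q)) (suc p) q ∎
    where
    open ≡-Reasoning
    unfold : ∀ i j → explore (suc v) w i j (suc p) q ≡ B q (λ x _ → B j (λ y j′ → explore v (λ m → w (x + y + m)) i j′ p (q + y)))
    unfold zero    zero    = refl
    unfold zero    (suc j) = refl
    unfold (suc i) j       = refl

-- Connected bipartite graphs of Betti number one

module Counting where

  open BinomialSums
  open RootedForests
  open Exploration
  open Reachability
  open import Defs hiding (_+_; _*_; _-_; -_; _<_)

  open import Data.Bool.Base using (true; false; if_then_else_)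
  open import Data.Fin.Base using (zero)
  open import Data.Fin.Subset using (Subset; ⊥; ⁅_⁆; ∁)
  open import Data.Fin.Subset using () renaming (∣_∣ to size)
  open import Data.Fin.Subset.Properties using (∉⊥; ∣⊥∣≡0; x∈⁅x⁆; x∈⁅y⁆⇒x≡y; ∣∁p∣≡n∸∣p∣)
  open import Data.Integer.Base as ℤ using (1ℤ)
  import Data.Integer.Properties as ℤ
  open import Data.List.Base using (List; []; _∷_; length; filter; upTo; applyUpTo)
  open import Data.List.Properties using (map-upTo)
  open import Data.Nat.Base using (ℕ; zero; suc; _+_; _*_; _^_; _∸_; _≤_; _<_; z≤n; s≤s; ⌊_/2⌋; _!)
  open import Data.Nat.Combinatorics using (_C_; nCk+nC[k+1]≡[n+1]C[k+1]; k>n⇒nCk≡0)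
  open import Data.Nat.ListAction using (sum)
  open import Data.Nat.Properties
  open import Data.Nat.Tactic.RingSolver using (solve-∀)
  open import Data.Product.Base using (_,_)
  open import Data.Sum.Base using (inj₁; inj₂)
  open import Function.Base using (_∘_)
  open import Function.Bundles using (_⇔_; mk⇔)
  open import Relation.Binary.Construct.Closure.ReflexiveTransitive using (Star; reverse; _◅◅_)
  open import Relation.Binary.PropositionalEquality
  open import Relation.Nullary using (Dec; does; contradiction)
  open import Relation.Nullary.Decidable using (dec-true; dec-false; _×-dec_)
  open import Relation.Unary using (Decidable)

  length-filter : ∀ {A : Set} {P : A → Set} (P? : Decidable P) xs → length (filter P? xs) ≡ sumOver xs (λ x → weigh (P? x) 1)
  length-filter P? []       = refl
  length-filter P? (x ∷ xs) with does (P? x)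
  ... | true  = cong suc (length-filter P? xs)
  ... | false = length-filter P? xs

  adj-sym : ∀ {r s} {G : BiGraph r s} {u v} → Adj G u v → Adj G v u
  adj-sym (left-right e) = right-left e
  adj-sym (right-left e) = left-right e

  δ : ℕ → ℕ → ℕ
  δ n m = weigh (m ≟ n) 1

  edges⇔ : ∀ m n → (ℤ.+ m ≡ ℤ.+ n ℤ.+ 1ℤ ℤ.- 1ℤ) ⇔ (m ≡ n)
  edges⇔ m n = mk⇔ (λ eq → ℤ.+-injective (trans eq (n+1-1 n))) (λ eq → trans (cong ℤ.+_ eq) (sym (n+1-1 n)))
    where
    n+1-1 : ∀ n → ℤ.+ n ℤ.+ 1ℤ ℤ.- 1ℤ ≡ ℤ.+ n
    n+1-1 n = trans (ℤ.+-assoc (ℤ.+ n) 1ℤ ℤ.-1ℤ) (ℤ.+-identityʳ (ℤ.+ n))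

  -- With a single active vertex, reachability is connectedness, because walks can be reversed.
  -- Betti number one means r + s edges, which `δ (r + s)` selects.
  N-bi₂-root : ∀ {r s} (v₀ : Vertex r s) P Q → Active P Q v₀ → (∀ u → Active P Q u → u ≡ v₀) → 0 < r + s →
               N-bi₂ r s 1ℤ ≡ reachCount (δ (r + s)) P Q
  N-bi₂-root {r} {s} v₀ P Q active unique 0<r+s = trans (length-filter (isCounted? 1ℤ) (allBiGraphs r s))
    (sumOver-cong (allBiGraphs r s) λ G → trans
      (weigh-× (connected? G) (ℤ.+ edgeCount G ℤ.≟ ℤ.+ r ℤ.+ ℤ.+ s ℤ.+ 1ℤ ℤ.- 1ℤ))
      (trans (weigh-⇔ (connected⇔ G) (connected? G) (reachable? G P Q) _)
      (cong (weigh (reachable? G P Q)) (weigh-⇔ (edges⇔ (edgeCount G) (r + s))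
        (ℤ.+ edgeCount G ℤ.≟ ℤ.+ r ℤ.+ ℤ.+ s ℤ.+ 1ℤ ℤ.- 1ℤ) (edgeCount G ≟ r + s) 1))))
    where
    weigh-× : ∀ {A B : Set} (a? : Dec A) (b? : Dec B) → weigh (a? ×-dec b?) 1 ≡ weigh a? (weigh b? 1)
    weigh-× a? b? with does a?
    ... | true  = refl
    ... | false = refl
    connected⇔ : ∀ G → Connected G ⇔ Reachable G P Q
    connected⇔ G = mk⇔ (λ (_ , c) v → v₀ , active , c v₀ v) (λ c → 0<r+s , λ u v → reverse adj-sym (from c u) ◅◅ from c v)
      where
      from : Reachable G P Q → ∀ v → Star (Adj G) v₀ v
      from c v with u , a , w ← c v = subst (λ u → Star (Adj G) u v) (unique u a) w

  size-∁⊥ : ∀ n → size (∁ (⊥ {n})) ≡ n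
  size-∁⊥ n = trans (∣∁p∣≡n∸∣p∣ (⊥ {n})) (cong (n ∸_) (∣⊥∣≡0 n))

  N-bi₂-left : ∀ r s → N-bi₂ (suc r) s 1ℤ ≡ explore (suc (r + s)) (δ (suc (r + s))) r s 1 0
  N-bi₂-left r s = begin
    N-bi₂ (suc r) s 1ℤ
      ≡⟨ N-bi₂-root {suc r} {s} (inj₁ zero) ⁅ zero ⁆ ⊥ (x∈⁅x⁆ zero)
           (λ { (inj₁ i) i∈ → cong inj₁ (x∈⁅y⁆⇒x≡y zero i∈) ; (inj₂ j) j∈ → contradiction j∈ ∉⊥ }) (s≤s z≤n) ⟩
    reachCount (δ (suc (r + s))) (⁅ zero {r} ⁆) (⊥ {s})
      ≡⟨ reachCount-explore (suc (r + s)) _ (⁅ zero {r} ⁆) (⊥ {s}) ≤-refl (cong suc (∣⊥∣≡0 r)) (∣⊥∣≡0 s) ⟩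
    explore (suc (r + s)) (δ (suc (r + s))) (size (∁ (⊥ {r}))) (size (∁ (⊥ {s}))) 1 0
      ≡⟨ cong₂ (λ i j → explore (suc (r + s)) (δ (suc (r + s))) i j 1 0) (size-∁⊥ r) (size-∁⊥ s) ⟩
    explore (suc (r + s)) (δ (suc (r + s))) r s 1 0 ∎
    where open ≡-Reasoning

  N-bi₂-right : ∀ r s → N-bi₂ r (suc s) 1ℤ ≡ explore (suc (r + s)) (δ (suc (r + s))) r s 0 1
  N-bi₂-right r s = begin
    N-bi₂ r (suc s) 1ℤ
      ≡⟨ N-bi₂-root {r} {suc s} (inj₂ zero) ⊥ ⁅ zero ⁆ (x∈⁅x⁆ zero)
           (λ { (inj₁ i) i∈ → contradiction i∈ ∉⊥ ; (inj₂ j) j∈ → cong inj₂ (x∈⁅y⁆⇒x≡y zero j∈) })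
           (subst (0 <_) (sym (+-suc r s)) (s≤s z≤n)) ⟩
    reachCount (δ (r + suc s)) (⊥ {r}) (⁅ zero {s} ⁆)
      ≡⟨ cong (λ m → reachCount (δ (m)) (⊥ {r}) (⁅ zero {s} ⁆)) (+-suc r s) ⟩
    reachCount (δ (suc (r + s))) (⊥ {r}) (⁅ zero {s} ⁆)
      ≡⟨ reachCount-explore (suc (r + s)) _ (⊥ {r}) (⁅ zero {s} ⁆) (≤-reflexive (+-suc r s)) (∣⊥∣≡0 r) (cong suc (∣⊥∣≡0 s)) ⟩
    explore (suc (r + s)) (δ (suc (r + s))) (size (∁ (⊥ {r}))) (size (∁ (⊥ {s}))) 0 1
      ≡⟨ cong₂ (λ i j → explore (suc (r + s)) (δ (suc (r + s))) i j 0 1) (size-∁⊥ r) (size-∁⊥ s) ⟩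
    explore (suc (r + s)) (δ (suc (r + s))) r s 0 1 ∎
    where open ≡-Reasoning

  sumTo : ℕ → (ℕ → ℕ) → ℕ
  sumTo zero    f = 0
  sumTo (suc n) f = f 0 + sumTo n (f ∘ suc)

  sumOver-upTo : ∀ n f → sumOver (upTo n) f ≡ sumTo n f
  sumOver-upTo n f = trans (cong sum (map-upTo f n)) (go n f)
    where
    go : ∀ n f → sum (applyUpTo f n) ≡ sumTo n f
    go zero    f = refl
    go (suc n) f = cong (f 0 +_) (go n (f ∘ suc))

  sumTo-cong : ∀ n {f g} → (∀ i → i < n → f i ≡ g i) → sumTo n f ≡ sumTo n g
  sumTo-cong zero    h = refl
  sumTo-cong (suc n) h = cong₂ _+_ (h 0 (s≤s z≤n)) (sumTo-cong n λ i i<n → h (suc i) (s≤s i<n))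

  sumTo-+ : ∀ n f g → sumTo n (λ i → f i + g i) ≡ sumTo n f + sumTo n g
  sumTo-+ zero    f g = refl
  sumTo-+ (suc n) f g = trans (cong (f 0 + g 0 +_) (sumTo-+ n (f ∘ suc) (g ∘ suc))) (interchange (f 0) (g 0) _ _)

  sumTo-* : ∀ n c f → sumTo n (λ i → c * f i) ≡ c * sumTo n f
  sumTo-* zero    c f = sym (*-zeroʳ c)
  sumTo-* (suc n) c f = trans (cong (c * f 0 +_) (sumTo-* n c (f ∘ suc))) (sym (*-distribˡ-+ c (f 0) _))

  sumTo-last : ∀ n f → sumTo (suc n) f ≡ sumTo n f + f n
  sumTo-last zero    f = +-identityʳ (f 0)
  sumTo-last (suc n) f = trans (cong (f 0 +_) (sumTo-last n (f ∘ suc))) (sym (+-assoc (f 0) _ _))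

  -- The recursion defining `B` is Pascal's rule.
  sumTo-B : ∀ n (f : ℕ → ℕ → ℕ) → sumTo (suc n) (λ r → (n C r) * f r (n ∸ r)) ≡ B n f
  sumTo-B zero    f = trans (+-identityʳ _) (trans (+-identityʳ _) (sym (B-base f)))
  sumTo-B (suc n) f = begin
    1 * f 0 (suc n) + sumTo (suc n) (λ r → (suc n C suc r) * f (suc r) (n ∸ r))
      ≡⟨ cong (1 * f 0 (suc n) +_) (trans (sumTo-cong (suc n) (λ r _ → trans
           (cong (_* f (suc r) (n ∸ r)) (sym (nCk+nC[k+1]≡[n+1]C[k+1] n r)))
           (*-distribʳ-+ (f (suc r) (n ∸ r)) (n C r) (n C suc r)))) (sumTo-+ (suc n) g h)) ⟩
    1 * f 0 (suc n) + (sumTo (suc n) g + sumTo (suc n) h)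
      ≡⟨ reorder (1 * f 0 (suc n)) (sumTo (suc n) g) (sumTo (suc n) h) ⟩
    sumTo (suc n) g + sumTo (suc (suc n)) k
      ≡⟨ cong₂ _+_ (sumTo-B n (λ i j → f (suc i) j)) (trans (sumTo-last (suc n) k) (cong₂ _+_
           (trans (sumTo-cong (suc n) (λ r r<n → cong (λ s → (n C r) * f r s) (+-∸-assoc 1 (≤-pred r<n))))
                  (sumTo-B n (λ i j → f i (suc j))))
           (cong (_* f (suc n) (n ∸ n)) (k>n⇒nCk≡0 (n<1+n n))))) ⟩
    B n (λ i j → f (suc i) j) + (B n (λ i j → f i (suc j)) + 0)
      ≡⟨ cong (B n (λ i j → f (suc i) j) +_) (+-identityʳ _) ⟩
    B n (λ i j → f (suc i) j) + B n (λ i j → f i (suc j))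
      ≡⟨ B-suc n f ⟨
    B (suc n) f ∎
    where
    open ≡-Reasoning
    g h k : ℕ → ℕ
    g r = (n C r) * f (suc r) (n ∸ r)
    h r = (n C suc r) * f (suc r) (n ∸ r)
    k r = (n C r) * f r (suc n ∸ r)
    reorder : ∀ a b c → a + (b + c) ≡ b + (a + c)
    reorder = solve-∀

  N-bi-B : ∀ n k → N-bi n k ≡ B n (λ r s → N-bi₂ r s k)
  N-bi-B n k = trans (sumOver-upTo (suc n) (λ r → (n C r) * N-bi₂ r (n ∸ r) k)) (sumTo-B n (λ r s → N-bi₂ r s k))

  -- One vertex is singled out as the root, and its two possible colours split the sum. Each colour
  -- contributes half of `cycles`: the forest term drops out because `δ (suc n)` vanishes at n, and
  -- a single root admits no path between roots.
  N-bi-cycles : ∀ n → N-bi (suc n) 1ℤ ≡ cycles n (suc n)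
  N-bi-cycles n = *-cancelˡ-≡ (N-bi (suc n) 1ℤ) (cycles n (suc n)) 2 (begin
    2 * N-bi (suc n) 1ℤ
      ≡⟨ cong (2 *_) (trans (N-bi-B (suc n) 1ℤ) (B-suc n (λ r s → N-bi₂ r s 1ℤ))) ⟩
    2 * (B n (λ r s → N-bi₂ (suc r) s 1ℤ) + B n (λ r s → N-bi₂ r (suc s) 1ℤ))
      ≡⟨ cong (2 *_) (cong₂ _+_
           (B-cong n (λ r s eq → trans (N-bi₂-left r s) (cong (λ m → explore (suc m) (δ (suc m)) r s 1 0) eq)))
           (B-cong n (λ r s eq → trans (N-bi₂-right r s) (cong (λ m → explore (suc m) (δ (suc m)) r s 0 1) eq)))) ⟩
    2 * (exploreAll (suc n) w n 1 0 + exploreAll (suc n) w n 0 1)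
      ≡⟨ *-distribˡ-+ 2 (exploreAll (suc n) w n 1 0) (exploreAll (suc n) w n 0 1) ⟩
    2 * exploreAll (suc n) w n 1 0 + 2 * exploreAll (suc n) w n 0 1
      ≡⟨ cong₂ _+_ (exploreAll-closed (suc n) w n 1 0 (+-comm n 1) vanishes)
                   (exploreAll-closed (suc n) w n 0 1 (+-comm n 1) vanishes) ⟩
    closedForm w n 1 0 + closedForm w n 0 1
      ≡⟨ cong₂ (λ a b → (2 * a * forests n 1 + b * unicyclic n 1 0) + (2 * a * forests n 1 + b * unicyclic n 0 1)) w-n w-suc-n ⟩
    (unicyclic n 1 0 + 0) + (unicyclic n 0 1 + 0)
      ≡⟨ cong₂ (λ a b → (a + 0) + (b + 0)) (unicyclic-one-root n) (trans (unicyclic-sym n 0 1) (unicyclic-one-root n)) ⟩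
    (cycles n (suc n) + 0) + (cycles n (suc n) + 0)
      ≡⟨ double (cycles n (suc n)) ⟩
    2 * cycles n (suc n) ∎)
    where
    open ≡-Reasoning
    w = (δ (suc n))
    w-n : w n ≡ 0
    w-n = cong (if_then 1 else 0) (dec-false (n ≟ suc n) (<⇒≢ (n<1+n n)))
    w-suc-n : w (suc n) ≡ 1
    w-suc-n = cong (if_then 1 else 0) (dec-true (suc n ≟ suc n) refl)
    vanishes : Vanishes n w
    vanishes m n+2≤m = cong (if_then 1 else 0) (dec-false (m ≟ suc n) (>⇒≢ n+2≤m))
    double : ∀ a → (a + 0) + (a + 0) ≡ 2 * a
    double = solve-∀

  falling : ℕ → ℕ → ℕ
  falling n       zero    = 1
  falling zero    (suc l) = 0
  falling (suc n) (suc l) = suc n * falling n l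

  falling-! : ∀ n l → l ≤ n → falling n l * (n ∸ l) ! ≡ n !
  falling-! n       zero    _         = +-identityʳ (n !)
  falling-! (suc n) (suc l) (s≤s l≤n) = trans (*-assoc (suc n) (falling n l) _) (cong (suc n *_) (falling-! n l l≤n))

  -- There are ⌊(n + 1) / 2⌋ odd numbers l ≤ n; two steps of the mutual recursion supply one
  -- summand.
  oddFalls-sum : ∀ n m → oddFalls n m ≡ sumTo ⌊ suc n /2⌋ (λ k → falling n (1 + 2 * k) * m ^ (n ∸ (1 + 2 * k)))
  oddFalls-sum zero          m = refl
  oddFalls-sum (suc zero)    m = refl
  oddFalls-sum (suc (suc n)) m = begin
    suc (suc n) * (m ^ suc n + suc n * oddFalls n m)
      ≡⟨ cong (λ o → suc (suc n) * (m ^ suc n + suc n * o)) (oddFalls-sum n m) ⟩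
    suc (suc n) * (m ^ suc n + suc n * s)
      ≡⟨ ring (suc n) (m ^ suc n) s ⟩
    suc (suc n) * 1 * m ^ suc n + suc (suc n) * suc n * s
      ≡⟨ cong (suc (suc n) * 1 * m ^ suc n +_) (sumTo-* ⌊ suc n /2⌋ (suc (suc n) * suc n) _) ⟨
    suc (suc n) * 1 * m ^ suc n
      + sumTo ⌊ suc n /2⌋ (λ k → suc (suc n) * suc n * (falling n (1 + 2 * k) * m ^ (n ∸ (1 + 2 * k))))
      ≡⟨ cong (suc (suc n) * 1 * m ^ suc n +_) (sumTo-cong ⌊ suc n /2⌋ (λ k _ → trans
           (regroup (suc (suc n)) (suc n) (falling n (1 + 2 * k)) (m ^ (n ∸ (1 + 2 * k))))
           (cong (λ l → falling (suc (suc n)) (suc l) * m ^ (suc n ∸ l)) (sym (*-suc 2 k))))) ⟩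
    suc (suc n) * 1 * m ^ suc n
      + sumTo ⌊ suc n /2⌋ (λ k → falling (suc (suc n)) (1 + 2 * suc k) * m ^ (suc (suc n) ∸ (1 + 2 * suc k))) ∎
    where
    open ≡-Reasoning
    s = sumTo ⌊ suc n /2⌋ (λ k → falling n (1 + 2 * k) * m ^ (n ∸ (1 + 2 * k)))
    ring : ∀ n p s → suc n * (p + n * s) ≡ suc n * 1 * p + suc n * n * s
    ring = solve-∀
    regroup : ∀ a b f p → a * b * (f * p) ≡ a * (b * f) * p
    regroup = solve-∀

-- The exact formula

module ExactFormula where

  open RootedForests
  open Counting
  open import Defs using (fromℕℚ; N-bi; term; ∑[_⋯_]; module ℚ-Lemmas)
  open ℚ-Lemmas using (/-*; /-≤; /-suc)

  open import Data.Integer.Base as ℤ using (1ℤ)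
  open import Data.List.Base using (List; foldr; applyUpTo)
  open import Data.List.Properties using (map-upTo)
  open import Data.Nat.Base as ℕ using (ℕ; zero; suc; NonZero; z≤n; s≤s; ⌊_/2⌋; _!)
  import Data.Nat.Properties as ℕ
  open import Data.Nat.Tactic.RingSolver using (solve-∀)
  open import Data.Rational.Base using (ℚ; 0ℚ; 1ℚ; _+_; _*_; _/_; _≤_)
  import Data.Rational.Properties as ℚ
  open import Data.Rational.Solver using (module +-*-Solver)
  open +-*-Solver using (solve; _:=_; _:+_; _:*_; _:-_; :-_; con)
  open import Function.Base using (_∘_)
  open import Relation.Binary.PropositionalEquality

  fromℕℚ-+ : ∀ m n → fromℕℚ (m ℕ.+ n) ≡ fromℕℚ m + fromℕℚ n
  fromℕℚ-+ zero    n = sym (ℚ.+-identityˡ (fromℕℚ n))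
  fromℕℚ-+ (suc m) n = begin
    fromℕℚ (suc m ℕ.+ n)        ≡⟨ /-suc (m ℕ.+ n) 0 ⟩
    fromℕℚ (m ℕ.+ n) + 1ℚ       ≡⟨ cong (_+ 1ℚ) (fromℕℚ-+ m n) ⟩
    fromℕℚ m + fromℕℚ n + 1ℚ    ≡⟨ solve 3 (λ a b c → a :+ b :+ c := a :+ c :+ b) refl (fromℕℚ m) (fromℕℚ n) 1ℚ ⟩
    fromℕℚ m + 1ℚ + fromℕℚ n    ≡⟨ cong (_+ fromℕℚ n) (/-suc m 0) ⟨
    fromℕℚ (suc m) + fromℕℚ n   ∎
    where
    open ≡-Reasoning

  fromℕℚ-* : ∀ m n → fromℕℚ (m ℕ.* n) ≡ fromℕℚ m * fromℕℚ n
  fromℕℚ-* m n = sym (/-* m 0 n 0)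

  /-cross : ∀ {a b c d} → a ℕ.* suc d ≡ c ℕ.* suc b → ℤ.+ a / suc b ≡ ℤ.+ c / suc d
  /-cross {a} {b} {c} {d} eq = ℚ.≤-antisym (/-≤ {a} {b} {c} {d} (ℕ.≤-reflexive eq)) (/-≤ {c} {d} {a} {b} (ℕ.≤-reflexive (sym eq)))

  fromℕℚ-*-/ : ∀ a b c d .{{_ : NonZero d}} → a ℕ.* b ≡ c ℕ.* d → fromℕℚ a * (ℤ.+ b / d) ≡ fromℕℚ c
  fromℕℚ-*-/ a b c (suc d) eq = trans (/-* a 0 b d)
    (/-cross {a ℕ.* b} {d ℕ.+ 0} {c} {0} (trans (ℕ.*-identityʳ (a ℕ.* b)) (trans eq (cong (λ d → c ℕ.* suc d) (sym (ℕ.+-identityʳ d))))))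

  ∑< : ℕ → (ℕ → ℚ) → ℚ
  ∑< zero    f = 0ℚ
  ∑< (suc n) f = f 0 + ∑< n (f ∘ suc)

  ∑-∑< : ∀ a b f → ∑[ a ⋯ b ] f ≡ ∑< (suc b ℕ.∸ a) (λ i → f (a ℕ.+ i))
  ∑-∑< a b f = trans (cong (foldr (λ k q → f k + q) 0ℚ) (map-upTo (a ℕ.+_) (suc b ℕ.∸ a))) (go (suc b ℕ.∸ a) (a ℕ.+_))
    where
    go : ∀ n g → foldr (λ k q → f k + q) 0ℚ (applyUpTo g n) ≡ ∑< n (f ∘ g)
    go zero    g = refl
    go (suc n) g = cong (f (g 0) +_) (go n (g ∘ suc))

  fromℕℚ-sumTo : ∀ n (f : ℕ → ℕ) c (g : ℕ → ℚ) → (∀ i → i ℕ.< n → fromℕℚ (f i) ≡ c * g i) → fromℕℚ (sumTo n f) ≡ c * ∑< n g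
  fromℕℚ-sumTo zero    f c g h = sym (ℚ.*-zeroʳ c)
  fromℕℚ-sumTo (suc n) f c g h = begin
    fromℕℚ (f 0 ℕ.+ sumTo n (f ∘ suc))          ≡⟨ fromℕℚ-+ (f 0) _ ⟩
    fromℕℚ (f 0) + fromℕℚ (sumTo n (f ∘ suc))   ≡⟨ cong₂ _+_ (h 0 (s≤s z≤n)) (fromℕℚ-sumTo n (f ∘ suc) c (g ∘ suc) λ i i<n → h (suc i) (s≤s i<n)) ⟩
    c * g 0 + c * ∑< n (g ∘ suc)                ≡⟨ ℚ.*-distribˡ-+ c (g 0) _ ⟨
    c * ∑< (suc n) g                            ∎
    where open ≡-Reasoning

  fromℕℚ-term : ∀ a c n .{{_ : NonZero n}} k → a ℕ.* n ! ≡ c ℕ.* ((n ℕ.∸ 2 ℕ.* k) ! ℕ.* n ℕ.^ (2 ℕ.* k)) → fromℕℚ a * term n k ≡ fromℕℚ c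
  fromℕℚ-term a c n k eq = fromℕℚ-*-/ a (n !) c ((n ℕ.∸ 2 ℕ.* k) ! ℕ.* n ℕ.^ (2 ℕ.* k))
    {{ℕ.m*n≢0 ((n ℕ.∸ 2 ℕ.* k) !) (n ℕ.^ (2 ℕ.* k)) {{(n ℕ.∸ 2 ℕ.* k) ℕ.!≢0}} {{ℕ.m^n≢0 n (2 ℕ.* k)}}}} eq

  2*⌊n/2⌋≤n : ∀ n → 2 ℕ.* ⌊ n /2⌋ ℕ.≤ n
  2*⌊n/2⌋≤n zero          = z≤n
  2*⌊n/2⌋≤n (suc zero)    = z≤n
  2*⌊n/2⌋≤n (suc (suc n)) = subst (ℕ._≤ suc (suc n)) (sym (ℕ.*-suc 2 ⌊ n /2⌋)) (s≤s (s≤s (2*⌊n/2⌋≤n n)))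

  -- For m = 3 + n vertices `cycles (2 + n)` unfolds to its two leading factors times
  -- `oddFalls n m`, whose number of summands is ⌊m / 2⌋ - 1, the number of indices from 2 to ⌊m /
  -- 2⌋.
  N-bi-exact : ∀ n → fromℕℚ (N-bi (3 ℕ.+ n) 1ℤ) ≡ fromℕℚ ((3 ℕ.+ n) ℕ.^ (2 ℕ.+ n)) * ∑[ 2 ⋯ ⌊ 3 ℕ.+ n /2⌋ ] (λ k → term (3 ℕ.+ n) k)
  N-bi-exact n = begin
    fromℕℚ (N-bi m 1ℤ)
      ≡⟨ cong fromℕℚ (N-bi-cycles (2 ℕ.+ n)) ⟩
    fromℕℚ (suc (suc n) ℕ.* (suc n ℕ.* oddFalls n m))
      ≡⟨ cong (λ s → fromℕℚ (suc (suc n) ℕ.* (suc n ℕ.* s))) (oddFalls-sum n m) ⟩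
    fromℕℚ (suc (suc n) ℕ.* (suc n ℕ.* sumTo h (λ i → falling n (1 ℕ.+ 2 ℕ.* i) ℕ.* m ℕ.^ (n ℕ.∸ (1 ℕ.+ 2 ℕ.* i)))))
      ≡⟨ cong fromℕℚ (trans (cong (suc (suc n) ℕ.*_) (sym (sumTo-* h (suc n) _))) (sym (sumTo-* h (suc (suc n)) _))) ⟩
    fromℕℚ (sumTo h g)
      ≡⟨ fromℕℚ-sumTo h g (fromℕℚ (m ℕ.^ (2 ℕ.+ n))) (λ i → term m (2 ℕ.+ i)) (λ i i<h → sym
           (fromℕℚ-term (m ℕ.^ (2 ℕ.+ n)) (g i) m (2 ℕ.+ i) (summand i i<h))) ⟩
    fromℕℚ (m ℕ.^ (2 ℕ.+ n)) * ∑< h (λ i → term m (2 ℕ.+ i))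
      ≡⟨ cong (fromℕℚ (m ℕ.^ (2 ℕ.+ n)) *_) (∑-∑< 2 ⌊ m /2⌋ (λ k → term m k)) ⟨
    fromℕℚ (m ℕ.^ (2 ℕ.+ n)) * ∑[ 2 ⋯ ⌊ m /2⌋ ] (λ k → term m k) ∎
    where
    open ≡-Reasoning
    m = 3 ℕ.+ n
    h = ⌊ suc n /2⌋
    g : ℕ → ℕ
    g i = suc (suc n) ℕ.* (suc n ℕ.* (falling n (1 ℕ.+ 2 ℕ.* i) ℕ.* m ℕ.^ (n ℕ.∸ (1 ℕ.+ 2 ℕ.* i))))
    summand : ∀ i → i ℕ.< h →
      m ℕ.^ (2 ℕ.+ n) ℕ.* m ! ≡ g i ℕ.* ((m ℕ.∸ 2 ℕ.* (2 ℕ.+ i)) ! ℕ.* m ℕ.^ (2 ℕ.* (2 ℕ.+ i)))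
    summand i i<h = begin
      -- Three factors of `m !` are split off: m - 1 and m - 2 belong to `g i`, while m raises the
      -- power to the even exponent 3 + l = 2 (2 + i).
      m ℕ.^ (2 ℕ.+ n) ℕ.* (m ℕ.* (suc (suc n) ℕ.* (suc n ℕ.* n !)))
        ≡⟨ cong₂ (λ e x → m ℕ.^ e ℕ.* (m ℕ.* (suc (suc n) ℕ.* (suc n ℕ.* x))))
             exponent (sym (falling-! n l l≤n)) ⟩
      m ℕ.^ ((n ℕ.∸ l) ℕ.+ (2 ℕ.+ l)) ℕ.* (m ℕ.* (suc (suc n) ℕ.* (suc n ℕ.* (falling n l ℕ.* (n ℕ.∸ l) !))))
        ≡⟨ cong (ℕ._* (m ℕ.* (suc (suc n) ℕ.* (suc n ℕ.* (falling n l ℕ.* (n ℕ.∸ l) !))))) (ℕ.^-distribˡ-+-* m (n ℕ.∸ l) (2 ℕ.+ l)) ⟩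
      m ℕ.^ (n ℕ.∸ l) ℕ.* m ℕ.^ (2 ℕ.+ l) ℕ.* (m ℕ.* (suc (suc n) ℕ.* (suc n ℕ.* (falling n l ℕ.* (n ℕ.∸ l) !))))
        ≡⟨ regroup (m ℕ.^ (n ℕ.∸ l)) (m ℕ.^ (2 ℕ.+ l)) m (suc (suc n)) (suc n) (falling n l) ((n ℕ.∸ l) !) ⟩
      suc (suc n) ℕ.* (suc n ℕ.* (falling n l ℕ.* m ℕ.^ (n ℕ.∸ l))) ℕ.* ((n ℕ.∸ l) ! ℕ.* m ℕ.^ (3 ℕ.+ l))
        ≡⟨ cong (λ e → g i ℕ.* ((m ℕ.∸ e) ! ℕ.* m ℕ.^ e)) (double i) ⟩
      g i ℕ.* ((m ℕ.∸ 2 ℕ.* (2 ℕ.+ i)) ! ℕ.* m ℕ.^ (2 ℕ.* (2 ℕ.+ i))) ∎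
      where
      l = 1 ℕ.+ 2 ℕ.* i
      double : ∀ i → 3 ℕ.+ (1 ℕ.+ 2 ℕ.* i) ≡ 2 ℕ.* (2 ℕ.+ i)
      double = solve-∀
      l≤n : l ℕ.≤ n
      l≤n = ℕ.≤-pred (ℕ.≤-trans (subst (ℕ._≤ 2 ℕ.* h) (ℕ.*-suc 2 i) (ℕ.*-monoʳ-≤ 2 i<h)) (2*⌊n/2⌋≤n (suc n)))
      exponent : 2 ℕ.+ n ≡ (n ℕ.∸ l) ℕ.+ (2 ℕ.+ l)
      exponent = trans (cong (2 ℕ.+_) (sym (ℕ.m∸n+n≡m l≤n))) (swap (n ℕ.∸ l) l)
        where
        swap : ∀ a l → 2 ℕ.+ (a ℕ.+ l) ≡ a ℕ.+ (2 ℕ.+ l)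
        swap = solve-∀
      regroup : ∀ p r m a b f x → p ℕ.* r ℕ.* (m ℕ.* (a ℕ.* (b ℕ.* (f ℕ.* x)))) ≡ a ℕ.* (b ℕ.* (f ℕ.* p)) ℕ.* (x ℕ.* (m ℕ.* r))
      regroup = solve-∀

-- Finite sums and products of rationals

module RationalLemmas where

  open ExactFormula
  open import Defs using (fromℕℚ; ∏; module ℚ-Lemmas)
  open ℚ-Lemmas using (/-≤; *-mono; 0≤*; ≤+; 0≤/)

  import Data.Integer.Base as ℤ
  open import Data.Nat.Base as ℕ using (ℕ; zero; suc; z≤n; s≤s)
  import Data.Nat.Properties as ℕ
  open import Data.Rational.Base using (ℚ; 0ℚ; 1ℚ; _+_; _*_; _-_; -_; _/_; _≤_; _<_; positive; nonNegative)
  import Data.Rational.Properties as ℚ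
  open import Data.Rational.Solver using (module +-*-Solver)
  open +-*-Solver using (solve; _:=_; _:+_; _:*_; _:-_; :-_; con)
  open import Function.Base using (_∘_)
  open import Relation.Binary.PropositionalEquality

  0≤1 : 0ℚ ≤ 1ℚ
  0≤1 = ℚ.nonNegative⁻¹ 1ℚ

  fromℕℚ-mono : ∀ {m n} → m ℕ.≤ n → fromℕℚ m ≤ fromℕℚ n
  fromℕℚ-mono {m} {n} m≤n = /-≤ {m} {0} {n} {0} (ℕ.*-monoˡ-≤ 1 m≤n)

  0≤fromℕℚ : ∀ n → 0ℚ ≤ fromℕℚ n
  0≤fromℕℚ n = 0≤/ n 0

  0<fromℕℚ : ∀ n → 0ℚ < fromℕℚ (suc n)
  0<fromℕℚ n = ℚ.<-≤-trans (ℚ.positive⁻¹ 1ℚ) (fromℕℚ-mono {1} {suc n} (s≤s z≤n))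

  fromℕℚ-suc : ∀ n → fromℕℚ (suc n) ≡ fromℕℚ n + 1ℚ
  fromℕℚ-suc n = ℚ-Lemmas./-suc n 0

  fromℕℚ-2* : ∀ n → fromℕℚ (2 ℕ.* n) ≡ fromℕℚ n + fromℕℚ n
  fromℕℚ-2* n = trans (cong fromℕℚ (cong (n ℕ.+_) (ℕ.+-identityʳ n))) (fromℕℚ-+ n n)

  fromℕℚ-∸ : ∀ {m n} → m ℕ.≤ n → fromℕℚ (n ℕ.∸ m) ≡ fromℕℚ n - fromℕℚ m
  fromℕℚ-∸ {m} {n} m≤n = begin
    fromℕℚ (n ℕ.∸ m)                               ≡⟨ solve 2 (λ x y → x := x :+ y :- y) refl (fromℕℚ (n ℕ.∸ m)) (fromℕℚ m) ⟩
    fromℕℚ (n ℕ.∸ m) + fromℕℚ m - fromℕℚ m         ≡⟨ cong (_- fromℕℚ m) (fromℕℚ-+ (n ℕ.∸ m) m) ⟨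
    fromℕℚ (n ℕ.∸ m ℕ.+ m) - fromℕℚ m              ≡⟨ cong (λ k → fromℕℚ k - fromℕℚ m) (ℕ.m∸n+n≡m m≤n) ⟩
    fromℕℚ n - fromℕℚ m                            ∎
    where open ≡-Reasoning

  /-*-cancel : ∀ a b → (ℤ.+ a / suc b) * fromℕℚ (suc b) ≡ fromℕℚ a
  /-*-cancel a b = trans (ℚ.*-comm (ℤ.+ a / suc b) (fromℕℚ (suc b))) (fromℕℚ-*-/ (suc b) a a (suc b) (ℕ.*-comm (suc b) a))

  *-cancelʳ-≤ : ∀ {p q} r → 0ℚ < r → p * r ≤ q * r → p ≤ q
  *-cancelʳ-≤ r 0<r = ℚ.*-cancelʳ-≤-pos r {{positive 0<r}}

  *-cancelʳ-≡ : ∀ {p q} r → 0ℚ < r → p * r ≡ q * r → p ≡ q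
  *-cancelʳ-≡ r 0<r eq = ℚ.≤-antisym (*-cancelʳ-≤ r 0<r (ℚ.≤-reflexive eq)) (*-cancelʳ-≤ r 0<r (ℚ.≤-reflexive (sym eq)))

  *-monoˡ : ∀ {p q} r → 0ℚ ≤ r → p ≤ q → r * p ≤ r * q
  *-monoˡ r 0≤r = ℚ.*-monoˡ-≤-nonNeg r {{nonNegative 0≤r}}

  *-monoʳ : ∀ {p q} r → 0ℚ ≤ r → p ≤ q → p * r ≤ q * r
  *-monoʳ r 0≤r = ℚ.*-monoʳ-≤-nonNeg r {{nonNegative 0≤r}}

  square-cancel-≤ : ∀ {p q} → 0ℚ ≤ q → p * p ≤ q * q → p ≤ q
  square-cancel-≤ {p} {q} 0≤q pp≤qq = ℚ.≮⇒≥ λ q<p → ℚ.<-irrefl refl (begin-strict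
    q * q ≤⟨ *-monoˡ q 0≤q (ℚ.<⇒≤ q<p) ⟩
    q * p <⟨ ℚ.*-monoˡ-<-pos p {{positive (ℚ.≤-<-trans 0≤q q<p)}} q<p ⟩
    p * p ≤⟨ pp≤qq ⟩
    q * q ∎)
    where open ℚ.≤-Reasoning

  ∑<-last : ∀ n f → ∑< (suc n) f ≡ ∑< n f + f n
  ∑<-last zero    f = ℚ.+-comm (f 0) 0ℚ
  ∑<-last (suc n) f = trans (cong (f 0 +_) (∑<-last n (f ∘ suc))) (sym (ℚ.+-assoc (f 0) _ _))

  ∑<-mono : ∀ n {f g} → (∀ i → i ℕ.< n → f i ≤ g i) → ∑< n f ≤ ∑< n g
  ∑<-mono zero    h = ℚ.≤-refl
  ∑<-mono (suc n) h = ℚ.+-mono-≤ (h 0 (s≤s z≤n)) (∑<-mono n λ i i<n → h (suc i) (s≤s i<n))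

  ∑<-split : ∀ m n f → ∑< (m ℕ.+ n) f ≡ ∑< m f + ∑< n (λ i → f (m ℕ.+ i))
  ∑<-split zero    n f = sym (ℚ.+-identityˡ _)
  ∑<-split (suc m) n f = trans (cong (f 0 +_) (∑<-split m n (f ∘ suc))) (sym (ℚ.+-assoc (f 0) _ _))

  ∑<-nonNeg : ∀ n {f} → (∀ i → 0ℚ ≤ f i) → 0ℚ ≤ ∑< n f
  ∑<-nonNeg zero    h = ℚ.≤-refl
  ∑<-nonNeg (suc n) h = ℚ.+-mono-≤ (h 0) (∑<-nonNeg n (h ∘ suc))

  ∑<-mono-bound : ∀ {m n f} → (∀ i → 0ℚ ≤ f i) → m ℕ.≤ n → ∑< m f ≤ ∑< n f
  ∑<-mono-bound {m} {n} {f} h m≤n = subst₂ _≤_ refl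
    (trans (sym (∑<-split m (n ℕ.∸ m) f)) (cong (λ k → ∑< k f) (ℕ.m+[n∸m]≡n m≤n)))
    (≤+ (∑< m f) _ (∑<-nonNeg (n ℕ.∸ m) λ i → h (m ℕ.+ i)))

  ∑<-pairs : ∀ n f → ∑< n (λ i → f (2 ℕ.* i) + f (1 ℕ.+ 2 ℕ.* i)) ≡ ∑< (2 ℕ.* n) f
  ∑<-pairs zero    f = refl
  ∑<-pairs (suc n) f = trans (cong (f 0 + f 1 +_) (trans
      (∑<-cong n λ i → cong₂ (λ a b → f a + f b) (ℕ.*-suc 2 i) (cong suc (ℕ.*-suc 2 i)))
      (∑<-pairs n (λ i → f (2 ℕ.+ i)))))
    (trans (ℚ.+-assoc (f 0) (f 1) _) (cong (λ k → ∑< k f) (sym (ℕ.*-suc 2 n))))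
    where
    ∑<-cong : ∀ n {f g} → (∀ i → f i ≡ g i) → ∑< n f ≡ ∑< n g
    ∑<-cong zero    h = refl
    ∑<-cong (suc n) h = cong₂ _+_ (h 0) (∑<-cong n (h ∘ suc))

  ∏-nonNeg : ∀ {f} → (∀ i → 0ℚ ≤ f i) → ∀ n → 0ℚ ≤ ∏ f n
  ∏-nonNeg     h zero    = 0≤1
  ∏-nonNeg {f} h (suc n) = 0≤* (∏ f n) (f n) (∏-nonNeg h n) (h n)

  ∏-mono : ∀ {f g} → (∀ i → 0ℚ ≤ f i) → ∀ n → (∀ i → i ℕ.< n → f i ≤ g i) → ∏ f n ≤ ∏ g n
  ∏-mono 0≤f zero    h = ℚ.≤-refl
  ∏-mono 0≤f (suc n) h = *-mono (∏-nonNeg 0≤f n) (∏-mono 0≤f n λ i i<n → h i (ℕ.m<n⇒m<1+n i<n)) (0≤f n) (h n ℕ.≤-refl)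

  ∏-anti : ∀ {f} → (∀ i → 0ℚ ≤ f i) → (∀ i → f i ≤ 1ℚ) → ∀ n → ∏ f (suc n) ≤ ∏ f n
  ∏-anti {f} 0≤f f≤1 n = subst (∏ f n * f n ≤_) (ℚ.*-identityʳ (∏ f n)) (*-monoˡ (∏ f n) (∏-nonNeg 0≤f n) (f≤1 n))

  ∏≤1 : ∀ {f} → (∀ i → 0ℚ ≤ f i) → (∀ i → f i ≤ 1ℚ) → ∀ n → ∏ f n ≤ 1ℚ
  ∏≤1 0≤f f≤1 zero    = ℚ.≤-refl
  ∏≤1 0≤f f≤1 (suc n) = ℚ.≤-trans (∏-anti 0≤f f≤1 n) (∏≤1 0≤f f≤1 n)

  p≤q⇒0≤q-p : ∀ {p q} → p ≤ q → 0ℚ ≤ q - p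
  p≤q⇒0≤q-p {p} {q} p≤q = subst (_≤ q - p) (ℚ.+-inverseʳ p) (ℚ.+-monoˡ-≤ (- p) p≤q)

-- Sums of binomial ratios and Wallis products

module WallisSums where

  open ExactFormula
  open RationalLemmas
  open import Defs using (fromℕℚ; ∏; wallisFactor; module ℚ-Lemmas)
  open ℚ-Lemmas using (*-pos)

  import Data.Integer.Base as ℤ
  open import Data.Nat.Base as ℕ using (ℕ; zero; suc)
  import Data.Nat.Properties as ℕ
  open import Data.Nat.Tactic.RingSolver using (solve-∀)
  open import Data.Rational.Base using (ℚ; 0ℚ; 1ℚ; _+_; _*_; _-_; -_; _/_; _≤_; _<_)
  import Data.Rational.Properties as ℚ
  open import Data.Rational.Solver using (module +-*-Solver)
  open +-*-Solver using (solve; _:=_; _:+_; _:*_; _:-_; :-_; con)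
  open import Function.Base using (_∘_)
  open import Relation.Binary.PropositionalEquality

  -- The factors (N - i) / (N + i) for N = n + 1; they vanish from i = N on.
  centralFactor : ℕ → ℕ → ℚ
  centralFactor n i = ℤ.+ (suc n ℕ.∸ i) / suc (n ℕ.+ i)

  -- For N = n + 1 and m ≤ N this is the binomial coefficient (2N - 1 choose N - m) divided by (2N -
  -- 1 choose N). The sum over m from 1 to N is thus 2 ^ (2N - 1) divided by the central coefficient
  -- (2N choose N).
  central : ℕ → ℕ → ℚ
  central n = ∏ (centralFactor n)

  centralSum : ℕ → ℚ
  centralSum n = ∑< (suc n) (λ m → central n (suc m))

  central-suc : ∀ n m → central n (suc m) * fromℕℚ (suc n ℕ.+ m) ≡ central n m * fromℕℚ (suc n ℕ.∸ m)
  central-suc n m = trans (ℚ.*-assoc (central n m) _ _) (cong (central n m *_) (/-*-cancel (suc n ℕ.∸ m) (n ℕ.+ m)))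

  module _ (n : ℕ) where

    private
      k = fromℕℚ (suc n)
      v v′ : ℕ → ℚ
      v  = central n
      v′ = central (suc n)
      k+ : ∀ m → fromℕℚ (suc n ℕ.+ m) ≡ k + fromℕℚ m
      k+ = fromℕℚ-+ (suc n)
      0<k+ : ∀ m → 0ℚ < k + fromℕℚ m
      0<k+ m = subst (0ℚ <_) (k+ m) (0<fromℕℚ (n ℕ.+ m))
      1+k+ : ∀ m → fromℕℚ (suc (suc n ℕ.+ m)) ≡ k + fromℕℚ m + 1ℚ
      1+k+ m = trans (fromℕℚ-suc (suc n ℕ.+ m)) (cong (_+ 1ℚ) (k+ m))

    -- In the binomial form both products have the factor (N - m)! in the denominator; the other
    -- factorials differ by the displayed linear terms.
    central-shift : ∀ m → v′ (suc m) * ((k + fromℕℚ m) * (k + fromℕℚ m + 1ℚ)) ≡ v m * (k * (k + 1ℚ))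
    central-shift zero = trans
      (solve 3 (λ a k z → a :* ((k :+ con 0ℚ) :* (k :+ con 0ℚ :+ con 1ℚ)) := k :* (a :* (k :+ con 1ℚ)))
        refl (v′ 1) k 0ℚ)
      (trans (cong (λ z → k * (v′ 1 * z)) (sym (fromℕℚ-suc (suc n))))
      (trans (cong (λ z → k * z) (trans (cong (λ z → v′ 1 * fromℕℚ z) (cong (suc ∘ suc) (sym (ℕ.+-identityʳ n)))) (central-suc (suc n) 0)))
      (trans (cong (λ z → k * (1ℚ * z)) (fromℕℚ-suc (suc n)))
      (solve 1 (λ k → k :* (con 1ℚ :* (k :+ con 1ℚ)) := con 1ℚ :* (k :* (k :+ con 1ℚ))) refl k))))
    central-shift (suc m) = *-cancelʳ-≡ (k + μ) (0<k+ m) (begin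
      v′ (2 ℕ.+ m) * ((k + fromℕℚ (suc m)) * (k + fromℕℚ (suc m) + 1ℚ)) * (k + μ)
        ≡⟨ cong (λ μ′ → v′ (2 ℕ.+ m) * ((k + μ′) * (k + μ′ + 1ℚ)) * (k + μ)) (fromℕℚ-suc m) ⟩
      v′ (2 ℕ.+ m) * ((k + (μ + 1ℚ)) * (k + (μ + 1ℚ) + 1ℚ)) * (k + μ)
        ≡⟨ solve 3 (λ a k μ → a :* ((k :+ (μ :+ con 1ℚ)) :* (k :+ (μ :+ con 1ℚ) :+ con 1ℚ)) :* (k :+ μ)
             := (a :* (k :+ μ :+ con 1ℚ :+ con 1ℚ)) :* ((k :+ μ) :* (k :+ μ :+ con 1ℚ))) refl (v′ (2 ℕ.+ m)) k μ ⟩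
      v′ (2 ℕ.+ m) * (k + μ + 1ℚ + 1ℚ) * ((k + μ) * (k + μ + 1ℚ))
        ≡⟨ cong (_* ((k + μ) * (k + μ + 1ℚ))) step ⟩
      v′ (suc m) * fromℕℚ (suc n ℕ.∸ m) * ((k + μ) * (k + μ + 1ℚ))
        ≡⟨ solve 3 (λ a d e → a :* d :* e := d :* (a :* e)) refl (v′ (suc m)) (fromℕℚ (suc n ℕ.∸ m)) ((k + μ) * (k + μ + 1ℚ)) ⟩
      fromℕℚ (suc n ℕ.∸ m) * (v′ (suc m) * ((k + μ) * (k + μ + 1ℚ)))
        ≡⟨ cong (fromℕℚ (suc n ℕ.∸ m) *_) (central-shift m) ⟩
      fromℕℚ (suc n ℕ.∸ m) * (v m * (k * (k + 1ℚ)))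
        ≡⟨ solve 3 (λ d a e → d :* (a :* e) := a :* d :* e) refl (fromℕℚ (suc n ℕ.∸ m)) (v m) (k * (k + 1ℚ)) ⟩
      v m * fromℕℚ (suc n ℕ.∸ m) * (k * (k + 1ℚ))
        ≡⟨ cong (_* (k * (k + 1ℚ))) (trans (sym (central-suc n m)) (cong (v (suc m) *_) (k+ m))) ⟩
      v (suc m) * (k + μ) * (k * (k + 1ℚ))
        ≡⟨ solve 3 (λ a d e → a :* d :* e := a :* e :* d) refl (v (suc m)) (k + μ) (k * (k + 1ℚ)) ⟩
      v (suc m) * (k * (k + 1ℚ)) * (k + μ) ∎)
      where
      open ≡-Reasoning
      μ = fromℕℚ m
      step : v′ (2 ℕ.+ m) * (k + μ + 1ℚ + 1ℚ) ≡ v′ (suc m) * fromℕℚ (suc n ℕ.∸ m)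
      step = trans (cong (v′ (2 ℕ.+ m) *_) (trans (cong (_+ 1ℚ) (sym (1+k+ m))) (trans (sym (fromℕℚ-suc (suc (suc n ℕ.+ m))))
        (cong fromℕℚ (cong (suc ∘ suc) (sym (ℕ.+-suc n m)))))))
        (central-suc (suc n) (suc m))

    private
      A C : ℕ → ℚ
      A m = ∑< m (v′ ∘ suc)
      C m = ∑< m (v ∘ suc)

    -- The telescoping relation between the sums for N = k and N + 1 given by Zeilberger's algorithm.
    central-telescope : ∀ m → m ℕ.≤ suc n →
      ((k + k + 1ℚ) * A m - (k + k + 1ℚ + 1ℚ) * C m) * (k + fromℕℚ m) ≡ - ((k + 1ℚ) * fromℕℚ m * v m)
    central-telescope zero _ = solve 1 (λ k → ((k :+ k :+ con 1ℚ) :* con 0ℚ :- (k :+ k :+ con 1ℚ :+ con 1ℚ) :* con 0ℚ) :* (k :+ con 0ℚ)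
      := :- ((k :+ con 1ℚ) :* con 0ℚ :* con 1ℚ)) refl k
    central-telescope (suc m) m<n = *-cancelʳ-≡ (k + μ) (0<k+ m) (begin
      ((k + k + 1ℚ) * A (suc m) - (k + k + 1ℚ + 1ℚ) * C (suc m)) * (k + fromℕℚ (suc m)) * (k + μ)
        ≡⟨ cong (λ μ′ → ((k + k + 1ℚ) * A (suc m) - (k + k + 1ℚ + 1ℚ) * C (suc m)) * (k + μ′) * (k + μ)) (fromℕℚ-suc m) ⟩
      ((k + k + 1ℚ) * A (suc m) - (k + k + 1ℚ + 1ℚ) * C (suc m)) * (k + (μ + 1ℚ)) * (k + μ)
        ≡⟨ cong₂ (λ x y → ((k + k + 1ℚ) * x - (k + k + 1ℚ + 1ℚ) * y) * (k + (μ + 1ℚ)) * (k + μ))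
             (∑<-last m (v′ ∘ suc)) (∑<-last m (v ∘ suc)) ⟩
      ((k + k + 1ℚ) * (A m + a) - (k + k + 1ℚ + 1ℚ) * (C m + b)) * (k + (μ + 1ℚ)) * (k + μ)
        ≡⟨ solve 6 (λ k μ A C a b →
             ((k :+ k :+ con 1ℚ) :* (A :+ a) :- (k :+ k :+ con 1ℚ :+ con 1ℚ) :* (C :+ b)) :* (k :+ (μ :+ con 1ℚ)) :* (k :+ μ)
             := ((k :+ k :+ con 1ℚ) :* A :- (k :+ k :+ con 1ℚ :+ con 1ℚ) :* C) :* (k :+ μ) :* (k :+ μ :+ con 1ℚ)
                :+ (k :+ k :+ con 1ℚ) :* (a :* ((k :+ μ) :* (k :+ μ :+ con 1ℚ)))
                :- (k :+ k :+ con 1ℚ :+ con 1ℚ) :* (k :+ μ :+ con 1ℚ) :* (b :* (k :+ μ)))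
             refl k μ (A m) (C m) a b ⟩
      ((k + k + 1ℚ) * A m - (k + k + 1ℚ + 1ℚ) * C m) * (k + μ) * (k + μ + 1ℚ)
        + (k + k + 1ℚ) * (a * ((k + μ) * (k + μ + 1ℚ))) - (k + k + 1ℚ + 1ℚ) * (k + μ + 1ℚ) * (b * (k + μ))
        ≡⟨ cong₂ (λ x y → x * (k + μ + 1ℚ) + (k + k + 1ℚ) * y - (k + k + 1ℚ + 1ℚ) * (k + μ + 1ℚ) * (b * (k + μ)))
             (central-telescope m (ℕ.≤-trans (ℕ.n≤1+n m) m<n)) (central-shift m) ⟩
      - ((k + 1ℚ) * μ * v m) * (k + μ + 1ℚ)
        + (k + k + 1ℚ) * (v m * (k * (k + 1ℚ))) - (k + k + 1ℚ + 1ℚ) * (k + μ + 1ℚ) * (b * (k + μ))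
        ≡⟨ cong (λ z → - ((k + 1ℚ) * μ * v m) * (k + μ + 1ℚ) + (k + k + 1ℚ) * (v m * (k * (k + 1ℚ))) - (k + k + 1ℚ + 1ℚ) * (k + μ + 1ℚ) * z) ratio ⟩
      - ((k + 1ℚ) * μ * v m) * (k + μ + 1ℚ)
        + (k + k + 1ℚ) * (v m * (k * (k + 1ℚ))) - (k + k + 1ℚ + 1ℚ) * (k + μ + 1ℚ) * (v m * (k - μ))
        ≡⟨ solve 3 (λ k μ v →
             :- ((k :+ con 1ℚ) :* μ :* v) :* (k :+ μ :+ con 1ℚ)
               :+ (k :+ k :+ con 1ℚ) :* (v :* (k :* (k :+ con 1ℚ))) :- (k :+ k :+ con 1ℚ :+ con 1ℚ) :* (k :+ μ :+ con 1ℚ) :* (v :* (k :- μ))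
             := :- ((k :+ con 1ℚ) :* (μ :+ con 1ℚ) :* (v :* (k :- μ)))) refl k μ (v m) ⟩
      - ((k + 1ℚ) * (μ + 1ℚ) * (v m * (k - μ)))
        ≡⟨ cong₂ (λ μ′ z → - ((k + 1ℚ) * μ′ * z)) (fromℕℚ-suc m) ratio ⟨
      - ((k + 1ℚ) * fromℕℚ (suc m) * (b * (k + μ)))
        ≡⟨ solve 4 (λ k μ b e → :- ((k :+ con 1ℚ) :* μ :* (b :* e)) := :- ((k :+ con 1ℚ) :* μ :* b) :* e) refl k (fromℕℚ (suc m)) b (k + μ) ⟩
      - ((k + 1ℚ) * fromℕℚ (suc m) * b) * (k + μ) ∎)
      where
      open ≡-Reasoning
      μ = fromℕℚ m
      a = v′ (suc m)
      b = v (suc m)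
      ratio : b * (k + μ) ≡ v m * (k - μ)
      ratio = trans (cong (b *_) (sym (k+ m))) (trans (central-suc n m) (cong (v m *_) (fromℕℚ-∸ (ℕ.≤-trans (ℕ.n≤1+n m) m<n))))

    -- At m = N the boundary term of the telescoping cancels against the one extra term that the sum
    -- for N + 1 has.
    centralSum-suc : (k + k + 1ℚ) * centralSum (suc n) ≡ (k + k + 1ℚ + 1ℚ) * centralSum n
    centralSum-suc = *-cancelʳ-≡ (k + k) (0<k+ (suc n)) (begin
      (k + k + 1ℚ) * ∑< (suc (suc n)) (v′ ∘ suc) * (k + k)
        ≡⟨ cong (λ z → (k + k + 1ℚ) * z * (k + k)) (∑<-last (suc n) (v′ ∘ suc)) ⟩
      (k + k + 1ℚ) * (A (suc n) + a) * (k + k)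
        ≡⟨ solve 4 (λ k A C a → (k :+ k :+ con 1ℚ) :* (A :+ a) :* (k :+ k)
             := ((k :+ k :+ con 1ℚ) :* A :- (k :+ k :+ con 1ℚ :+ con 1ℚ) :* C) :* (k :+ k) :+ a :* ((k :+ k) :* (k :+ k :+ con 1ℚ))
                :+ (k :+ k :+ con 1ℚ :+ con 1ℚ) :* C :* (k :+ k)) refl k (A (suc n)) (C (suc n)) a ⟩
      ((k + k + 1ℚ) * A (suc n) - (k + k + 1ℚ + 1ℚ) * C (suc n)) * (k + k) + a * ((k + k) * (k + k + 1ℚ))
        + (k + k + 1ℚ + 1ℚ) * C (suc n) * (k + k)
        ≡⟨ cong₂ (λ x y → x + y + (k + k + 1ℚ + 1ℚ) * C (suc n) * (k + k)) (central-telescope (suc n) ℕ.≤-refl) (central-shift (suc n)) ⟩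
      - ((k + 1ℚ) * k * v (suc n)) + v (suc n) * (k * (k + 1ℚ)) + (k + k + 1ℚ + 1ℚ) * C (suc n) * (k + k)
        ≡⟨ solve 3 (λ k v z → :- ((k :+ con 1ℚ) :* k :* v) :+ v :* (k :* (k :+ con 1ℚ)) :+ z := z)
             refl k (v (suc n)) ((k + k + 1ℚ + 1ℚ) * C (suc n) * (k + k)) ⟩
      (k + k + 1ℚ + 1ℚ) * centralSum n * (k + k) ∎)
      where
      open ≡-Reasoning
      a = v′ (suc (suc n))

  wallisFactor-cancel : ∀ n → let k = fromℕℚ n in
    wallisFactor n * ((k + k + 1ℚ) * (k + k + 1ℚ + 1ℚ + 1ℚ)) ≡ (k + k + 1ℚ + 1ℚ) * (k + k + 1ℚ + 1ℚ)
  wallisFactor-cancel n = begin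
    wallisFactor n * ((k + k + 1ℚ) * (k + k + 1ℚ + 1ℚ + 1ℚ))
      ≡⟨ cong (λ z → wallisFactor n * z) (trans (cong₂ _*_ (sym odd₁) (sym odd₃)) (sym (fromℕℚ-* (1 ℕ.+ 2 ℕ.* n) (3 ℕ.+ 2 ℕ.* n)))) ⟩
    wallisFactor n * fromℕℚ ((1 ℕ.+ 2 ℕ.* n) ℕ.* (3 ℕ.+ 2 ℕ.* n))
      ≡⟨ /-*-cancel (4 ℕ.* (suc n ℕ.* suc n)) _ ⟩
    fromℕℚ (4 ℕ.* (suc n ℕ.* suc n))
      ≡⟨ cong fromℕℚ (quadruple n) ⟩
    fromℕℚ ((2 ℕ.+ 2 ℕ.* n) ℕ.* (2 ℕ.+ 2 ℕ.* n))
      ≡⟨ trans (fromℕℚ-* (2 ℕ.+ 2 ℕ.* n) (2 ℕ.+ 2 ℕ.* n)) (cong₂ _*_ even even) ⟩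
    (k + k + 1ℚ + 1ℚ) * (k + k + 1ℚ + 1ℚ) ∎
    where
    open ≡-Reasoning
    k = fromℕℚ n
    odd₁ : fromℕℚ (1 ℕ.+ 2 ℕ.* n) ≡ k + k + 1ℚ
    odd₁ = trans (fromℕℚ-suc (2 ℕ.* n)) (cong (_+ 1ℚ) (fromℕℚ-2* n))
    even : fromℕℚ (2 ℕ.+ 2 ℕ.* n) ≡ k + k + 1ℚ + 1ℚ
    even = trans (fromℕℚ-suc (1 ℕ.+ 2 ℕ.* n)) (cong (_+ 1ℚ) odd₁)
    odd₃ : fromℕℚ (3 ℕ.+ 2 ℕ.* n) ≡ k + k + 1ℚ + 1ℚ + 1ℚ
    odd₃ = trans (fromℕℚ-suc (2 ℕ.+ 2 ℕ.* n)) (cong (_+ 1ℚ) even)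
    quadruple : ∀ n → 4 ℕ.* (suc n ℕ.* suc n) ≡ (2 ℕ.+ 2 ℕ.* n) ℕ.* (2 ℕ.+ 2 ℕ.* n)
    quadruple = solve-∀

  0<2k+1 : ∀ n → let k = fromℕℚ n in 0ℚ < k + k + 1ℚ
  0<2k+1 n = subst (0ℚ <_) (trans (fromℕℚ-suc (2 ℕ.* n)) (cong (_+ 1ℚ) (fromℕℚ-2* n))) (0<fromℕℚ (2 ℕ.* n))

  -- Passing from k to k + 1 multiplies the square of the sum by ((2k + 2) / (2k + 1))², which is
  -- (2k + 3) / (2k + 1) times the next Wallis factor.
  centralSum² : ∀ n → let k = fromℕℚ (suc n) in
    fromℕℚ 4 * (centralSum n * centralSum n) ≡ (k + k + 1ℚ) * ∏ wallisFactor (suc n)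
  centralSum² zero    = refl
  centralSum² (suc n) = *-cancelʳ-≡ ((k + k + 1ℚ) * (k + k + 1ℚ)) (*-pos (0<2k+1 (suc n)) (0<2k+1 (suc n))) (begin
    fromℕℚ 4 * (V′ * V′) * ((k + k + 1ℚ) * (k + k + 1ℚ))
      ≡⟨ solve 3 (λ f V k → f :* (V :* V) :* ((k :+ k :+ con 1ℚ) :* (k :+ k :+ con 1ℚ))
           := f :* (((k :+ k :+ con 1ℚ) :* V) :* ((k :+ k :+ con 1ℚ) :* V))) refl (fromℕℚ 4) V′ k ⟩
    fromℕℚ 4 * (((k + k + 1ℚ) * V′) * ((k + k + 1ℚ) * V′))
      ≡⟨ cong (λ z → fromℕℚ 4 * (z * z)) (centralSum-suc n) ⟩
    fromℕℚ 4 * (((k + k + 1ℚ + 1ℚ) * V) * ((k + k + 1ℚ + 1ℚ) * V))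
      ≡⟨ solve 3 (λ f V e → f :* ((e :* V) :* (e :* V)) := f :* (V :* V) :* (e :* e)) refl (fromℕℚ 4) V (k + k + 1ℚ + 1ℚ) ⟩
    fromℕℚ 4 * (V * V) * ((k + k + 1ℚ + 1ℚ) * (k + k + 1ℚ + 1ℚ))
      ≡⟨ cong₂ _*_ (centralSum² n) (sym (wallisFactor-cancel (suc n))) ⟩
    (k + k + 1ℚ) * W * (f * ((k + k + 1ℚ) * (k + k + 1ℚ + 1ℚ + 1ℚ)))
      ≡⟨ solve 3 (λ k W f → (k :+ k :+ con 1ℚ) :* W :* (f :* ((k :+ k :+ con 1ℚ) :* (k :+ k :+ con 1ℚ :+ con 1ℚ :+ con 1ℚ)))
           := ((k :+ con 1ℚ) :+ (k :+ con 1ℚ) :+ con 1ℚ) :* (W :* f) :* ((k :+ k :+ con 1ℚ) :* (k :+ k :+ con 1ℚ))) refl k W f ⟩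
    (k + 1ℚ + (k + 1ℚ) + 1ℚ) * (W * f) * ((k + k + 1ℚ) * (k + k + 1ℚ))
      ≡⟨ cong (λ k′ → (k′ + k′ + 1ℚ) * (W * f) * ((k + k + 1ℚ) * (k + k + 1ℚ))) (fromℕℚ-suc (suc n)) ⟨
    (fromℕℚ (2 ℕ.+ n) + fromℕℚ (2 ℕ.+ n) + 1ℚ) * (W * f) * ((k + k + 1ℚ) * (k + k + 1ℚ)) ∎)
    where
    open ≡-Reasoning
    k = fromℕℚ (suc n)
    V = centralSum n
    V′ = centralSum (suc n)
    W = ∏ wallisFactor (suc n)
    f = wallisFactor (suc n)

-- Bounds for the sum in the exact formula

module HalfSums where

  open Counting using (falling; falling-!)
  open ExactFormula
  open RationalLemmas
  open WallisSums
  open import Defs using (fromℕℚ; ∏; term; N-bi; ∑[_⋯_]; module ℚ-Lemmas)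
  open ℚ-Lemmas using (/-≤; 0≤*; 0≤/)

  open import Data.Integer.Base as ℤ using (1ℤ)
  open import Data.Nat.Base as ℕ using (ℕ; zero; suc; z≤n; s≤s; ⌊_/2⌋)
  import Data.Nat.Properties as ℕ
  open import Data.Nat.Tactic.RingSolver using (solve-∀)
  open import Data.Rational.Base using (ℚ; 0ℚ; 1ℚ; _+_; _*_; _-_; -_; _/_; _≤_; _<_)
  import Data.Rational.Properties as ℚ
  open import Data.Rational.Solver using (module +-*-Solver)
  open +-*-Solver using (solve; _:=_; _:+_; _:*_; _:-_; :-_; con)
  open import Data.Sum.Base using (_⊎_; inj₁; inj₂)
  open import Function.Base using (_∘_)
  open import Relation.Binary.PropositionalEquality

  fallFactor : ℕ → ℕ → ℚ
  fallFactor n i = ℤ.+ (suc n ℕ.∸ i) / suc n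

  fall : ℕ → ℕ → ℚ
  fall n = ∏ (fallFactor n)

  falling-last : ∀ n l → falling n (suc l) ≡ falling n l ℕ.* (n ℕ.∸ l)
  falling-last zero    zero    = refl
  falling-last zero    (suc l) = refl
  falling-last (suc n) zero    = ℕ.*-comm (suc n) 1
  falling-last (suc n) (suc l) = trans (cong (suc n ℕ.*_) (falling-last n l)) (sym (ℕ.*-assoc (suc n) (falling n l) (n ℕ.∸ l)))

  fall-falling : ∀ n m → fall n m * fromℕℚ (suc n ℕ.^ m) ≡ fromℕℚ (falling (suc n) m)
  fall-falling n zero    = refl
  fall-falling n (suc m) = begin
    fall n m * fallFactor n m * fromℕℚ (suc n ℕ.* suc n ℕ.^ m)
      ≡⟨ cong (fall n m * fallFactor n m *_) (fromℕℚ-* (suc n) (suc n ℕ.^ m)) ⟩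
    fall n m * fallFactor n m * (fromℕℚ (suc n) * fromℕℚ (suc n ℕ.^ m))
      ≡⟨ solve 4 (λ a b c d → a :* b :* (c :* d) := a :* d :* (b :* c)) refl (fall n m) (fallFactor n m) (fromℕℚ (suc n)) (fromℕℚ (suc n ℕ.^ m)) ⟩
    fall n m * fromℕℚ (suc n ℕ.^ m) * (fallFactor n m * fromℕℚ (suc n))
      ≡⟨ cong₂ _*_ (fall-falling n m) (/-*-cancel (suc n ℕ.∸ m) n) ⟩
    fromℕℚ (falling (suc n) m) * fromℕℚ (suc n ℕ.∸ m)
      ≡⟨ fromℕℚ-* (falling (suc n) m) (suc n ℕ.∸ m) ⟨
    fromℕℚ (falling (suc n) m ℕ.* (suc n ℕ.∸ m))
      ≡⟨ cong fromℕℚ (falling-last (suc n) m) ⟨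
    fromℕℚ (falling (suc n) (suc m)) ∎
    where open ≡-Reasoning

  0<fromℕℚ^ : ∀ n m → 0ℚ < fromℕℚ (suc n ℕ.^ m)
  0<fromℕℚ^ n m = ℚ.<-≤-trans (0<fromℕℚ 0) (fromℕℚ-mono (ℕ.m^n>0 (suc n) m))

  -- Without the bound on k, truncated subtraction would give the factor 0 ! = 1 and a positive
  -- `term`, whereas `fall` vanishes beyond `suc n`.
  term-fall : ∀ n k → 2 ℕ.* k ℕ.≤ suc n → term (suc n) k ≡ fall n (2 ℕ.* k)
  term-fall n k 2k≤n = *-cancelʳ-≡ (fromℕℚ (suc n ℕ.^ (2 ℕ.* k))) (0<fromℕℚ^ n (2 ℕ.* k)) (trans
    (ℚ.*-comm (term (suc n) k) _)
    (trans (fromℕℚ-term (suc n ℕ.^ (2 ℕ.* k)) (falling (suc n) (2 ℕ.* k)) (suc n) k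
      (trans (cong (suc n ℕ.^ (2 ℕ.* k) ℕ.*_) (sym (falling-! (suc n) (2 ℕ.* k) 2k≤n)))
             (regroup (suc n ℕ.^ (2 ℕ.* k)) (falling (suc n) (2 ℕ.* k)) _)))
    (sym (fall-falling n (2 ℕ.* k)))))
    where
    regroup : ∀ p f x → p ℕ.* (f ℕ.* x) ≡ f ℕ.* (x ℕ.* p)
    regroup = solve-∀

  0≤fallFactor : ∀ n i → 0ℚ ≤ fallFactor n i
  0≤fallFactor n i = 0≤/ (suc n ℕ.∸ i) n

  fallFactor≤1 : ∀ n i → fallFactor n i ≤ 1ℚ
  fallFactor≤1 n i = /-≤ {suc n ℕ.∸ i} {n} {1} {0}
    (subst₂ ℕ._≤_ (sym (ℕ.*-identityʳ _)) (sym (ℕ.*-identityˡ _)) (ℕ.m∸n≤m (suc n) i))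

  0≤centralFactor : ∀ n i → 0ℚ ≤ centralFactor n i
  0≤centralFactor n i = 0≤/ (suc n ℕ.∸ i) (n ℕ.+ i)

  centralFactor≤1 : ∀ n i → centralFactor n i ≤ 1ℚ
  centralFactor≤1 n i = /-≤ {suc n ℕ.∸ i} {n ℕ.+ i} {1} {0}
    (subst₂ ℕ._≤_ (sym (ℕ.*-identityʳ _)) (sym (ℕ.*-identityˡ _)) (ℕ.≤-trans (ℕ.m∸n≤m (suc n) i) (ℕ.m≤m+n (suc n) i)))

  fall-anti : ∀ n m → fall n (suc m) ≤ fall n m
  fall-anti n = ∏-anti (0≤fallFactor n) (fallFactor≤1 n)

  0≤fall : ∀ n m → 0ℚ ≤ fall n m
  0≤fall n = ∏-nonNeg (0≤fallFactor n)

  0≤central : ∀ n m → 0ℚ ≤ central n m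
  0≤central n = ∏-nonNeg (0≤centralFactor n)

  -- With n for `suc n` and N = 2n, the two sides of the cross-multiplied inequality differ by
  -- exactly i² when i ≤ n; otherwise the left side is zero.
  fallFactor≤centralFactor : ∀ n i → fallFactor n i ≤ centralFactor (n ℕ.+ suc n) i
  fallFactor≤centralFactor n i = /-≤ {suc n ℕ.∸ i} {n} {suc (n ℕ.+ suc n) ℕ.∸ i} {n ℕ.+ suc n ℕ.+ i} (cross (suc n) (ℕ.≤-total i (suc n)))
    where
    cross : ∀ n → i ℕ.≤ n ⊎ n ℕ.≤ i → (n ℕ.∸ i) ℕ.* (n ℕ.+ n ℕ.+ i) ℕ.≤ (n ℕ.+ n ℕ.∸ i) ℕ.* n
    cross n (inj₂ n≤i) = subst (ℕ._≤ (n ℕ.+ n ℕ.∸ i) ℕ.* n) (cong (ℕ._* (n ℕ.+ n ℕ.+ i)) (sym (ℕ.m≤n⇒m∸n≡0 n≤i))) z≤n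
    cross n (inj₁ i≤n) = subst (λ m → k ℕ.* (m ℕ.+ m ℕ.+ i) ℕ.≤ (m ℕ.+ m ℕ.∸ i) ℕ.* m) (ℕ.m+[n∸m]≡n i≤n)
      (subst (λ d → k ℕ.* (i ℕ.+ k ℕ.+ (i ℕ.+ k) ℕ.+ i) ℕ.≤ d ℕ.* (i ℕ.+ k))
        (sym (trans (cong (ℕ._∸ i) (ℕ.+-assoc i k (i ℕ.+ k))) (ℕ.m+n∸m≡n i (k ℕ.+ (i ℕ.+ k)))))
        (subst (k ℕ.* (i ℕ.+ k ℕ.+ (i ℕ.+ k) ℕ.+ i) ℕ.≤_) (difference i k) (ℕ.m≤m+n _ (i ℕ.* i))))
      where
      k = n ℕ.∸ i
      difference : ∀ i k → k ℕ.* (i ℕ.+ k ℕ.+ (i ℕ.+ k) ℕ.+ i) ℕ.+ i ℕ.* i ≡ (k ℕ.+ (i ℕ.+ k)) ℕ.* (i ℕ.+ k)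
      difference = solve-∀

  -- With n and N for the successors, the nontrivial case reduces to N - i ≤ 2 (n - i), that is N +
  -- i ≤ 2n, which is i ≤ c.
  centralFactor≤fallFactor : ∀ n N c i → suc N ℕ.+ c ≡ suc n ℕ.+ suc n → i ℕ.≤ c → centralFactor N i ≤ fallFactor n i
  centralFactor≤fallFactor n N c i eq i≤c = /-≤ {suc N ℕ.∸ i} {N ℕ.+ i} {suc n ℕ.∸ i} {n} (cross (ℕ.≤-total i (suc N)))
    where
    cross : i ℕ.≤ suc N ⊎ suc N ℕ.≤ i → (suc N ℕ.∸ i) ℕ.* suc n ℕ.≤ (suc n ℕ.∸ i) ℕ.* (suc N ℕ.+ i)
    cross (inj₂ N≤i) = subst (ℕ._≤ (suc n ℕ.∸ i) ℕ.* (suc N ℕ.+ i)) (cong (ℕ._* suc n) (sym (ℕ.m≤n⇒m∸n≡0 N≤i))) z≤n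
    cross (inj₁ i≤N) = begin
      l ℕ.* suc n                 ≡⟨ cong (l ℕ.*_) n≡ ⟨
      l ℕ.* (i ℕ.+ k)             ≡⟨ ℕ.*-distribˡ-+ l i k ⟩
      l ℕ.* i ℕ.+ l ℕ.* k         ≤⟨ ℕ.+-monoˡ-≤ (l ℕ.* k) (ℕ.*-monoˡ-≤ i l≤2k) ⟩
      (k ℕ.+ k) ℕ.* i ℕ.+ l ℕ.* k ≡⟨ regroup k i l ⟩
      k ℕ.* (i ℕ.+ l ℕ.+ i)       ≡⟨ cong (λ m → k ℕ.* (m ℕ.+ i)) (ℕ.m+[n∸m]≡n i≤N) ⟩
      k ℕ.* (suc N ℕ.+ i)         ∎
      where
      open ℕ.≤-Reasoning
      l = suc N ℕ.∸ i
      k = suc n ℕ.∸ i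
      2i+l≤2n : i ℕ.+ i ℕ.+ l ℕ.≤ suc n ℕ.+ suc n
      2i+l≤2n = begin
        i ℕ.+ i ℕ.+ l     ≡⟨ swap i l ⟩
        i ℕ.+ l ℕ.+ i     ≡⟨ cong (ℕ._+ i) (ℕ.m+[n∸m]≡n i≤N) ⟩
        suc N ℕ.+ i       ≤⟨ ℕ.+-monoʳ-≤ (suc N) i≤c ⟩
        suc N ℕ.+ c       ≡⟨ eq ⟩
        suc n ℕ.+ suc n   ∎
        where
        swap : ∀ i l → i ℕ.+ i ℕ.+ l ≡ i ℕ.+ l ℕ.+ i
        swap = solve-∀
      i≤n : i ℕ.≤ suc n
      i≤n = ℕ.≮⇒≥ λ n<i → ℕ.<-irrefl refl (ℕ.<-≤-trans (ℕ.+-mono-< n<i n<i) (ℕ.≤-trans (ℕ.m≤m+n (i ℕ.+ i) l) 2i+l≤2n))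
      n≡ : i ℕ.+ k ≡ suc n
      n≡ = ℕ.m+[n∸m]≡n i≤n
      l≤2k : l ℕ.≤ k ℕ.+ k
      l≤2k = ℕ.+-cancelˡ-≤ (i ℕ.+ i) l (k ℕ.+ k) (ℕ.≤-trans 2i+l≤2n (ℕ.≤-reflexive (trans (cong (λ m → m ℕ.+ m) (sym n≡)) (double i k))))
        where
        double : ∀ i k → i ℕ.+ k ℕ.+ (i ℕ.+ k) ≡ i ℕ.+ i ℕ.+ (k ℕ.+ k)
        double = solve-∀
      regroup : ∀ k i l → (k ℕ.+ k) ℕ.* i ℕ.+ l ℕ.* k ≡ k ℕ.* (i ℕ.+ l ℕ.+ i)
      regroup = solve-∀

  -- With N = n + 1, the difference v_m - v_(m+1) equals 2m / (N + m) times v_m, and N + m ≤ 2N.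
  central-drop : ∀ n c m → c ℕ.≤ m → m ℕ.≤ suc n →
    fromℕℚ c * central n m ≤ fromℕℚ (suc n) * (central n m - central n (suc m))
  central-drop n c m c≤m m≤n = *-cancelʳ-≤ (fromℕℚ (suc n ℕ.+ m)) (0<fromℕℚ (n ℕ.+ m)) (begin
    fromℕℚ c * v * fromℕℚ (suc n ℕ.+ m)
      ≡⟨ solve 3 (λ c v s → c :* v :* s := v :* (c :* s)) refl (fromℕℚ c) v (fromℕℚ (suc n ℕ.+ m)) ⟩
    v * (fromℕℚ c * fromℕℚ (suc n ℕ.+ m))
      ≡⟨ cong (v *_) (fromℕℚ-* c (suc n ℕ.+ m)) ⟨
    v * fromℕℚ (c ℕ.* (suc n ℕ.+ m))
      ≤⟨ *-monoˡ v (0≤central n m) (fromℕℚ-mono (ℕ.*-mono-≤ c≤m (ℕ.+-monoʳ-≤ (suc n) m≤n))) ⟩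
    v * fromℕℚ (m ℕ.* (suc n ℕ.+ suc n))
      ≡⟨ cong (v *_) (trans (fromℕℚ-* m (suc n ℕ.+ suc n)) (cong (μ *_) (fromℕℚ-+ (suc n) (suc n)))) ⟩
    v * (μ * (k + k))
      ≡⟨ solve 3 (λ v μ k → v :* (μ :* (k :+ k)) := k :* (v :* (k :+ μ)) :- k :* (v :* (k :- μ))) refl v μ k ⟩
    k * (v * (k + μ)) - k * (v * (k - μ))
      ≡⟨ cong₂ (λ x y → k * (v * x) - k * y) (sym (fromℕℚ-+ (suc n) m))
           (trans (cong (v *_) (sym (fromℕℚ-∸ m≤n))) (sym (central-suc n m))) ⟩
    k * (v * fromℕℚ (suc n ℕ.+ m)) - k * (central n (suc m) * fromℕℚ (suc n ℕ.+ m))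
      ≡⟨ solve 4 (λ k v w s → k :* (v :* s) :- k :* (w :* s) := k :* (v :- w) :* s) refl k v (central n (suc m)) (fromℕℚ (suc n ℕ.+ m)) ⟩
    k * (v - central n (suc m)) * fromℕℚ (suc n ℕ.+ m) ∎)
    where
    open ℚ.≤-Reasoning
    v = central n m
    k = fromℕℚ (suc n)
    μ = fromℕℚ m

  central-tail : ∀ n c r → c ℕ.+ r ℕ.≤ suc n →
    fromℕℚ c * ∑< r (λ i → central n (suc (c ℕ.+ i))) ≤ fromℕℚ (suc n) * (1ℚ - central n (c ℕ.+ r))
  central-tail n c zero    c≤n = begin
    fromℕℚ c * 0ℚ                                ≡⟨ ℚ.*-zeroʳ (fromℕℚ c) ⟩
    0ℚ                                           ≤⟨ 0≤* (fromℕℚ (suc n)) _ (0≤fromℕℚ (suc n)) (p≤q⇒0≤q-p (∏≤1 (0≤centralFactor n) (centralFactor≤1 n) (c ℕ.+ 0))) ⟩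
    fromℕℚ (suc n) * (1ℚ - central n (c ℕ.+ 0))  ∎
    where open ℚ.≤-Reasoning
  central-tail n c (suc r) c+r≤n = begin
    fromℕℚ c * ∑< (suc r) (λ i → central n (suc (c ℕ.+ i)))
      ≡⟨ cong (fromℕℚ c *_) (∑<-last r _) ⟩
    fromℕℚ c * (∑< r (λ i → central n (suc (c ℕ.+ i))) + central n (suc (c ℕ.+ r)))
      ≡⟨ ℚ.*-distribˡ-+ (fromℕℚ c) _ _ ⟩
    fromℕℚ c * ∑< r (λ i → central n (suc (c ℕ.+ i))) + fromℕℚ c * central n (suc (c ℕ.+ r))
      ≤⟨ ℚ.+-mono-≤ (central-tail n c r (ℕ.≤-trans (ℕ.n≤1+n (c ℕ.+ r)) c+r<n)) (ℚ.≤-trans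
           (*-monoˡ (fromℕℚ c) (0≤fromℕℚ c) (∏-anti (0≤centralFactor n) (centralFactor≤1 n) (c ℕ.+ r)))
           (central-drop n c (c ℕ.+ r) (ℕ.m≤m+n c r) (ℕ.≤-trans (ℕ.n≤1+n (c ℕ.+ r)) c+r<n))) ⟩
    k * (1ℚ - central n (c ℕ.+ r)) + k * (central n (c ℕ.+ r) - central n (suc (c ℕ.+ r)))
      ≡⟨ solve 3 (λ k v w → k :* (con 1ℚ :- v) :+ k :* (v :- w) := k :* (con 1ℚ :- w)) refl k (central n (c ℕ.+ r)) (central n (suc (c ℕ.+ r))) ⟩
    k * (1ℚ - central n (suc (c ℕ.+ r)))
      ≡⟨ cong (λ m → k * (1ℚ - central n m)) (ℕ.+-suc c r) ⟨
    k * (1ℚ - central n (c ℕ.+ suc r)) ∎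
    where
    open ℚ.≤-Reasoning
    k = fromℕℚ (suc n)
    c+r<n : suc (c ℕ.+ r) ℕ.≤ suc n
    c+r<n = subst (ℕ._≤ suc n) (ℕ.+-suc c r) c+r≤n

  module _ (n₀ : ℕ) where

    private
      n h : ℕ
      n = 2 ℕ.+ n₀
      h = ⌊ suc n₀ /2⌋

    halfSum : ℚ
    halfSum = ∑[ 2 ⋯ ⌊ suc n /2⌋ ] (λ k → term (suc n) k)

    private
      even : ∀ i → i ℕ.< h → term (suc n) (2 ℕ.+ i) ≡ fall n (4 ℕ.+ 2 ℕ.* i)
      even i i<h = trans (term-fall n (2 ℕ.+ i) (subst (ℕ._≤ suc n) (sym (double i))
          (s≤s (s≤s (ℕ.≤-trans (subst (ℕ._≤ 2 ℕ.* h) (ℕ.*-suc 2 i) (ℕ.*-monoʳ-≤ 2 i<h)) (2*⌊n/2⌋≤n (suc n₀)))))))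
        (cong (fall n) (double i))
        where
        double : ∀ i → 2 ℕ.* (2 ℕ.+ i) ≡ 4 ℕ.+ 2 ℕ.* i
        double = solve-∀

      halfSum≡ : halfSum ≡ ∑< h (λ i → term (suc n) (2 ℕ.+ i))
      halfSum≡ = ∑-∑< 2 ⌊ suc n /2⌋ (λ k → term (suc n) k)

      doubled : halfSum + halfSum ≡ ∑< h (λ i → term (suc n) (2 ℕ.+ i) + term (suc n) (2 ℕ.+ i))
      doubled = trans (cong₂ _+_ halfSum≡ halfSum≡) (go h _)
        where
        go : ∀ m f → ∑< m f + ∑< m f ≡ ∑< m (λ i → f i + f i)
        go zero    f = refl
        go (suc m) f = trans (solve 2 (λ a s → (a :+ s) :+ (a :+ s) := (a :+ a) :+ (s :+ s)) refl (f 0) (∑< m (f ∘ suc)))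
          (cong (f 0 + f 0 +_) (go m (f ∘ suc)))

    N-bi-halfSum : fromℕℚ (N-bi (3 ℕ.+ n₀) 1ℤ) ≡ fromℕℚ ((3 ℕ.+ n₀) ℕ.^ (2 ℕ.+ n₀)) * halfSum
    N-bi-halfSum = trans (N-bi-exact n₀) (cong (fromℕℚ ((3 ℕ.+ n₀) ℕ.^ (2 ℕ.+ n₀)) *_) ∑≡halfSum)
      where
      ∑≡halfSum : ∑[ 2 ⋯ ⌊ 3 ℕ.+ n₀ /2⌋ ] (λ k → term (3 ℕ.+ n₀) k) ≡ halfSum
      ∑≡halfSum = refl

    0≤halfSum : 0ℚ ≤ halfSum
    0≤halfSum = subst (0ℚ ≤_) (sym halfSum≡) (subst (_≤ ∑< h (λ i → term (suc n) (2 ℕ.+ i))) (zeros h)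
      (∑<-mono h λ i i<h → subst (0ℚ ≤_) (sym (even i i<h)) (0≤fall n (4 ℕ.+ 2 ℕ.* i))))
      where
      zeros : ∀ m → ∑< m (λ _ → 0ℚ) ≡ 0ℚ
      zeros zero    = refl
      zeros (suc m) = trans (ℚ.+-identityˡ _) (zeros m)

    -- Since `fall` decreases, each doubled term is at most the sum of itself and its predecessor.
    -- The index `n ℕ.+ suc n` stands for N = 2 (n + 1).
    halfSum-upper : halfSum + halfSum ≤ centralSum (n ℕ.+ suc n)
    halfSum-upper = begin
      halfSum + halfSum
        ≡⟨ doubled ⟩
      ∑< h (λ i → term (suc n) (2 ℕ.+ i) + term (suc n) (2 ℕ.+ i))
        ≤⟨ ∑<-mono h (λ i i<h → subst (λ t → t + t ≤ fall n (3 ℕ.+ 2 ℕ.* i) + fall n (4 ℕ.+ 2 ℕ.* i)) (sym (even i i<h))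
             (ℚ.+-monoˡ-≤ (fall n (4 ℕ.+ 2 ℕ.* i)) (fall-anti n (3 ℕ.+ 2 ℕ.* i)))) ⟩
      ∑< h (λ i → fall n (3 ℕ.+ 2 ℕ.* i) + fall n (4 ℕ.+ 2 ℕ.* i))
        ≡⟨ ∑<-pairs h (λ m → fall n (3 ℕ.+ m)) ⟩
      ∑< (2 ℕ.* h) (λ m → fall n (3 ℕ.+ m))
        ≤⟨ ∑<-mono (2 ℕ.* h) (λ m _ → ∏-mono (0≤fallFactor n) (3 ℕ.+ m) (λ i _ → fallFactor≤centralFactor n i)) ⟩
      ∑< (2 ℕ.* h) (λ m → v (3 ℕ.+ m))
        ≤⟨ subst (_≤ ∑< 2 (v ∘ suc) + ∑< (2 ℕ.* h) (λ m → v (3 ℕ.+ m))) (ℚ.+-identityˡ _)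
             (ℚ.+-monoˡ-≤ _ (∑<-nonNeg 2 {v ∘ suc} (λ i → 0≤central (n ℕ.+ suc n) (suc i)))) ⟩
      ∑< 2 (v ∘ suc) + ∑< (2 ℕ.* h) (λ m → v (3 ℕ.+ m))
        ≡⟨ ∑<-split 2 (2 ℕ.* h) (v ∘ suc) ⟨
      ∑< (2 ℕ.+ 2 ℕ.* h) (v ∘ suc)
        ≤⟨ ∑<-mono-bound (λ i → 0≤central (n ℕ.+ suc n) (suc i)) (ℕ.≤-trans (ℕ.+-monoʳ-≤ 2 (2*⌊n/2⌋≤n (suc n₀))) (ℕ.m≤n+m (suc n) (suc n))) ⟩
      centralSum (n ℕ.+ suc n) ∎
      where
      open ℚ.≤-Reasoning
      v = central (n ℕ.+ suc n)

    -- Here each doubled term is at least the sum of itself and its successor. The 3 bounds t_1 +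
    -- t_2 + t_3, and `suc N` bounds c times the tail; the common factor c avoids a division.
    halfSum-lower : ∀ N c → suc N ℕ.+ c ≡ suc n ℕ.+ suc n → c ℕ.≤ suc n →
      fromℕℚ c * centralSum N ≤ fromℕℚ c * (halfSum + halfSum + fromℕℚ 3) + fromℕℚ (suc N)
    halfSum-lower N c eq c≤n = begin
      fromℕℚ c * ∑< (suc N) (v ∘ suc)
        ≡⟨ cong (fromℕℚ c *_) (trans (cong (λ m → ∑< m (v ∘ suc)) (sym (ℕ.m+[n∸m]≡n c≤N))) (∑<-split c (suc N ℕ.∸ c) (v ∘ suc))) ⟩
      fromℕℚ c * (∑< c (v ∘ suc) + tail)
        ≡⟨ ℚ.*-distribˡ-+ (fromℕℚ c) _ tail ⟩
      fromℕℚ c * ∑< c (v ∘ suc) + fromℕℚ c * tail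
        ≤⟨ ℚ.+-mono-≤ (*-monoˡ (fromℕℚ c) (0≤fromℕℚ c) head) (ℚ.≤-trans
             (central-tail N c (suc N ℕ.∸ c) (ℕ.≤-reflexive (ℕ.m+[n∸m]≡n c≤N))) (drop (v (c ℕ.+ (suc N ℕ.∸ c))) (0≤central N (c ℕ.+ (suc N ℕ.∸ c))))) ⟩
      fromℕℚ c * (halfSum + halfSum + fromℕℚ 3) + fromℕℚ (suc N) ∎
      where
      open ℚ.≤-Reasoning
      v = central N
      tail = ∑< (suc N ℕ.∸ c) (λ i → v (suc (c ℕ.+ i)))
      c≤N : c ℕ.≤ suc N
      c≤N = ℕ.+-cancelʳ-≤ c c (suc N) (ℕ.≤-trans (ℕ.+-mono-≤ c≤n c≤n) (ℕ.≤-reflexive (sym eq)))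
      drop : ∀ x → 0ℚ ≤ x → fromℕℚ (suc N) * (1ℚ - x) ≤ fromℕℚ (suc N)
      drop x 0≤x = begin
        fromℕℚ (suc N) * (1ℚ - x) ≤⟨ *-monoˡ (fromℕℚ (suc N)) (0≤fromℕℚ (suc N)) (ℚ.+-monoʳ-≤ 1ℚ (ℚ.neg-antimono-≤ 0≤x)) ⟩
        fromℕℚ (suc N) * 1ℚ       ≡⟨ ℚ.*-identityʳ _ ⟩
        fromℕℚ (suc N)            ∎
      t = fall n
      t≤1 : ∀ m → t m ≤ 1ℚ
      t≤1 = ∏≤1 (0≤fallFactor n) (fallFactor≤1 n)
      n≤ : ∀ n₀ → n₀ ℕ.≤ 2 ℕ.* ⌊ suc n₀ /2⌋
      n≤ zero          = z≤n
      n≤ (suc zero)    = s≤s z≤n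
      n≤ (suc (suc n)) = subst (suc (suc n) ℕ.≤_) (sym (ℕ.*-suc 2 ⌊ suc n /2⌋)) (s≤s (s≤s (n≤ n)))
      head : ∑< c (v ∘ suc) ≤ halfSum + halfSum + fromℕℚ 3
      head = begin
        ∑< c (v ∘ suc)
          ≤⟨ ∑<-mono c (λ m m<c → ∏-mono (0≤centralFactor N) (suc m) (λ i i≤m →
               centralFactor≤fallFactor n N c i eq (ℕ.≤-trans (ℕ.≤-pred i≤m) (ℕ.<⇒≤ m<c)))) ⟩
        ∑< c (t ∘ suc)
          ≤⟨ ∑<-mono-bound (λ i → 0≤fall n (suc i)) (ℕ.≤-trans c≤n (ℕ.+-monoʳ-≤ 3 (n≤ n₀))) ⟩
        ∑< (3 ℕ.+ 2 ℕ.* h) (t ∘ suc)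
          ≡⟨ ∑<-split 3 (2 ℕ.* h) (t ∘ suc) ⟩
        ∑< 3 (t ∘ suc) + ∑< (2 ℕ.* h) (λ m → t (4 ℕ.+ m))
          ≤⟨ ℚ.+-mono-≤ (∑<-mono 3 {t ∘ suc} {λ _ → 1ℚ} (λ i _ → t≤1 (suc i))) (ℚ.≤-reflexive (sym (∑<-pairs h (λ m → t (4 ℕ.+ m))))) ⟩
        fromℕℚ 3 + ∑< h (λ i → t (4 ℕ.+ 2 ℕ.* i) + t (5 ℕ.+ 2 ℕ.* i))
          ≤⟨ ℚ.+-monoʳ-≤ (fromℕℚ 3) (∑<-mono h (λ i i<h → subst (λ x → t (4 ℕ.+ 2 ℕ.* i) + t (5 ℕ.+ 2 ℕ.* i) ≤ x + x) (sym (even i i<h))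
               (ℚ.+-monoʳ-≤ (t (4 ℕ.+ 2 ℕ.* i)) (fall-anti n (4 ℕ.+ 2 ℕ.* i))))) ⟩
        fromℕℚ 3 + ∑< h (λ i → term (suc n) (2 ℕ.+ i) + term (suc n) (2 ℕ.+ i))
          ≡⟨ trans (cong (fromℕℚ 3 +_) (sym doubled)) (ℚ.+-comm (fromℕℚ 3) (halfSum + halfSum)) ⟩
        halfSum + halfSum + fromℕℚ 3 ∎

-- The asymptotic formula

module Asymptotics where

  open ExactFormula
  open RationalLemmas
  open WallisSums
  open HalfSums
  open import Defs using (fromℕℚ; ∏; wallisFactor; sqrtℚ; square; recipℚ; module ℚ-Lemmas; module Recip-Lemmas; module Sqrt-Lemmas; module Wallis-Lemmas; N-bi; fromℕ; fromℚ; √_; π; n^[n-½]; _∼_; ℝ; approx; _#0; abs; divide) renaming (_*_ to _*ℝ_; _-_ to _-ℝ_; _<_ to _<ℝ_)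
  open ℚ-Lemmas using (/-≤; /-*; *-mono; 0≤*; ≤+; *-pos; 0≤/; archimedean; half-pos; halves)
  open Recip-Lemmas using (recip-inverse)
  open Sqrt-Lemmas using (sqrtℚ-lower; sqrtℚ-upper; 0≤sqrtℚ; square-mono)
  open Wallis-Lemmas using (module Squeeze; wallisGap; 1≤wallisFactor; 1≤wallisGap; factor*gap≤gap; wallisGap≤)

  open import Data.Integer.Base as ℤ using (1ℤ)
  open import Data.Nat.Base as ℕ using (ℕ; suc; z≤n; s≤s)
  open import Data.Nat.DivMod using (m/n*n≤m; m≥n⇒m/n>0; m≡m%n+[m/n]*n; m%n<n)
  import Data.Nat.Properties as ℕ
  open import Data.Product.Base using (Σ; _,_; proj₁; proj₂)
  open import Data.Rational.Base using (ℚ; 0ℚ; 1ℚ; ½; _+_; _*_; _-_; -_; _/_; _≤_; _<_; ∣_∣)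
  import Data.Rational.Properties as ℚ
  open import Data.Rational.Solver using (module +-*-Solver)
  open +-*-Solver using (solve; _:=_; _:+_; _:*_; _:-_; :-_; con)
  open import Data.Sum.Base using (_⊎_; inj₁; inj₂)
  open import Relation.Binary.PropositionalEquality

  open Squeeze wallisFactor wallisGap 1≤wallisFactor 1≤wallisGap factor*gap≤gap ℚ.≤-refl wallisGap≤
    using (0≤∏; ∏≤∏*; upper; mono; anti)

  wallis : ℕ → ℚ
  wallis = ∏ wallisFactor

  ¼ : ℚ
  ¼ = ℤ.+ 1 / 4

  double-cancel-≤ : ∀ {p q} → p + p ≤ q + q → p ≤ q
  double-cancel-≤ {p} {q} h = *-cancelʳ-≤ (fromℕℚ 2) (0<fromℕℚ 1) (subst₂ _≤_ (twice p) (twice q) h)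
    where
    twice : ∀ p → p + p ≡ p * fromℕℚ 2
    twice = solve 1 (λ p → p :+ p := p :* con (fromℕℚ 2)) refl

  ∣∣≤-intro : ∀ {p q r} → p ≤ q + r → q - r ≤ p → ∣ p - q ∣ ≤ r
  ∣∣≤-intro {p} {q} {r} p≤ ≤p with ℚ.∣p∣≡p∨∣p∣≡-p (p - q)
  ... | inj₁ eq = subst (_≤ r) (sym eq) (subst (p - q ≤_) (solve 2 (λ q r → q :+ r :- q := r) refl q r) (ℚ.+-monoˡ-≤ (- q) p≤))
  ... | inj₂ eq = subst (_≤ r) (sym eq) (subst₂ _≤_
    (solve 3 (λ p q r → q :- r :+ (r :- p) := :- (p :- q)) refl p q r)
    (solve 2 (λ p r → p :+ (r :- p) := r) refl p r) (ℚ.+-monoˡ-≤ (r - p) ≤p))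

  module _ {κ q x s₁ s₂ D : ℚ} (0≤κ : 0ℚ ≤ κ) (κ≤1 : κ ≤ 1ℚ) (0≤D : 0ℚ ≤ D)
           {h : ℚ} (0≤h : 0ℚ ≤ h) (h≤ : h ≤ ¼ * κ) (¼≤s₁ : ¼ ≤ s₁) (¼≤s₂ : ¼ ≤ s₂)
           (0≤q : 0ℚ ≤ q) (0≤x : 0ℚ ≤ x) (q≤ : q ≤ square (s₁ + h)) (x≤ : x ≤ square (s₂ + h))
           (1≤κx : 1ℚ ≤ κ * x) (D≤ : square (D + D) ≤ (fromℕℚ 4 * x + 1ℚ) * q) where

    private
      0≤¼ : 0ℚ ≤ ¼
      0≤¼ = 0≤/ 1 3
      0≤1+κ : 0ℚ ≤ 1ℚ + κ
      0≤1+κ = ℚ.+-mono-≤ 0≤1 0≤κ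

      grow : ∀ {s y} → ¼ ≤ s → y ≤ square (s + h) → y ≤ square (s * (1ℚ + κ))
      grow {s} ¼≤s y≤ = ℚ.≤-trans y≤ (square-mono (s + h) (s * (1ℚ + κ)) (ℚ.+-mono-≤ 0≤s 0≤h) (begin
        s + h             ≤⟨ ℚ.+-monoʳ-≤ s (ℚ.≤-trans h≤ (*-monoʳ κ 0≤κ ¼≤s)) ⟩
        s + s * κ         ≡⟨ solve 2 (λ s κ → s :+ s :* κ := s :* (con 1ℚ :+ κ)) refl s κ ⟩
        s * (1ℚ + κ)      ∎))
        where
        open ℚ.≤-Reasoning
        0≤s = ℚ.≤-trans 0≤¼ ¼≤s

    -- Here q and x stand for π/8 and n, s₁ and s₂ for their roots computed up to h, and D for the
    -- sum. Rounding costs a factor 1 + κ per root, and replacing 4x + 1 by 4x at most another. The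
    -- constant 7 comes from (1 + κ)³ ≤ 1 + 7κ for κ ≤ 1.
    upper-estimate : D ≤ s₁ * s₂ + fromℕℚ 7 * κ * (s₁ * s₂)
    upper-estimate = double-cancel-≤ (ℚ.≤-trans
      (square-cancel-≤ {D + D} {y + y} (ℚ.+-mono-≤ 0≤y 0≤y) (begin
        square (D + D)
          ≤⟨ D≤ ⟩
        (fromℕℚ 4 * x + 1ℚ) * q
          ≤⟨ *-monoʳ q 0≤q (ℚ.+-monoʳ-≤ (fromℕℚ 4 * x) (ℚ.≤-trans 1≤κx
               (subst (κ * x ≤_) (solve 2 (λ κ x → κ :* x :+ con (fromℕℚ 3) :* (κ :* x) := con (fromℕℚ 4) :* (κ :* x)) refl κ x)
                 (≤+ (κ * x) (fromℕℚ 3 * (κ * x)) (0≤* (fromℕℚ 3) (κ * x) (0≤fromℕℚ 3) (0≤* κ x 0≤κ 0≤x)))))) ⟩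
        (fromℕℚ 4 * x + fromℕℚ 4 * (κ * x)) * q
          ≡⟨ solve 3 (λ κ x q → (con (fromℕℚ 4) :* x :+ con (fromℕℚ 4) :* (κ :* x)) :* q := (con 1ℚ :+ κ) :* con (fromℕℚ 4) :* (x :* q)) refl κ x q ⟩
        (1ℚ + κ) * fromℕℚ 4 * (x * q)
          ≤⟨ *-monoˡ ((1ℚ + κ) * fromℕℚ 4) (0≤* (1ℚ + κ) (fromℕℚ 4) 0≤1+κ (0≤fromℕℚ 4))
               (*-mono 0≤x (grow ¼≤s₂ x≤) 0≤q (grow ¼≤s₁ q≤)) ⟩
        (1ℚ + κ) * fromℕℚ 4 * (square (s₂ * (1ℚ + κ)) * square (s₁ * (1ℚ + κ)))
          ≤⟨ *-monoʳ _ (0≤* (square (s₂ * (1ℚ + κ))) (square (s₁ * (1ℚ + κ))) (0≤square (s₂ * (1ℚ + κ)) (0≤* s₂ (1ℚ + κ) 0≤s₂ 0≤1+κ)) (0≤square (s₁ * (1ℚ + κ)) (0≤* s₁ (1ℚ + κ) 0≤s₁ 0≤1+κ)))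
               (*-monoʳ (fromℕℚ 4) (0≤fromℕℚ 4) (subst (1ℚ + κ ≤_)
                 (solve 1 (λ κ → con 1ℚ :+ κ :+ κ :* (con 1ℚ :+ κ) := (con 1ℚ :+ κ) :* (con 1ℚ :+ κ)) refl κ)
                 (≤+ (1ℚ + κ) (κ * (1ℚ + κ)) (0≤* κ (1ℚ + κ) 0≤κ 0≤1+κ)))) ⟩
        (1ℚ + κ) * (1ℚ + κ) * fromℕℚ 4 * (square (s₂ * (1ℚ + κ)) * square (s₁ * (1ℚ + κ)))
          ≡⟨ solve 3 (λ e s t → e :* e :* con (fromℕℚ 4) :* ((t :* e) :* (t :* e) :* ((s :* e) :* (s :* e)))
               := (e :* (e :* e) :* (s :* t) :+ e :* (e :* e) :* (s :* t)) :* (e :* (e :* e) :* (s :* t) :+ e :* (e :* e) :* (s :* t)))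
               refl (1ℚ + κ) s₁ s₂ ⟩
        square (y + y) ∎))
      (ℚ.+-mono-≤ y≤ y≤))
      where
      open ℚ.≤-Reasoning
      β = s₁ * s₂
      y = (1ℚ + κ) * ((1ℚ + κ) * (1ℚ + κ)) * β
      0≤s₁ = ℚ.≤-trans 0≤¼ ¼≤s₁
      0≤s₂ = ℚ.≤-trans 0≤¼ ¼≤s₂
      0≤β = 0≤* s₁ s₂ 0≤s₁ 0≤s₂
      0≤square : ∀ p → 0ℚ ≤ p → 0ℚ ≤ square p
      0≤square p 0≤p = 0≤* p p 0≤p 0≤p
      0≤y : 0ℚ ≤ y
      0≤y = 0≤* _ β (0≤* (1ℚ + κ) _ 0≤1+κ (0≤* (1ℚ + κ) (1ℚ + κ) 0≤1+κ 0≤1+κ)) 0≤β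
      y≤ : y ≤ β + fromℕℚ 7 * κ * β
      y≤ = subst (y ≤_)
        (solve 2 (λ κ β → (con 1ℚ :+ κ) :* ((con 1ℚ :+ κ) :* (con 1ℚ :+ κ)) :* β :+ κ :* (con 1ℚ :- κ) :* (con (fromℕℚ 4) :+ κ) :* β
          := β :+ con (fromℕℚ 7) :* κ :* β) refl κ β)
        (≤+ y _ (0≤* _ β (0≤* _ (fromℕℚ 4 + κ) (0≤* κ (1ℚ - κ) 0≤κ (p≤q⇒0≤q-p κ≤1)) (ℚ.+-mono-≤ (0≤fromℕℚ 4) 0≤κ)) 0≤β))

  -- V is the sum of the v_m(k) for k = 2x - c, where c is about κ x.
  module _ {κ K q x k c s₁ s₂ D V : ℚ} (0≤κ : 0ℚ ≤ κ) (κK≡1 : κ * K ≡ 1ℚ) (0<x : 0ℚ < x) (0<c : 0ℚ < c) (0≤k : 0ℚ ≤ k)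
           (k+c≡2x : k + c ≡ x + x) (cK≤x : c * K ≤ x) (x≤2cK : x ≤ (c + c) * K)
           (0≤s₁ : 0ℚ ≤ s₁) (0≤s₂ : 0ℚ ≤ s₂) (s₁²≤q : square s₁ ≤ q) (s₂²≤x : square s₂ ≤ x)
           (0≤V : 0ℚ ≤ V) (2kq≤V² : (k + k) * q ≤ square V) (cV≤ : c * V ≤ c * (D + D + fromℕℚ 3) + k)
           (large : fromℕℚ 3 + fromℕℚ 4 * K ≤ κ * (s₁ * s₂)) where

    -- For β = s₁ s₂, comparing squares gives k β ≤ x V, hence (2 - κ) β ≤ V as c ≤ κ x. The tail
    -- contributes k / c ≤ 4K, so V ≤ 2D + 3 + 4K, and the hypothesis `large` absorbs the constant
    -- into a second κ β.
    lower-estimate : s₁ * s₂ - κ * (s₁ * s₂) ≤ D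
    lower-estimate = double-cancel-≤ (begin
      β - κ * β + (β - κ * β)
        ≡⟨ solve 2 (λ κ β → β :- κ :* β :+ (β :- κ :* β) := (β :+ β :- κ :* β) :- κ :* β) refl κ β ⟩
      (β + β - κ * β) - κ * β
        ≤⟨ ℚ.+-mono-≤ (ℚ.≤-trans β≤V V≤) (ℚ.neg-antimono-≤ large) ⟩
      D + D + fromℕℚ 3 + fromℕℚ 4 * K - (fromℕℚ 3 + fromℕℚ 4 * K)
        ≡⟨ solve 3 (λ D a b → D :+ D :+ a :+ b :- (a :+ b) := D :+ D) refl D (fromℕℚ 3) (fromℕℚ 4 * K) ⟩
      D + D ∎)
      where
      open ℚ.≤-Reasoning
      β = s₁ * s₂
      0≤x = ℚ.<⇒≤ 0<x
      0≤β = 0≤* s₁ s₂ 0≤s₁ 0≤s₂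
      k≤2x : k ≤ x + x
      k≤2x = subst (k ≤_) k+c≡2x (≤+ k c (ℚ.<⇒≤ 0<c))
      V≤ : V ≤ D + D + fromℕℚ 3 + fromℕℚ 4 * K
      V≤ = *-cancelʳ-≤ c 0<c (begin
        V * c                                              ≡⟨ ℚ.*-comm V c ⟩
        c * V                                              ≤⟨ cV≤ ⟩
        c * (D + D + fromℕℚ 3) + k                         ≤⟨ ℚ.+-monoʳ-≤ (c * (D + D + fromℕℚ 3)) (ℚ.≤-trans k≤2x (ℚ.+-mono-≤ x≤2cK x≤2cK)) ⟩
        c * (D + D + fromℕℚ 3) + ((c + c) * K + (c + c) * K)
          ≡⟨ solve 3 (λ c E K → c :* E :+ ((c :+ c) :* K :+ (c :+ c) :* K) := (E :+ con (fromℕℚ 4) :* K) :* c) refl c (D + D + fromℕℚ 3) K ⟩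
        (D + D + fromℕℚ 3 + fromℕℚ 4 * K) * c              ∎)
      c≤κx : c ≤ κ * x
      c≤κx = begin
        c             ≡⟨ trans (sym (ℚ.*-identityˡ c)) (cong (_* c) (sym κK≡1)) ⟩
        κ * K * c     ≡⟨ solve 3 (λ κ K c → κ :* K :* c := κ :* (c :* K)) refl κ K c ⟩
        κ * (c * K)   ≤⟨ *-monoˡ κ 0≤κ cK≤x ⟩
        κ * x         ∎
      s₁² = square s₁
      0≤s₁² = 0≤* s₁ s₁ 0≤s₁ 0≤s₁
      kβ≤xV : k * β ≤ x * V
      kβ≤xV = square-cancel-≤ (0≤* x V 0≤x 0≤V) (begin
        k * β * (k * β)
          ≡⟨ solve 3 (λ k s t → k :* (s :* t) :* (k :* (s :* t)) := k :* (s :* s) :* k :* (t :* t)) refl k s₁ s₂ ⟩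
        k * s₁² * k * (s₂ * s₂)
          ≤⟨ *-mono (0≤* (k * s₁²) k (0≤* k s₁² 0≤k 0≤s₁²) 0≤k) (*-monoˡ (k * s₁²) (0≤* k s₁² 0≤k 0≤s₁²) k≤2x) (0≤* s₂ s₂ 0≤s₂ 0≤s₂) s₂²≤x ⟩
        k * s₁² * (x + x) * x
          ≡⟨ solve 3 (λ k a x → k :* a :* (x :+ x) :* x := x :* x :* ((k :+ k) :* a)) refl k s₁² x ⟩
        x * x * ((k + k) * s₁²)
          ≤⟨ *-monoˡ (x * x) (0≤* x x 0≤x 0≤x) (ℚ.≤-trans (*-monoˡ (k + k) (ℚ.+-mono-≤ 0≤k 0≤k) s₁²≤q) 2kq≤V²) ⟩
        x * x * (V * V)
          ≡⟨ solve 2 (λ x V → x :* x :* (V :* V) := x :* V :* (x :* V)) refl x V ⟩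
        x * V * (x * V) ∎)
      β≤V : β + β - κ * β ≤ V
      β≤V = *-cancelʳ-≤ x 0<x (begin
        (β + β - κ * β) * x       ≡⟨ solve 3 (λ β κ x → (β :+ β :- κ :* β) :* x := (x :+ x) :* β :- κ :* x :* β) refl β κ x ⟩
        (x + x) * β - κ * x * β   ≤⟨ ℚ.+-monoʳ-≤ ((x + x) * β) (ℚ.neg-antimono-≤ (*-monoʳ β 0≤β c≤κx)) ⟩
        (x + x) * β - c * β       ≡⟨ cong (λ z → z * β - c * β) k+c≡2x ⟨
        (k + c) * β - c * β       ≡⟨ solve 3 (λ k c β → (k :+ c) :* β :- c :* β := k :* β) refl k c β ⟩
        k * β                     ≤⟨ kβ≤xV ⟩
        x * V                     ≡⟨ ℚ.*-comm x V ⟩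
        V * x                     ∎)

  wallisGap-cancel : ∀ n → let k = fromℕℚ n in wallisGap n * (k + k + 1ℚ) ≡ k + k + 1ℚ + 1ℚ
  wallisGap-cancel n = begin
    wallisGap n * (k + k + 1ℚ)             ≡⟨ cong (wallisGap n *_) odd ⟨
    wallisGap n * fromℕℚ (1 ℕ.+ 2 ℕ.* n)   ≡⟨ /-*-cancel (2 ℕ.+ 2 ℕ.* n) (2 ℕ.* n) ⟩
    fromℕℚ (2 ℕ.+ 2 ℕ.* n)                 ≡⟨ trans (fromℕℚ-suc (1 ℕ.+ 2 ℕ.* n)) (cong (_+ 1ℚ) odd) ⟩
    k + k + 1ℚ + 1ℚ                        ∎
    where
    open ≡-Reasoning
    k = fromℕℚ n
    odd : fromℕℚ (1 ℕ.+ 2 ℕ.* n) ≡ k + k + 1ℚ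
    odd = trans (fromℕℚ-suc (2 ℕ.* n)) (cong (_+ 1ℚ) (fromℕℚ-2* n))

  -- A quarter of the Wallis product, written in the shape of the m-th approximation of π/8 so that
  -- the two agree by computation.
  eighthπ : ℕ → ℚ
  eighthπ m = fromℕℚ 2 * wallis m * (ℤ.+ 1 / 8)

  4*eighthπ : ∀ m → fromℕℚ 4 * eighthπ m ≡ wallis m
  4*eighthπ m = solve 1 (λ w → con (fromℕℚ 4) :* (con (fromℕℚ 2) :* w :* con (ℤ.+ 1 / 8)) := w) refl (wallis m)

  0≤eighthπ : ∀ m → 0ℚ ≤ eighthπ m
  0≤eighthπ m = 0≤* (fromℕℚ 2 * wallis m) (ℤ.+ 1 / 8) (0≤* (fromℕℚ 2) (wallis m) (0≤fromℕℚ 2) (0≤∏ m)) (0≤/ 1 7)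

  1≤wallis : ∀ m → 1ℚ ≤ wallis m
  1≤wallis m = mono {0} {m} (ℕ.≤⇒≤′ z≤n)

  *-cancelˡ-≤ : ∀ {p q} r → 0ℚ < r → r * p ≤ r * q → p ≤ q
  *-cancelˡ-≤ {p} {q} r 0<r h = *-cancelʳ-≤ r 0<r (subst₂ _≤_ (ℚ.*-comm r p) (ℚ.*-comm r q) h)

  -- Wallis products increase, so the one of index N = n + 1 may be replaced by any later one; this
  -- makes the index m of the approximation to π independent of N.
  centralSum²-upper : ∀ n m → suc n ℕ.≤ m → let k = fromℕℚ (suc n) in
    square (centralSum n) ≤ (k + k + 1ℚ) * eighthπ m
  centralSum²-upper n m n<m = *-cancelˡ-≤ (fromℕℚ 4) (0<fromℕℚ 3) (begin
    fromℕℚ 4 * square (centralSum n)          ≡⟨ centralSum² n ⟩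
    (k + k + 1ℚ) * wallis (suc n)             ≤⟨ *-monoˡ (k + k + 1ℚ) (ℚ.<⇒≤ (0<2k+1 (suc n))) (mono (ℕ.≤⇒≤′ n<m)) ⟩
    (k + k + 1ℚ) * wallis m                   ≡⟨ cong ((k + k + 1ℚ) *_) (4*eighthπ m) ⟨
    (k + k + 1ℚ) * (fromℕℚ 4 * eighthπ m)     ≡⟨ solve 3 (λ a b c → a :* (b :* c) := b :* (a :* c)) refl (k + k + 1ℚ) (fromℕℚ 4) (eighthπ m) ⟩
    fromℕℚ 4 * ((k + k + 1ℚ) * eighthπ m)     ∎)
    where
    open ℚ.≤-Reasoning
    k = fromℕℚ (suc n)

  -- Wallis products multiplied by `wallisGap` decrease, so a later product exceeds that of index k
  -- by at most the factor (2k + 2) / (2k + 1); the claim then follows from 2k (2k + 2) ≤ (2k + 1)².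
  centralSum²-lower : ∀ n m → suc n ℕ.≤ m → let k = fromℕℚ (suc n) in
    (k + k) * eighthπ m ≤ square (centralSum n)
  centralSum²-lower n m n<m = *-cancelˡ-≤ (fromℕℚ 4 * g) (*-pos (0<fromℕℚ 3) 0<g) (begin
    fromℕℚ 4 * g * ((k + k) * eighthπ m)
      ≡⟨ solve 4 (λ f g e p → f :* g :* (e :* p) := e :* g :* (f :* p)) refl (fromℕℚ 4) g (k + k) (eighthπ m) ⟩
    (k + k) * g * (fromℕℚ 4 * eighthπ m)
      ≡⟨ cong ((k + k) * g *_) (4*eighthπ m) ⟩
    (k + k) * g * wallis m
      ≤⟨ *-mono {q = (k + k + 1ℚ) * (k + k + 1ℚ)} (0≤* (k + k) g (ℚ.+-mono-≤ 0≤k 0≤k) (ℚ.<⇒≤ 0<g))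
           (subst ((k + k) * g ≤_) (solve 1 (λ k → (k :+ k) :* (k :+ k :+ con 1ℚ :+ con 1ℚ) :+ con 1ℚ := (k :+ k :+ con 1ℚ) :* (k :+ k :+ con 1ℚ)) refl k)
             (≤+ ((k + k) * g) 1ℚ 0≤1))
           (0≤∏ m) (ℚ.≤-trans (∏≤∏* m (1≤wallisGap m)) (anti (ℕ.≤⇒≤′ n<m))) ⟩
    (k + k + 1ℚ) * (k + k + 1ℚ) * (wallis (suc n) * wallisGap (suc n))
      ≡⟨ solve 3 (λ o w z → o :* o :* (w :* z) := o :* w :* (z :* o)) refl (k + k + 1ℚ) (wallis (suc n)) (wallisGap (suc n)) ⟩
    (k + k + 1ℚ) * wallis (suc n) * (wallisGap (suc n) * (k + k + 1ℚ))
      ≡⟨ cong₂ _*_ (sym (centralSum² n)) (wallisGap-cancel (suc n)) ⟩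
    fromℕℚ 4 * square (centralSum n) * g
      ≡⟨ solve 3 (λ f v g → f :* v :* g := f :* g :* v) refl (fromℕℚ 4) (square (centralSum n)) g ⟩
    fromℕℚ 4 * g * square (centralSum n) ∎)
    where
    open ℚ.≤-Reasoning
    k = fromℕℚ (suc n)
    g = k + k + 1ℚ + 1ℚ
    0≤k = 0≤fromℕℚ (suc n)
    0<g : 0ℚ < g
    0<g = ℚ.<-≤-trans (0<2k+1 (suc n)) (≤+ (k + k + 1ℚ) 1ℚ 0≤1)

  sqrtℚ²≤ : ∀ n q → 0ℚ ≤ q → square (sqrtℚ n q) ≤ q
  sqrtℚ²≤ n q 0≤q = bound (sqrtℚ n q) (sqrtℚ-lower n q)
    where
    bound : ∀ s → (s ≡ 0ℚ) ⊎ (square s ≤ q) → square s ≤ q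
    bound s (inj₁ refl) = 0≤q
    bound s (inj₂ h)    = h

  root-≥ : ∀ {q s h a d} → 0ℚ ≤ s → 0ℚ ≤ h → q < square (s + h) → h ≤ d → square (a + d) ≤ q → a ≤ s
  root-≥ {q} {s} {h} {a} {d} 0≤s 0≤h q<  h≤d a²≤q = ℚ.≮⇒≥ λ s<a → ℚ.<-irrefl refl (begin-strict
    q                <⟨ q< ⟩
    square (s + h)   ≤⟨ square-mono (s + h) (s + d) (ℚ.+-mono-≤ 0≤s 0≤h) (ℚ.+-monoʳ-≤ s h≤d) ⟩
    square (s + d)   ≤⟨ square-mono (s + d) (a + d) (ℚ.+-mono-≤ 0≤s (ℚ.≤-trans 0≤h h≤d)) (ℚ.+-monoˡ-≤ d (ℚ.<⇒≤ s<a)) ⟩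
    square (a + d)   ≤⟨ a²≤q ⟩
    q                ∎)
    where
    open ℚ.≤-Reasoning

  -- It makes √n at least X, which outweighs the error 3 + 4 (K + 1) of the lower estimate.
  threshold : ℕ → ℕ
  threshold K = suc X ℕ.* suc X ℕ.+ suc K
    where X = 4 ℕ.* (suc K ℕ.* (3 ℕ.+ 4 ℕ.* suc K))

  module Estimate (K n₀ m : ℕ) {s₁ s₂ h : ℚ} (0≤s₁ : 0ℚ ≤ s₁) (0≤s₂ : 0ℚ ≤ s₂) (0≤h : 0ℚ ≤ h)
    (s₁²≤ : square s₁ ≤ eighthπ m) (<s₁+h² : eighthπ m < square (s₁ + h))
    (s₂²≤ : square s₂ ≤ fromℕℚ (3 ℕ.+ n₀)) (<s₂+h² : fromℕℚ (3 ℕ.+ n₀) < square (s₂ + h))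
    (h≤¼κ : h ≤ ¼ * (ℤ.+ 1 / suc K))
    (n-large : threshold K ℕ.≤ 3 ℕ.+ n₀) (2n≤m : (3 ℕ.+ n₀) ℕ.+ (3 ℕ.+ n₀) ℕ.≤ m) where

    private
      K₁ n X : ℕ
      K₁ = suc K
      n = 2 ℕ.+ n₀
      X = 4 ℕ.* (K₁ ℕ.* (3 ℕ.+ 4 ℕ.* K₁))
      κ x q D β : ℚ
      κ = ℤ.+ 1 / K₁
      x = fromℕℚ (suc n)
      q = eighthπ m
      D = halfSum n₀
      β = s₁ * s₂
      0≤κ : 0ℚ ≤ κ
      0≤κ = 0≤/ 1 K
      κK≡1 : κ * fromℕℚ K₁ ≡ 1ℚ
      κK≡1 = /-*-cancel 1 K
      κ≤1 : κ ≤ 1ℚ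
      κ≤1 = /-≤ {1} {K} {1} {0} (s≤s z≤n)
      0≤β : 0ℚ ≤ β
      0≤β = 0≤* s₁ s₂ 0≤s₁ 0≤s₂
      K₁≤n : K₁ ℕ.≤ suc n
      K₁≤n = ℕ.≤-trans (ℕ.m≤n+m K₁ (suc X ℕ.* suc X)) n-large
      h≤¼ : h ≤ ¼
      h≤¼ = ℚ.≤-trans h≤¼κ (subst (¼ * κ ≤_) (ℚ.*-identityʳ ¼) (*-monoˡ ¼ (0≤/ 1 3) κ≤1))
      ¼≤1 : ¼ ≤ 1ℚ
      ¼≤1 = /-≤ {1} {3} {1} {0} (s≤s z≤n)

      -- The threshold contains the square of `suc X`; the extra unit pays for the rounding error h
      -- ≤ 1.
      X≤s₂ : fromℕℚ X ≤ s₂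
      X≤s₂ = root-≥ 0≤s₂ 0≤h <s₂+h² (ℚ.≤-trans h≤¼ ¼≤1)
        (subst (_≤ x) (trans (fromℕℚ-* (suc X) (suc X)) (cong₂ _*_ (fromℕℚ-suc X) (fromℕℚ-suc X)))
          (fromℕℚ-mono (ℕ.≤-trans (ℕ.m≤m+n (suc X ℕ.* suc X) K₁) n-large)))

      -- As the Wallis products are at least 1, q ≥ ¼ = (¼ + ¼)²; one of these quarters covers the
      -- rounding error.
      ¼≤s₁ : ¼ ≤ s₁
      ¼≤s₁ = root-≥ 0≤s₁ 0≤h <s₁+h² h≤¼ (*-cancelˡ-≤ (fromℕℚ 4) (0<fromℕℚ 3)
        (subst (1ℚ ≤_) (sym (4*eighthπ m)) (1≤wallis m)))

      1≤s₂ : 1ℚ ≤ s₂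
      1≤s₂ = ℚ.≤-trans (fromℕℚ-mono {1} {X} (s≤s z≤n)) X≤s₂

      halfSum≤ : D ≤ β + fromℕℚ 7 * κ * β
      halfSum≤ = upper-estimate 0≤κ κ≤1 (0≤halfSum n₀) 0≤h h≤¼κ ¼≤s₁ (ℚ.≤-trans ¼≤1 1≤s₂)
        (0≤eighthπ m) (0≤fromℕℚ (suc n)) (ℚ.<⇒≤ <s₁+h²) (ℚ.<⇒≤ <s₂+h²)
        (subst (_≤ κ * x) κK≡1 (*-monoˡ κ 0≤κ (fromℕℚ-mono K₁≤n)))
        (begin
          square (D + D)
            ≤⟨ square-mono (D + D) (centralSum (n ℕ.+ suc n)) (ℚ.+-mono-≤ (0≤halfSum n₀) (0≤halfSum n₀)) (halfSum-upper n₀) ⟩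
          square (centralSum (n ℕ.+ suc n))
            ≤⟨ centralSum²-upper (n ℕ.+ suc n) m 2n≤m ⟩
          (fromℕℚ (suc n ℕ.+ suc n) + fromℕℚ (suc n ℕ.+ suc n) + 1ℚ) * q
            ≡⟨ cong (λ k → (k + k + 1ℚ) * q) (fromℕℚ-+ (suc n) (suc n)) ⟩
          (x + x + (x + x) + 1ℚ) * q
            ≡⟨ solve 2 (λ x q → (x :+ x :+ (x :+ x) :+ con 1ℚ) :* q := (con (fromℕℚ 4) :* x :+ con 1ℚ) :* q) refl x q ⟩
          (fromℕℚ 4 * x + 1ℚ) * q ∎)
        where open ℚ.≤-Reasoning

      Y c N : ℕ
      Y = 3 ℕ.+ 4 ℕ.* K₁
      -- Thus c is about κ n: small enough for N to stay near 2n, and large enough for the tail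
      -- bound N / c to be at most 4 K₁.
      c = suc n ℕ./ K₁
      N = (n ℕ.+ suc n) ℕ.∸ c
      1≤c : 1 ℕ.≤ c
      1≤c = m≥n⇒m/n>0 K₁≤n
      c≤n : c ℕ.≤ suc n
      c≤n = ℕ.≤-trans (ℕ.m≤m*n c K₁) (m/n*n≤m (suc n) K₁)
      N+c≡2n : suc N ℕ.+ c ≡ suc n ℕ.+ suc n
      N+c≡2n = cong suc (ℕ.m∸n+n≡m (ℕ.≤-trans c≤n (ℕ.m≤n+m (suc n) n)))
      -- Rounding the quotient down loses less than 1, hence at most a factor 2 because c ≥ 1.
      n≤2cK : suc n ℕ.≤ (c ℕ.+ c) ℕ.* K₁
      n≤2cK = ℕ.≤-trans (ℕ.≤-trans (ℕ.≤-reflexive (m≡m%n+[m/n]*n (suc n) K₁)) (ℕ.+-monoˡ-≤ (c ℕ.* K₁) (ℕ.<⇒≤ (m%n<n (suc n) K₁))))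
        (ℕ.*-monoˡ-≤ K₁ (ℕ.+-monoˡ-≤ c 1≤c))

      Y≤κβ : fromℕℚ 3 + fromℕℚ 4 * fromℕℚ K₁ ≤ κ * β
      Y≤κβ = begin
        fromℕℚ 3 + fromℕℚ 4 * fromℕℚ K₁
          ≡⟨ trans (cong (fromℕℚ 3 +_) (sym (fromℕℚ-* 4 K₁))) (sym (fromℕℚ-+ 3 (4 ℕ.* K₁))) ⟩
        fromℕℚ Y
          ≡⟨ trans (sym (ℚ.*-identityˡ (fromℕℚ Y))) (cong (_* fromℕℚ Y) (sym κK≡1)) ⟩
        κ * fromℕℚ K₁ * fromℕℚ Y
          -- The factor 4 in X compensates for the lower bound ¼ of s₁, the factor K₁ for κ.
          ≡⟨ solve 3 (λ κ K Y → κ :* K :* Y := κ :* (con ¼ :* (con (fromℕℚ 4) :* (K :* Y)))) refl κ (fromℕℚ K₁) (fromℕℚ Y) ⟩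
        κ * (¼ * (fromℕℚ 4 * (fromℕℚ K₁ * fromℕℚ Y)))
          ≡⟨ cong (λ z → κ * (¼ * z)) (trans (cong (fromℕℚ 4 *_) (sym (fromℕℚ-* K₁ Y))) (sym (fromℕℚ-* 4 (K₁ ℕ.* Y)))) ⟩
        κ * (¼ * fromℕℚ X)
          ≤⟨ *-monoˡ κ 0≤κ (*-mono (0≤/ 1 3) ¼≤s₁ (0≤fromℕℚ X) X≤s₂) ⟩
        κ * (s₁ * s₂) ∎
        where open ℚ.≤-Reasoning

      ≤halfSum : β - κ * β ≤ D
      ≤halfSum = lower-estimate 0≤κ κK≡1 (0<fromℕℚ n) (ℚ.<-≤-trans (0<fromℕℚ 0) (fromℕℚ-mono 1≤c)) (0≤fromℕℚ (suc N))
        (trans (sym (fromℕℚ-+ (suc N) c)) (trans (cong fromℕℚ N+c≡2n) (fromℕℚ-+ (suc n) (suc n))))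
        (subst (_≤ x) (fromℕℚ-* c K₁) (fromℕℚ-mono (m/n*n≤m (suc n) K₁)))
        (subst (x ≤_) (trans (fromℕℚ-* (c ℕ.+ c) K₁) (cong (_* fromℕℚ K₁) (fromℕℚ-+ c c))) (fromℕℚ-mono n≤2cK))
        0≤s₁ 0≤s₂ s₁²≤ s₂²≤
        (∑<-nonNeg (suc N) (λ i → 0≤central N (suc i)))
        (centralSum²-lower N m (ℕ.≤-trans (ℕ.m≤m+n (suc N) c) (ℕ.≤-trans (ℕ.≤-reflexive N+c≡2n) 2n≤m)))
        (halfSum-lower n₀ N c N+c≡2n c≤n)
        Y≤κβ

      close : ∣ D - β ∣ ≤ fromℕℚ 7 * κ * β
      close = ∣∣≤-intro halfSum≤ (ℚ.≤-trans (ℚ.+-monoʳ-≤ β (ℚ.neg-antimono-≤ κβ≤7κβ)) ≤halfSum)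
        where
        0≤κβ : 0ℚ ≤ κ * β
        0≤κβ = 0≤* κ β 0≤κ 0≤β
        κβ≤7κβ : κ * β ≤ fromℕℚ 7 * κ * β
        κβ≤7κβ = subst (κ * β ≤_) (solve 2 (λ κ β → κ :* β :+ con (fromℕℚ 6) :* (κ :* β) := con (fromℕℚ 7) :* κ :* β) refl κ β)
          (≤+ (κ * β) (fromℕℚ 6 * (κ * β)) (0≤* (fromℕℚ 6) (κ * β) (0≤fromℕℚ 6) 0≤κβ))

    scaled-≥ : ∀ {p} → 1ℚ ≤ p → ¼ ≤ s₁ * (p * s₂)
    scaled-≥ {p} 1≤p = *-mono {¼} {s₁} {1ℚ * 1ℚ} {p * s₂} (0≤/ 1 3) ¼≤s₁ 0≤1 (*-mono {1ℚ} {p} {1ℚ} {s₂} 0≤1 1≤p 0≤1 1≤s₂)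

    scaled-close : ∀ {p} → 0ℚ ≤ p → ∣ p * D - s₁ * (p * s₂) ∣ ≤ fromℕℚ 7 * κ * (s₁ * (p * s₂))
    scaled-close {p} 0≤p = begin
      ∣ p * D - s₁ * (p * s₂) ∣
        ≡⟨ cong ∣_∣ (solve 4 (λ p D s t → p :* D :- s :* (p :* t) := p :* (D :- s :* t)) refl p D s₁ s₂) ⟩
      ∣ p * (D - β) ∣
        ≡⟨ trans (ℚ.∣p*q∣≡∣p∣*∣q∣ p (D - β)) (cong (_* ∣ D - β ∣) (ℚ.0≤p⇒∣p∣≡p 0≤p)) ⟩
      p * ∣ D - β ∣
        ≤⟨ *-monoˡ p 0≤p close ⟩
      p * (fromℕℚ 7 * κ * (s₁ * s₂))
        ≡⟨ solve 4 (λ p e s t → p :* (e :* (s :* t)) := e :* (s :* (p :* t))) refl p (fromℕℚ 7 * κ) s₁ s₂ ⟩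
      fromℕℚ 7 * κ * (s₁ * (p * s₂)) ∎
      where open ℚ.≤-Reasoning

  quotient-close : ∀ {a b δ η} → 0ℚ < δ → δ ≤ b → ∣ a - b ∣ ≤ η * b → ∣ a * recipℚ b - 1ℚ ∣ ≤ η
  quotient-close {a} {b} {δ} {η} 0<δ δ≤b h = begin
    ∣ a * r - 1ℚ ∣         ≡⟨ cong (λ z → ∣ a * r - z ∣) rb≡1 ⟨
    ∣ a * r - r * b ∣      ≡⟨ cong ∣_∣ (solve 3 (λ a b r → a :* r :- r :* b := (a :- b) :* r) refl a b r) ⟩
    ∣ (a - b) * r ∣        ≡⟨ ℚ.∣p*q∣≡∣p∣*∣q∣ (a - b) r ⟩
    ∣ a - b ∣ * ∣ r ∣      ≤⟨ *-monoʳ ∣ r ∣ (ℚ.0≤∣p∣ r) h ⟩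
    η * b * ∣ r ∣          ≡⟨ ℚ.*-assoc η b ∣ r ∣ ⟩
    η * (b * ∣ r ∣)        ≡⟨ cong (λ z → η * (z * ∣ r ∣)) ∣b∣≡b ⟨
    η * (∣ b ∣ * ∣ r ∣)    ≡⟨ cong (η *_) (trans (ℚ.*-comm ∣ b ∣ ∣ r ∣) (trans (sym (ℚ.∣p*q∣≡∣p∣*∣q∣ r b)) (cong ∣_∣ rb≡1))) ⟩
    η * 1ℚ                 ≡⟨ ℚ.*-identityʳ η ⟩
    η                      ∎
    where
    open ℚ.≤-Reasoning
    r = recipℚ b
    ∣b∣≡b : ∣ b ∣ ≡ b
    ∣b∣≡b = ℚ.0≤p⇒∣p∣≡p (ℚ.≤-trans (ℚ.<⇒≤ 0<δ) δ≤b)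
    rb≡1 : r * b ≡ 1ℚ
    rb≡1 = recip-inverse 0<δ (subst (δ ≤_) (sym ∣b∣≡b) δ≤b)

  -- The summand 2n puts m beyond the indices of all Wallis products that occur in the bounds; 4 (K
  -- + 1) brings the rounding error 1 / (m + 1) of the roots below κ / 4.
  cutoff : ℕ → ℕ → ℕ
  cutoff K n = n ℕ.+ n ℕ.+ 4 ℕ.* suc K

  approx-* : ∀ x y m → approx (x *ℝ y) m ≡ approx x m * approx y m
  approx-* x y m = refl

  approx-√ : ∀ x m → approx (√ x) m ≡ sqrtℚ m (approx x m)
  approx-√ x m = refl

  approx-n^[n-½] : ∀ n m → approx (n^[n-½] n) m ≡ fromℕℚ (n ℕ.^ (n ℕ.∸ 1)) * approx (√ fromℕ n) m
  approx-n^[n-½] n m = approx-* (fromℕ (n ℕ.^ (n ℕ.∸ 1))) (√ fromℕ n) m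

  module _ (x : ℝ) (m : ℕ) where

    0≤approx-√ : 0ℚ ≤ approx (√ x) m
    0≤approx-√ = subst (0ℚ ≤_) (sym (approx-√ x m)) (0≤sqrtℚ m (approx x m))

    approx-√-lower : 0ℚ ≤ approx x m → square (approx (√ x) m) ≤ approx x m
    approx-√-lower 0≤ = subst (λ s → square s ≤ approx x m) (sym (approx-√ x m)) (sqrtℚ²≤ m (approx x m) 0≤)

    approx-√-upper : approx x m < square (approx (√ x) m + (ℤ.+ 1 / suc m))
    approx-√-upper = subst (λ s → approx x m < square (s + (ℤ.+ 1 / suc m))) (sym (approx-√ x m)) (sqrtℚ-upper m (approx x m))

  ratio→1 : ∀ a b (b#0 : b #0) {ε δ} M → 0ℚ < δ →
    (∀ m → M ℕ.≤ m → ∣ approx a m * recipℚ (approx b m) - 1ℚ ∣ + δ ≤ ε) → abs (divide a b b#0 -ℝ fromℕ 1) <ℝ fromℚ ε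
  ratio→1 a b b#0 {ε} {δ} M 0<δ h = δ , 0<δ , M , h

  #0-intro : ∀ b {δ} M → 0ℚ < δ → (∀ m → M ℕ.≤ m → δ ≤ approx b m) → b #0
  #0-intro b {δ} M 0<δ h = δ , 0<δ , M , λ m M≤m → ℚ.≤-trans (h m M≤m) (ℚ-Lemmas.p≤∣p∣ (approx b m))

  -- x = π / 8 and f = N-bi; they are parameters lest they be unfolded.
  module _ (x : ℝ) (x≡ : ∀ m → approx x m ≡ eighthπ m) (f : ℕ → ℕ)
           (f≡ : ∀ n → fromℕℚ (f (3 ℕ.+ n)) ≡ fromℕℚ ((3 ℕ.+ n) ℕ.^ (2 ℕ.+ n)) * halfSum n) where

    approx-limit : ∀ n m → approx (√ x *ℝ n^[n-½] n) m ≡ approx (√ x) m * (fromℕℚ (n ℕ.^ (n ℕ.∸ 1)) * approx (√ fromℕ n) m)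
    approx-limit n m = trans (approx-* (√ x) (n^[n-½] n) m) (cong (approx (√ x) m *_) (approx-n^[n-½] n m))

    module _ (K n₀ m : ℕ) (n-large : threshold K ℕ.≤ 3 ℕ.+ n₀) (m-large : cutoff K (3 ℕ.+ n₀) ℕ.≤ m) where

      private
        n = 3 ℕ.+ n₀
        p = fromℕℚ (n ℕ.^ (2 ℕ.+ n₀))
        h≤¼κ : ℤ.+ 1 / suc m ≤ ¼ * (ℤ.+ 1 / suc K)
        h≤¼κ = subst (ℤ.+ 1 / suc m ≤_) (sym (/-* 1 3 1 K)) (/-≤ {1} {m} {1} {K ℕ.+ 3 ℕ.* suc K}
          (ℕ.*-monoʳ-≤ 1 (ℕ.≤-trans (ℕ.m≤n+m (4 ℕ.* suc K) (n ℕ.+ n)) (ℕ.≤-trans m-large (ℕ.n≤1+n m)))))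
        module E = Estimate K n₀ m {approx (√ x) m} {approx (√ fromℕ n) m} {ℤ.+ 1 / suc m}
          (0≤approx-√ x m) (0≤approx-√ (fromℕ n) m) (0≤/ 1 m)
          (subst (square (approx (√ x) m) ≤_) (x≡ m) (approx-√-lower x m (subst (0ℚ ≤_) (sym (x≡ m)) (0≤eighthπ m))))
          (subst (_< square (approx (√ x) m + (ℤ.+ 1 / suc m))) (x≡ m) (approx-√-upper x m))
          (approx-√-lower (fromℕ n) m (0≤fromℕℚ n)) (approx-√-upper (fromℕ n) m)
          h≤¼κ n-large (ℕ.≤-trans (ℕ.m≤m+n (n ℕ.+ n) (4 ℕ.* suc K)) m-large)

      limit-≥ : ¼ ≤ approx (√ x *ℝ n^[n-½] n) m
      limit-≥ = subst (¼ ≤_) (sym (approx-limit n m)) (E.scaled-≥ {p} (fromℕℚ-mono {1} (ℕ.m^n>0 n (2 ℕ.+ n₀))))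

      ratio-close : ∣ fromℕℚ (f n) * recipℚ (approx (√ x *ℝ n^[n-½] n) m) - 1ℚ ∣ ≤ fromℕℚ 7 * (ℤ.+ 1 / suc K)
      ratio-close = quotient-close {fromℕℚ (f n)} {approx (√ x *ℝ n^[n-½] n) m} {¼} {fromℕℚ 7 * (ℤ.+ 1 / suc K)} (ℚ.positive⁻¹ ¼) limit-≥
        (subst₂ (λ a b → ∣ a - b ∣ ≤ fromℕℚ 7 * (ℤ.+ 1 / suc K) * b)
          (sym (f≡ n₀)) (sym (approx-limit n m)) (E.scaled-close {p} (0≤fromℕℚ (n ℕ.^ (2 ℕ.+ n₀)))))

    asymptotic : (λ n → fromℕ (f n)) ∼ (λ n → √ x *ℝ n^[n-½] n)
    asymptotic ε 0<ε = 3 ℕ.+ threshold K , bounds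
      where
      -- With κ at most ε / 14 the relative error 7κ is at most ε / 2; the other half of ε is the
      -- gap required by the strict order on the reals.
      1/14 = ℤ.+ 1 / 14
      small = archimedean (*-pos {ε} {1/14} 0<ε (ℚ.positive⁻¹ 1/14))
      K = proj₁ small
      7κ≤½ε : fromℕℚ 7 * (ℤ.+ 1 / suc K) ≤ ½ * ε
      7κ≤½ε = subst (fromℕℚ 7 * (ℤ.+ 1 / suc K) ≤_)
        (solve 1 (λ ε → con (fromℕℚ 7) :* (ε :* con 1/14) := con ½ :* ε) refl ε)
        (*-monoˡ (fromℕℚ 7) (0≤fromℕℚ 7) (proj₂ small K ℕ.≤-refl))
      bounds : ∀ n → 3 ℕ.+ threshold K ℕ.≤ n →
        Σ ((√ x *ℝ n^[n-½] n) #0) λ n#0 → abs (divide (fromℕ (f n)) (√ x *ℝ n^[n-½] n) n#0 -ℝ fromℕ 1) <ℝ fromℚ ε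
      bounds (suc (suc (suc n₀))) (s≤s (s≤s (s≤s n₀-large))) = n#0 ,
        ratio→1 (fromℕ (f n)) (√ x *ℝ n^[n-½] n) n#0 (cutoff K n) (half-pos 0<ε) λ m m-large →
          subst (∣ fromℕℚ (f n) * recipℚ (approx (√ x *ℝ n^[n-½] n) m) - 1ℚ ∣ + ½ * ε ≤_) (halves ε)
            (ℚ.+-monoˡ-≤ (½ * ε) (ℚ.≤-trans (ratio-close K n₀ m n-large m-large) 7κ≤½ε))
        where
        n = 3 ℕ.+ n₀
        n-large : threshold K ℕ.≤ n
        n-large = ℕ.≤-trans n₀-large (ℕ.m≤n+m n₀ 3)
        n#0 : (√ x *ℝ n^[n-½] n) #0
        n#0 = #0-intro (√ x *ℝ n^[n-½] n) (cutoff K n) (ℚ.positive⁻¹ ¼) λ m → limit-≥ K n₀ m n-large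

  eighth : ∀ m → approx (π *ℝ fromℚ (ℤ.+ 1 / 8)) m ≡ eighthπ m
  eighth m = refl

  N-bi-asymptotic : (λ n → fromℕ (N-bi n 1ℤ)) ∼ (λ n → √ (π *ℝ fromℚ (ℤ.+ 1 / 8)) *ℝ n^[n-½] n)
  N-bi-asymptotic = asymptotic (π *ℝ fromℚ (ℤ.+ 1 / 8)) eighth (λ n → N-bi n 1ℤ) N-bi-halfSum

open import Defs
open import Data.Integer.Base using (+_; 1ℤ)
open import Data.Nat.Base as ℕ using (ℕ; NonZero; ⌊_/2⌋; _≤_; _^_; _∸_; s≤s)
open import Data.Product.Base using (_×_; _,_)
open import Data.Rational.Base as ℚ using (_/_)
open import Relation.Binary.PropositionalEquality using (_≡_)

theorem1p3 : (∀ (n : ℕ) .{{_ : NonZero n}} → 4 ≤ n →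
    fromℕℚ (N-bi n 1ℤ) ≡ fromℕℚ (n ^ (n ∸ 1)) ℚ.* ∑[ 2 ⋯ ⌊ n /2⌋ ] (λ k → term n k))
    ×
    (λ n → fromℕ (N-bi n 1ℤ)) ∼ (λ n → √ (π * fromℚ (+ 1 / 8)) * n^[n-½] n)
theorem1p3 = (λ { (ℕ.suc (ℕ.suc (ℕ.suc n))) _ → ExactFormula.N-bi-exact n
                ; (ℕ.suc (ℕ.suc ℕ.zero)) (s≤s (s≤s ())) ; (ℕ.suc ℕ.zero) (s≤s ()) }) , Asymptotics.N-bi-asymptotic
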